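{- Let $q \geq 3$ be a prime power and $k \geq 5$. Let $Y$ be an independent set of $qK_{2k:k}$ (i.e. a family of $k$-dimensional subspaces of $\mathbb{F}_q^{2k}$ any two of which intersect nontrivially). If $Y$ is not contained in a dictator or in the dual of a dictator, then \[ |Y| < (1 + 3q^{ -1}) \begin{bmatrix} k \\ 1 \end{bmatrix} \begin{bmatrix} 2k-2 \\ k-2 \end{bmatrix}. \]
   Context: The $q$-Kneser graph $qK_{2k:k}$ has as vertices the $k$-dimensional subspaces of $\mathbb{F}_q^{2k}$, adjacent iff they intersect trivially. The Gaussian binomial coefficient is $\begin{bmatrix} n \\ m \end{bmatrix} = \prod_{i=1}^m \frac{q^{n-i+1}-1}{q^i-1}$, the number of $m$-dimensional subspaces of $\mathbb{F}_q^n$. A dictator is the set of all $k$-subspaces containing a fixed $1$-dimensional subspace (point); the dual of a dictator is the set of all $k$-subspaces contained in a fixed $(2k-1)$-dimensional subspace (hyperplane). -}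

module Defs where

open import Data.Nat using (ℕ; zero; suc; _*_; _∸_; _^_; _/_; _≤_)
open import Data.Nat.Primality using (Prime)
open import Data.Fin using (Fin)
import Data.Fin as Fin
open import Data.Vec using (Vec; replicate; zipWith; map)
open import Data.Product using (Σ; ∃; _×_)
open import Function using (_∘_)
open import Function.Bundles using (_↔_)
open import Algebra.Core using (Op₁; Op₂)
open import Algebra.Structures using (IsCommutativeRing)
open import Relation.Binary.PropositionalEquality using (_≡_; _≢_)
open import Relation.Nullary using (¬_)

IsPrimePower : ℕ → Set
IsPrimePower q = Σ ℕ λ p → Σ ℕ λ e → Prime p × 1 ≤ e × q ≡ p ^ e

record FiniteField (q : ℕ) : Set₁ where
  field
    Carrier : Set
    _+F_ _*F_ : Op₂ Carrier
    -F_ : Op₁ Carrier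
    0# 1# : Carrier
    isCommutativeRing : IsCommutativeRing _≡_ _+F_ _*F_ -F_ 0# 1#
    0≢1 : 0# ≢ 1#
    inverse : ∀ x → x ≢ 0# → ∃ λ y → x *F y ≡ 1#
    enumeration : Carrier ↔ Fin q

module Linear {q : ℕ} (F : FiniteField q) (n : ℕ) where
  open FiniteField F

  V : Set
  V = Vec Carrier n

  zeroV : V
  zeroV = replicate n 0#

  _+V_ : V → V → V
  _+V_ = zipWith _+F_

  _·_ : Carrier → V → V
  a · v = map (a *F_) v

  lincomb : ∀ {d} → (Fin d → Carrier) → (Fin d → V) → V
  lincomb {zero} c b = zeroV
  lincomb {suc d} c b = (c Fin.zero · b Fin.zero) +V lincomb (c ∘ Fin.suc) (b ∘ Fin.suc)

  LinIndep : ∀ {d} → (Fin d → V) → Set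
  LinIndep b = ∀ c → lincomb c b ≡ zeroV → ∀ i → c i ≡ 0#

  Sub : Set₁
  Sub = V → Set

  IsSubspaceOfDim : ℕ → Sub → Set
  IsSubspaceOfDim d P = Σ (Fin d → V) λ b → LinIndep b ×
    (∀ v → (P v → ∃ λ c → v ≡ lincomb c b) × ((∃ λ c → v ≡ lincomb c b) → P v))

  SameSub : Sub → Sub → Set
  SameSub P Q = ∀ v → (P v → Q v) × (Q v → P v)

  _⊆_ : Sub → Sub → Set
  P ⊆ Q = ∀ v → P v → Q v

  IntersectNontrivially : Sub → Sub → Set
  IntersectNontrivially P Q = Σ V λ v → v ≢ zeroV × P v × Q v

  InDictator : ∀ {m} → (Fin m → Sub) → Set₁
  InDictator Y = Σ Sub λ P → IsSubspaceOfDim 1 P × (∀ i → P ⊆ Y i)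

  InDualDictator : ∀ {m} → (Fin m → Sub) → Set₁
  InDualDictator Y = Σ Sub λ H → IsSubspaceOfDim (n ∸ 1) H × (∀ i → Y i ⊆ H)

gaussNum : ℕ → ℕ → ℕ → ℕ
gaussNum q n zero = 1
gaussNum q n (suc m) = gaussNum q n m * (q ^ (n ∸ m) ∸ 1)

gaussDen : ℕ → ℕ → ℕ
gaussDen q zero = 1
gaussDen q (suc m) = gaussDen q m * (q ^ suc m ∸ 1)

-- division (only used with nonzero, exactly dividing denominators; 0 for divisor 0)
_div_ : ℕ → ℕ → ℕ
a div zero = 0
a div suc d = a / suc d

gauss : ℕ → ℕ → ℕ → ℕ
gauss q n m = gaussNum q n m div gaussDen q m

{-# OPTIONS --safe #-}

-- A k-space x is the kernel of exactly γ = |GL(k,q)| matrices W ∈ Vᵏ, namely the bases of x⊥.  Hence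
-- a sum over the family Y is at most γ⁻¹ times the same sum over all W, where the rows are independent
-- and moments can be computed exactly from the sizes of spans.
--
-- Let D(v) be the number of members of Y containing v, and let f be D, centred and set to 0 at 0.  The
-- sum φ of f over any x ∈ Y is large, since x meets all of Y.  On the other hand G(W), the sum of
-- f(v) f(w) over the independent pairs v, w in the kernel of W, has a second moment governed by the
-- sums of f over hyperplanes, that is, by the number of members of Y inside each hyperplane.  So Y is
-- small when no point lies on, and no hyperplane contains, at least |Y| / (2q + 2) members.
--
-- Otherwise, replacing Y by {y⊥ | y ∈ Y} if necessary, some point p lies on that many members.  It does
-- not lie on all of them, and counting through a member that misses p shows that at most
-- [k 1] [2k-2 k-2] members contain p.  The members on p and those off p are cross-intersecting, and two
-- variance computations bound the product of their numbers, so that few members miss p.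

module Submission where

open import Defs

-- The variance of φ alone bounds |Y| only by about the size of a dictator, a factor of order q
-- above the target, since dictators do have that size. Heavy points must be told apart from light
-- ones, hence the sum over pairs, whose second moment is of fourth order in f. It is accessible
-- because two independent pairs together span dimension 2, 3 or 4 only: the k-th power of the
-- number of vectors orthogonal to all four is an affine function of that number plus a correction
-- for coinciding planes. The linear part is the same moment with one row instead of k, hence a sum
-- over hyperplanes; the constant part is negative and is dropped.
--
-- The constant 3 acts as follows. If |Y| is at least 1 + 3/q times the bound for the members on p,
-- then at least 3 |Y| / (q + 3) members miss p, which has to contradict the product bound. That
-- bound wants the threshold |Y| / (2q + 2) high, the case without heavy points wants it low. The
-- hypothesis on k acts through Q ≥ q⁵. Everything is an integer with denominators cleared, and
-- sizes stand in for dimensions.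

module Development where

  open import Data.Nat using (ℕ; zero; suc)
  import Data.Nat as ℕ
  import Data.Nat.DivMod as ℕ
  import Data.Nat.Properties as ℕ
  import Data.Nat.Tactic.RingSolver as ℕ
  open import Data.Fin using (Fin)
  import Data.Fin as Fin
  import Data.Fin.Properties as Fin
  open import Data.Integer using (ℤ; +_; 0ℤ; 1ℤ; -1ℤ; _+_; _*_; _-_; -_; _^_; _≤_; _<_; _≤?_; +≤+; +<+; nonNegative; positive)
  open import Data.Integer.Properties hiding (_≟_)
  open import Data.Integer.Tactic.RingSolver using (solve-∀)
  open import Data.List using (List; []; _∷_; _++_; map; concatMap; allFin; tabulate)
  open import Data.Vec using (Vec; []; _∷_; replicate; zipWith)
  import Data.Vec as Vec
  import Data.Vec.Properties as Vec
  open import Data.Product using (∃; _×_; _,_; proj₁; proj₂)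
  open import Data.Sum using (_⊎_; inj₁; inj₂)
  open import Data.Unit using (⊤; tt)
  open import Data.Empty using (⊥; ⊥-elim)
  open import Function using (_∘_)
  open import Function.Bundles using (_↔_; Inverse)
  open import Algebra.Bundles using (CommutativeRing)
  import Algebra.Properties.Ring
  open import Relation.Binary using (DecidableEquality)
  open import Relation.Binary.PropositionalEquality
  open import Relation.Nullary using (¬_; Dec; yes; no)
  open import Relation.Nullary.Decidable using (map′; _×-dec_; _→-dec_; ¬?; decidable-stable)

  -- Ordered arithmetic of the integers

  ≤-witness : ∀ {x y} z → 0ℤ ≤ z → y ≡ x + z → x ≤ y
  ≤-witness {x} z 0≤z refl = subst (_≤ x + z) (+-identityʳ x) (+-monoʳ-≤ x 0≤z)

  *-monoˡ : ∀ {c x y} → 0ℤ ≤ c → x ≤ y → c * x ≤ c * y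
  *-monoˡ {c} 0≤c = *-monoˡ-≤-nonNeg c {{nonNegative 0≤c}}

  *-nonneg : ∀ {x y} → 0ℤ ≤ x → 0ℤ ≤ y → 0ℤ ≤ x * y
  *-nonneg {x} {y} 0≤x 0≤y = subst (_≤ x * y) (*-zeroʳ x) (*-monoˡ 0≤x 0≤y)

  +-nonneg : ∀ {x y} → 0ℤ ≤ x → 0ℤ ≤ y → 0ℤ ≤ x + y
  +-nonneg = +-mono-≤

  *-mono : ∀ {a b c d} → 0ℤ ≤ a → 0ℤ ≤ d → a ≤ b → c ≤ d → a * c ≤ b * d
  *-mono {a} {b} {c} {d} 0≤a 0≤d a≤b c≤d = ≤-trans (*-monoˡ 0≤a c≤d)
    (subst₂ _≤_ (*-comm d a) (*-comm d b) (*-monoˡ 0≤d a≤b))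

  square-nonneg : ∀ x → 0ℤ ≤ x * x
  square-nonneg x with 0ℤ ≤? x
  ... | yes p = *-nonneg p p
  ... | no  p = subst (0ℤ ≤_) (neg-square x) (*-nonneg 0≤-x 0≤-x)
    where
    0≤-x : 0ℤ ≤ - x
    0≤-x = neg-mono-≤ (<⇒≤ (≰⇒> p))
    neg-square : ∀ x → (- x) * (- x) ≡ x * x
    neg-square = solve-∀

  *-cancelˡ-≤ : ∀ {c x y} → 0ℤ < c → c * x ≤ c * y → x ≤ y
  *-cancelˡ-≤ {c} {x} {y} 0<c = *-cancelˡ-≤-pos x y c {{positive 0<c}}

  *-pos : ∀ {x y} → 0ℤ < x → 0ℤ < y → 0ℤ < x * y
  *-pos {x} {y} 0<x 0<y = subst (_< x * y) (*-zeroʳ x) (*-monoˡ-<-pos x {{positive 0<x}} 0<y)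

  *-cancelˡ : ∀ {c x y} → 0ℤ < c → c * x ≡ c * y → x ≡ y
  *-cancelˡ 0<c e = ≤-antisym (*-cancelˡ-≤ 0<c (≤-reflexive e)) (*-cancelˡ-≤ 0<c (≤-reflexive (sym e)))

  ^-pos : ∀ {x} n → 0ℤ < x → 0ℤ < x ^ n
  ^-pos zero    _   = +<+ (ℕ.s≤s ℕ.z≤n)
  ^-pos (suc n) 0<x = *-pos 0<x (^-pos n 0<x)

  *-^ : ∀ x y n → (x * y) ^ n ≡ x ^ n * y ^ n
  *-^ x y zero    = refl
  *-^ x y (suc n) = trans (cong ((x * y) *_) (*-^ x y n)) (lemma x y (x ^ n) (y ^ n))
    where
    lemma : ∀ a b c d → a * b * (c * d) ≡ a * c * (b * d)
    lemma = solve-∀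

  ≤-by-diff : ∀ {x y} → 0ℤ ≤ y - x → x ≤ y
  ≤-by-diff = 0≤i-j⇒j≤i

  diff-≥0 : ∀ {x y} → x ≤ y → 0ℤ ≤ y - x
  diff-≥0 = i≤j⇒0≤j-i

  0≤1 : 0ℤ ≤ 1ℤ
  0≤1 = +≤+ ℕ.z≤n

  -- For `s` the size of a space over a field of `q` elements, this is the number of its ordered
  -- independent `j`-tuples. In particular `falling q (q ^ k) k` is the order of GL(k,q).
  falling : ℤ → ℤ → ℕ → ℤ
  falling q s zero    = 1ℤ
  falling q s (suc j) = (s - q ^ j) * falling q s j

  -- Indicators of decidable propositions

  𝟙 : {P : Set} → Dec P → ℤ
  𝟙 (yes _) = 1ℤ
  𝟙 (no _)  = 0ℤ

  module _ {P : Set} where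

    𝟙-yes : (d : Dec P) → P → 𝟙 d ≡ 1ℤ
    𝟙-yes (yes _) _ = refl
    𝟙-yes (no ¬p) p = ⊥-elim (¬p p)

    𝟙-no : (d : Dec P) → ¬ P → 𝟙 d ≡ 0ℤ
    𝟙-no (yes p) ¬p = ⊥-elim (¬p p)
    𝟙-no (no _)  _  = refl

    𝟙-true : (d : Dec P) → 𝟙 d ≡ 1ℤ → P
    𝟙-true (yes p) _ = p

    𝟙-nonneg : (d : Dec P) → 0ℤ ≤ 𝟙 d
    𝟙-nonneg (yes _) = 0≤1
    𝟙-nonneg (no _)  = ≤-refl

    𝟙-≤1 : (d : Dec P) → 𝟙 d ≤ 1ℤ
    𝟙-≤1 (yes _) = ≤-refl
    𝟙-≤1 (no _)  = 0≤1

    𝟙-*-cong : (d : Dec P) {x y : ℤ} → (P → x ≡ y) → 𝟙 d * x ≡ 𝟙 d * y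
    𝟙-*-cong (yes p) h = cong (1ℤ *_) (h p)
    𝟙-*-cong (no _)  h = refl

    𝟙-*-mono : (d : Dec P) {x y : ℤ} → (P → x ≤ y) → 𝟙 d * x ≤ 𝟙 d * y
    𝟙-*-mono (yes p) h = *-monoˡ 0≤1 (h p)
    𝟙-*-mono (no _)  h = ≤-refl

  𝟙-mono : {P Q : Set} (d : Dec P) (e : Dec Q) → (P → Q) → 𝟙 d ≤ 𝟙 e
  𝟙-mono (yes p) e f = ≤-reflexive (sym (𝟙-yes e (f p)))
  𝟙-mono (no _)  e f = 𝟙-nonneg e

  𝟙-cong : {P Q : Set} (d : Dec P) (e : Dec Q) → (P → Q) → (Q → P) → 𝟙 d ≡ 𝟙 e
  𝟙-cong d e f g = ≤-antisym (𝟙-mono d e f) (𝟙-mono e d g)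

  𝟙-× : {P A B : Set} (d : Dec P) (a : Dec A) (b : Dec B) → (P → A × B) → (A → B → P) → 𝟙 d ≡ 𝟙 a * 𝟙 b
  𝟙-× d (yes a) (yes b) f g = 𝟙-yes d (g a b)
  𝟙-× d (yes a) (no ¬b) f g = 𝟙-no d (¬b ∘ proj₂ ∘ f)
  𝟙-× d (no ¬a) b       f g = 𝟙-no d (¬a ∘ proj₁ ∘ f)

  𝟙-¬ : {P Q : Set} (d : Dec P) (e : Dec Q) → (P → ¬ Q) → (¬ Q → P) → 𝟙 d ≡ 1ℤ - 𝟙 e
  𝟙-¬ d (yes r) f g = 𝟙-no d (λ p → f p r)
  𝟙-¬ d (no ¬r) f g = 𝟙-yes d (g ¬r)

  -- Finite sums

  sumL : {A : Set} → List A → (A → ℤ) → ℤ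
  sumL []       f = 0ℤ
  sumL (x ∷ xs) f = f x + sumL xs f

  module _ {A : Set} where

    sumL-cong : ∀ (xs : List A) {f g : A → ℤ} → (∀ x → f x ≡ g x) → sumL xs f ≡ sumL xs g
    sumL-cong []       h = refl
    sumL-cong (x ∷ xs) h = cong₂ _+_ (h x) (sumL-cong xs h)

    sumL-mono : ∀ (xs : List A) {f g : A → ℤ} → (∀ x → f x ≤ g x) → sumL xs f ≤ sumL xs g
    sumL-mono []       h = ≤-refl
    sumL-mono (x ∷ xs) h = +-mono-≤ (h x) (sumL-mono xs h)

    sumL-0 : ∀ (xs : List A) → sumL xs (λ _ → 0ℤ) ≡ 0ℤ
    sumL-0 []       = refl
    sumL-0 (x ∷ xs) = trans (+-identityˡ _) (sumL-0 xs)

    sumL-+ : ∀ (xs : List A) (f g : A → ℤ) → sumL xs (λ x → f x + g x) ≡ sumL xs f + sumL xs g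
    sumL-+ []       f g = refl
    sumL-+ (x ∷ xs) f g = trans (cong (_+_ (f x + g x)) (sumL-+ xs f g)) (lemma (f x) (g x) _ _)
      where
      lemma : ∀ a b c d → a + b + (c + d) ≡ a + c + (b + d)
      lemma = solve-∀

    sumL-* : ∀ (xs : List A) c (f : A → ℤ) → sumL xs (λ x → c * f x) ≡ c * sumL xs f
    sumL-* []       c f = sym (*-zeroʳ c)
    sumL-* (x ∷ xs) c f = trans (cong (_+_ (c * f x)) (sumL-* xs c f)) (sym (*-distribˡ-+ c (f x) _))

    sumL-++ : ∀ (xs ys : List A) (f : A → ℤ) → sumL (xs ++ ys) f ≡ sumL xs f + sumL ys f
    sumL-++ []       ys f = sym (+-identityˡ _)
    sumL-++ (x ∷ xs) ys f = trans (cong (_+_ (f x)) (sumL-++ xs ys f)) (sym (+-assoc (f x) _ _))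

  module _ {A B : Set} where

    sumL-swap : ∀ (xs : List A) (ys : List B) (f : A → B → ℤ) →
      sumL xs (λ x → sumL ys (f x)) ≡ sumL ys (λ y → sumL xs (λ x → f x y))
    sumL-swap []       ys f = sym (sumL-0 ys)
    sumL-swap (x ∷ xs) ys f = trans (cong (_+_ (sumL ys (f x))) (sumL-swap xs ys f))
      (sym (sumL-+ ys (f x) _))

    sumL-map : ∀ (xs : List A) (h : A → B) (f : B → ℤ) → sumL (map h xs) f ≡ sumL xs (f ∘ h)
    sumL-map []       h f = refl
    sumL-map (x ∷ xs) h f = cong (_+_ (f (h x))) (sumL-map xs h f)

    sumL-concatMap : ∀ (xs : List A) (h : A → List B) (f : B → ℤ) →
      sumL (concatMap h xs) f ≡ sumL xs (λ x → sumL (h x) f)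
    sumL-concatMap []       h f = refl
    sumL-concatMap (x ∷ xs) h f = trans (sumL-++ (h x) (concatMap h xs) f)
      (cong (_+_ (sumL (h x) f)) (sumL-concatMap xs h f))

  -- The single equation `once` says both that every element is listed and that none is listed
  -- twice, in the form in which `∑-δ` consumes it.
  record Enum (A : Set) : Set where
    field
      elems : List A
      _≟_   : DecidableEquality A
      once  : ∀ a → sumL elems (λ b → 𝟙 (b ≟ a)) ≡ 1ℤ

  ∑ : {A : Set} → Enum A → (A → ℤ) → ℤ
  ∑ E = sumL (Enum.elems E)

  syntax ∑ E (λ x → e) = ∑[ x ∈ E ] e
  infix 5 ∑

  module _ {A : Set} (E : Enum A) where
    open Enum E

    ∑-cong : {f g : A → ℤ} → (∀ x → f x ≡ g x) → ∑ E f ≡ ∑ E g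
    ∑-cong = sumL-cong elems

    ∑-mono : {f g : A → ℤ} → (∀ x → f x ≤ g x) → ∑ E f ≤ ∑ E g
    ∑-mono = sumL-mono elems

    ∑-0 : ∑ E (λ _ → 0ℤ) ≡ 0ℤ
    ∑-0 = sumL-0 elems

    ∑-+ : ∀ (f g : A → ℤ) → ∑ E (λ x → f x + g x) ≡ ∑ E f + ∑ E g
    ∑-+ = sumL-+ elems

    ∑-*ˡ : ∀ c (f : A → ℤ) → ∑ E (λ x → c * f x) ≡ c * ∑ E f
    ∑-*ˡ = sumL-* elems

    ∑-*ʳ : ∀ (f : A → ℤ) c → ∑ E (λ x → f x * c) ≡ ∑ E f * c
    ∑-*ʳ f c = trans (∑-cong (λ x → *-comm (f x) c)) (trans (∑-*ˡ c f) (*-comm c _))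

    ∑-neg : ∀ (f : A → ℤ) → ∑ E (λ x → - f x) ≡ - ∑ E f
    ∑-neg f = trans (∑-cong (λ x → sym (-1*i≡-i (f x)))) (trans (∑-*ˡ -1ℤ f) (-1*i≡-i _))

    ∑-sub : ∀ (f g : A → ℤ) → ∑ E (λ x → f x - g x) ≡ ∑ E f - ∑ E g
    ∑-sub f g = trans (∑-+ f (-_ ∘ g)) (cong (_+_ (∑ E f)) (∑-neg g))

    ∑-nonneg : {f : A → ℤ} → (∀ x → 0ℤ ≤ f x) → 0ℤ ≤ ∑ E f
    ∑-nonneg {f} h = subst (_≤ ∑ E f) ∑-0 (∑-mono h)

    ∑-δ : ∀ a (g : A → ℤ) → ∑ E (λ b → 𝟙 (b ≟ a) * g b) ≡ g a
    ∑-δ a g = trans (∑-cong (λ b → 𝟙-*-cong (b ≟ a) (cong g)))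
      (trans (∑-*ʳ (λ b → 𝟙 (b ≟ a)) (g a)) (trans (cong (_* g a) (once a)) (*-identityˡ (g a))))

    term≤∑ : {f : A → ℤ} → (∀ x → 0ℤ ≤ f x) → ∀ a → f a ≤ ∑ E f
    term≤∑ {f} h a = ≤-trans (≤-reflexive (sym (∑-δ a f)))
      (∑-mono (λ b → ≤-trans (𝟙-*-mono′ b) (≤-reflexive (*-identityˡ (f b)))))
      where
      𝟙-*-mono′ : ∀ b → 𝟙 (b ≟ a) * f b ≤ 1ℤ * f b
      𝟙-*-mono′ b = *-mono (𝟙-nonneg (b ≟ a)) (h b) (𝟙-≤1 (b ≟ a)) ≤-refl

    -- Used to turn an inclusion between subspaces of equal size into an equality.
    ∑-≡⇒pointwise : {f g : A → ℤ} → (∀ x → f x ≤ g x) → ∑ E f ≡ ∑ E g → ∀ a → f a ≡ g a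
    ∑-≡⇒pointwise {f} {g} f≤g e a = ≤-antisym (f≤g a) (≤-by-diff (neg a (≤-trans
        (term≤∑ (λ x → diff-≥0 (f≤g x)) a)
        (≤-reflexive (trans (∑-sub g f) (trans (cong (λ z → ∑ E g - z) e) (+-inverseʳ (∑ E g))))))))
      where
      flip-sign : ∀ x y → - (x - y) ≡ y - x
      flip-sign = solve-∀
      neg : ∀ a → g a - f a ≤ 0ℤ → 0ℤ ≤ f a - g a
      neg a p = subst (0ℤ ≤_) (flip-sign (g a) (f a)) (neg-mono-≤ p)

    -- The sum of the indicators is positive exactly when there is a witness, and then a scan of the
    -- list must find one.
    dec-∃ : {P : A → Set} → (∀ a → Dec (P a)) → Dec (∃ P)
    dec-∃ {P} P? with (∑ E (λ a → 𝟙 (P? a))) ≤? 0ℤ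
    ... | yes p = no (λ { (a , pa) → 1≰0 (≤-trans (≤-reflexive (sym (𝟙-yes (P? a) pa)))
                           (≤-trans (term≤∑ (λ b → 𝟙-nonneg (P? b)) a) p)) })
      where
      1≰0 : ¬ (1ℤ ≤ 0ℤ)
      1≰0 (+≤+ ())
    ... | no ¬p = yes (search elems ¬p)
      where
      search : ∀ xs → ¬ (sumL xs (λ a → 𝟙 (P? a)) ≤ 0ℤ) → ∃ P
      search []       h = ⊥-elim (h ≤-refl)
      search (x ∷ xs) h with P? x
      ... | yes px = x , px
      ... | no  _  = search xs (λ p → h (≤-trans (≤-reflexive (+-identityˡ _)) p))

    dec-∀ : {P : A → Set} → (∀ a → Dec (P a)) → Dec (∀ a → P a)
    dec-∀ P? with dec-∃ (λ a → ¬? (P? a))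
    ... | yes (a , ¬pa) = no (λ h → ¬pa (h a))
    ... | no  h         = yes (λ a → stable a)
      where
      stable = λ a → decidable-stable (P? a) (λ ¬pa → h (a , ¬pa))

    counterexample : {P : A → Set} → (∀ a → Dec (P a)) → ¬ (∀ a → P a) → ∃ (λ a → ¬ P a)
    counterexample P? ¬all with dec-∃ (λ a → ¬? (P? a))
    ... | yes x = x
    ... | no  h = ⊥-elim (¬all (λ a → decidable-stable (P? a) (λ ¬pa → h (a , ¬pa))))

  module _ {A B : Set} (E : Enum A) (F : Enum B) where

    ∑-swap : ∀ (f : A → B → ℤ) → ∑[ x ∈ E ] ∑[ y ∈ F ] f x y ≡ ∑[ y ∈ F ] ∑[ x ∈ E ] f x y
    ∑-swap = sumL-swap (Enum.elems E) (Enum.elems F)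

    ∑-∑-* : ∀ (f : A → ℤ) (g : B → ℤ) → ∑[ x ∈ E ] ∑[ y ∈ F ] f x * g y ≡ ∑ E f * ∑ F g
    ∑-∑-* f g = trans (∑-cong E (λ x → ∑-*ˡ F (f x) g)) (∑-*ʳ E f (∑ F g))

    ∑-reindex : (h : A → B) (h⁻¹ : B → A) → (∀ a → h⁻¹ (h a) ≡ a) → (∀ b → h (h⁻¹ b) ≡ b) →
      ∀ g → ∑[ a ∈ E ] g (h a) ≡ ∑ F g
    ∑-reindex h h⁻¹ invˡ invʳ g = begin
      (∑[ a ∈ E ] g (h a))
        ≡⟨ ∑-cong E (λ a → sym (∑-δ F (h a) g)) ⟩
      (∑[ a ∈ E ] ∑[ b ∈ F ] 𝟙 (b ≟F h a) * g b)
        ≡⟨ ∑-swap _ ⟩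
      (∑[ b ∈ F ] ∑[ a ∈ E ] 𝟙 (b ≟F h a) * g b)
        ≡⟨ ∑-cong F (λ b → trans (∑-*ʳ E _ (g b)) (trans (cong (_* g b) (fiber b)) (*-identityˡ (g b)))) ⟩
      ∑ F g ∎
      where
      open ≡-Reasoning
      open Enum E using () renaming (_≟_ to _≟E_; once to onceE)
      open Enum F using () renaming (_≟_ to _≟F_)
      fiber : ∀ b → ∑[ a ∈ E ] 𝟙 (b ≟F h a) ≡ 1ℤ
      fiber b = trans (∑-cong E (λ a → 𝟙-cong (b ≟F h a) (a ≟E h⁻¹ b)
        (λ e → trans (sym (invˡ a)) (cong h⁻¹ (sym e)))
        (λ e → trans (sym (invʳ b)) (cong h (sym e))))) (onceE (h⁻¹ b))

  -- Enumerations of finite types and of vectors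

  sumFin : ∀ n → (Fin n → ℤ) → ℤ
  sumFin n = sumL (allFin n)

  sumL-tabulate : ∀ {A : Set} n (h : Fin n → A) (f : A → ℤ) → sumL (tabulate h) f ≡ sumFin n (f ∘ h)
  sumL-tabulate zero    h f = refl
  sumL-tabulate (suc n) h f = cong (_+_ (f (h Fin.zero)))
    (trans (sumL-tabulate n (h ∘ Fin.suc) f) (sym (sumL-tabulate n Fin.suc (f ∘ h))))

  sumFin-suc : ∀ n (f : Fin (suc n) → ℤ) → sumFin (suc n) f ≡ f Fin.zero + sumFin n (f ∘ Fin.suc)
  sumFin-suc n f = cong (_+_ (f Fin.zero)) (sumL-tabulate n Fin.suc f)

  sumFin-once : ∀ n (a : Fin n) → sumFin n (λ b → 𝟙 (b Fin.≟ a)) ≡ 1ℤ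
  sumFin-once (suc n) Fin.zero = trans (sumFin-suc n (λ b → 𝟙 (b Fin.≟ Fin.zero)))
    (cong (_+_ 1ℤ) (trans (sumL-cong (allFin n) (λ b → 𝟙-no (Fin.suc b Fin.≟ Fin.zero) (λ ()))) (sumL-0 (allFin n))))
  sumFin-once (suc n) (Fin.suc a) = trans (sumFin-suc n (λ b → 𝟙 (b Fin.≟ Fin.suc a)))
    (trans (+-identityˡ _) (trans (sumL-cong (allFin n)
      (λ b → 𝟙-cong (Fin.suc b Fin.≟ Fin.suc a) (b Fin.≟ a) Fin.suc-injective (cong Fin.suc))) (sumFin-once n a)))

  finEnum : ∀ n → Enum (Fin n)
  finEnum n = record { elems = allFin n ; _≟_ = Fin._≟_ ; once = sumFin-once n }

  sumFin-const : ∀ n c → sumFin n (λ _ → c) ≡ + n * c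
  sumFin-const zero    c = refl
  sumFin-const (suc n) c = trans (sumFin-suc n (λ _ → c)) (trans (cong (_+_ c) (sumFin-const n c)) (sym (lemma (+ n) c)))
    where
    lemma : ∀ n c → (1ℤ + n) * c ≡ c + n * c
    lemma = solve-∀

  module _ {A : Set} {n : ℕ} (iso : A ↔ Fin n) where
    open Inverse iso

    private
      to-injective : ∀ {a b} → to a ≡ to b → a ≡ b
      to-injective {a} {b} e = trans (sym (strictlyInverseʳ a)) (trans (cong from e) (strictlyInverseʳ b))
      _≟A_ : DecidableEquality A
      a ≟A b = map′ to-injective (cong to) (to a Fin.≟ to b)

    ↔-Enum : Enum A
    ↔-Enum = record
      { elems = map from (allFin n)
      ; _≟_   = _≟A_
      ; once  = λ a → trans (sumL-map (allFin n) from _)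
          (trans (sumL-cong (allFin n) (λ b → 𝟙-cong (from b ≟A a) (b Fin.≟ to a)
            (λ e → trans (sym (strictlyInverseˡ b)) (cong to e))
            (λ e → trans (cong from e) (strictlyInverseʳ a))))
          (sumFin-once n (to a)))
      }

    ↔-∑-const : ∀ c → ∑ ↔-Enum (λ _ → c) ≡ + n * c
    ↔-∑-const c = trans (sumL-map (allFin n) from _) (sumFin-const n c)

  module _ {A : Set} (E : Enum A) where
    open Enum E

    vecElems : ∀ n → List (Vec A n)
    vecElems zero    = [] ∷ []
    vecElems (suc n) = concatMap (λ a → map (a ∷_) (vecElems n)) elems

    sum-vecElems : ∀ n (f : Vec A (suc n) → ℤ) →
      sumL (vecElems (suc n)) f ≡ ∑[ a ∈ E ] sumL (vecElems n) (λ v → f (a ∷ v))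
    sum-vecElems n f = trans (sumL-concatMap elems (λ a → map (a ∷_) (vecElems n)) f)
      (∑-cong E (λ a → sumL-map (vecElems n) (a ∷_) f))

    vec≟ : ∀ {n} → DecidableEquality (Vec A n)
    vec≟ = Vec.≡-dec _≟_

    vecOnce : ∀ n (v : Vec A n) → sumL (vecElems n) (λ w → 𝟙 (vec≟ w v)) ≡ 1ℤ
    vecOnce zero    []      = refl
    vecOnce (suc n) (a ∷ v) = begin
      sumL (vecElems (suc n)) (λ w → 𝟙 (vec≟ w (a ∷ v)))
        ≡⟨ sum-vecElems n _ ⟩
      (∑[ b ∈ E ] sumL (vecElems n) (λ w → 𝟙 (vec≟ (b ∷ w) (a ∷ v))))
        ≡⟨ ∑-cong E (λ b → sumL-cong (vecElems n) (split b)) ⟩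
      (∑[ b ∈ E ] sumL (vecElems n) (λ w → 𝟙 (b ≟ a) * 𝟙 (vec≟ w v)))
        ≡⟨ ∑-cong E (λ b → sumL-* (vecElems n) (𝟙 (b ≟ a)) _) ⟩
      (∑[ b ∈ E ] 𝟙 (b ≟ a) * sumL (vecElems n) (λ w → 𝟙 (vec≟ w v)))
        ≡⟨ ∑-δ E a (λ _ → sumL (vecElems n) (λ w → 𝟙 (vec≟ w v))) ⟩
      sumL (vecElems n) (λ w → 𝟙 (vec≟ w v))
        ≡⟨ vecOnce n v ⟩
      1ℤ ∎
      where
      open ≡-Reasoning
      split : ∀ b w → 𝟙 (vec≟ (b ∷ w) (a ∷ v)) ≡ 𝟙 (b ≟ a) * 𝟙 (vec≟ w v)
      split b w = 𝟙-× (vec≟ (b ∷ w) (a ∷ v)) (b ≟ a) (vec≟ w v) Vec.∷-injective (cong₂ _∷_)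

    vecEnum : ∀ n → Enum (Vec A n)
    vecEnum n = record { elems = vecElems n ; _≟_ = vec≟ ; once = vecOnce n }

    ∑-vec-suc : ∀ n (f : Vec A (suc n) → ℤ) →
      ∑ (vecEnum (suc n)) f ≡ ∑[ a ∈ E ] ∑[ v ∈ vecEnum n ] f (a ∷ v)
    ∑-vec-suc = sum-vecElems

  -- Vectors and the dot product over a finite field

  module VectorSpace {q : ℕ} (F : FiniteField q) where
    open FiniteField F public

    fieldRing : CommutativeRing _ _
    fieldRing = record { isCommutativeRing = isCommutativeRing }

    module R = CommutativeRing fieldRing
    module RP = Algebra.Properties.Ring R.ring

    𝔽 : Enum Carrier
    𝔽 = ↔-Enum enumeration

    _≟F_ = Enum._≟_ 𝔽

    infixl 6 _⊕_
    infixr 7 _⊙_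

    _⊕_ : ∀ {n} → Vec Carrier n → Vec Carrier n → Vec Carrier n
    _⊕_ = zipWith _+F_

    _⊙_ : ∀ {n} → Carrier → Vec Carrier n → Vec Carrier n
    a ⊙ v = Vec.map (a *F_) v

    𝟘 : ∀ {n} → Vec Carrier n
    𝟘 = replicate _ 0#

    ⊕-comm : ∀ {n} (v w : Vec Carrier n) → v ⊕ w ≡ w ⊕ v
    ⊕-comm []      []      = refl
    ⊕-comm (a ∷ v) (b ∷ w) = cong₂ _∷_ (R.+-comm a b) (⊕-comm v w)

    ⊕-assoc : ∀ {n} (u v w : Vec Carrier n) → (u ⊕ v) ⊕ w ≡ u ⊕ (v ⊕ w)
    ⊕-assoc []      []      []      = refl
    ⊕-assoc (a ∷ u) (b ∷ v) (c ∷ w) = cong₂ _∷_ (R.+-assoc a b c) (⊕-assoc u v w)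

    ⊕-identityʳ : ∀ {n} (v : Vec Carrier n) → v ⊕ 𝟘 ≡ v
    ⊕-identityʳ []      = refl
    ⊕-identityʳ (a ∷ v) = cong₂ _∷_ (R.+-identityʳ a) (⊕-identityʳ v)

    ⊙-distribˡ : ∀ {n} a (v w : Vec Carrier n) → a ⊙ (v ⊕ w) ≡ a ⊙ v ⊕ a ⊙ w
    ⊙-distribˡ a []      []      = refl
    ⊙-distribˡ a (b ∷ v) (c ∷ w) = cong₂ _∷_ (R.distribˡ a b c) (⊙-distribˡ a v w)

    ⊙-distribʳ : ∀ {n} a b (v : Vec Carrier n) → (a +F b) ⊙ v ≡ a ⊙ v ⊕ b ⊙ v
    ⊙-distribʳ a b []      = refl
    ⊙-distribʳ a b (c ∷ v) = cong₂ _∷_ (R.distribʳ c a b) (⊙-distribʳ a b v)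

    ⊙-assoc : ∀ {n} a b (v : Vec Carrier n) → (a *F b) ⊙ v ≡ a ⊙ (b ⊙ v)
    ⊙-assoc a b []      = refl
    ⊙-assoc a b (c ∷ v) = cong₂ _∷_ (R.*-assoc a b c) (⊙-assoc a b v)

    ⊙-identity : ∀ {n} (v : Vec Carrier n) → 1# ⊙ v ≡ v
    ⊙-identity []      = refl
    ⊙-identity (a ∷ v) = cong₂ _∷_ (R.*-identityˡ a) (⊙-identity v)

    ⊙-zeroˡ : ∀ {n} (v : Vec Carrier n) → 0# ⊙ v ≡ 𝟘
    ⊙-zeroˡ []      = refl
    ⊙-zeroˡ (a ∷ v) = cong₂ _∷_ (R.zeroˡ a) (⊙-zeroˡ v)

    ⊙-zeroʳ : ∀ {n} a → a ⊙ 𝟘 {n} ≡ 𝟘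
    ⊙-zeroʳ {zero}  a = refl
    ⊙-zeroʳ {suc n} a = cong₂ _∷_ (R.zeroʳ a) (⊙-zeroʳ a)

    neg : ∀ {n} → Vec Carrier n → Vec Carrier n
    neg v = (-F 1#) ⊙ v

    ⊕-inverseʳ : ∀ {n} (v : Vec Carrier n) → v ⊕ neg v ≡ 𝟘
    ⊕-inverseʳ v = trans (cong (_⊕ neg v) (sym (⊙-identity v)))
      (trans (sym (⊙-distribʳ 1# (-F 1#) v)) (trans (cong (_⊙ v) (R.-‿inverseʳ 1#)) (⊙-zeroˡ v)))

    ⊕-cancel : ∀ {n} (v t : Vec Carrier n) → (v ⊕ t) ⊕ neg t ≡ v
    ⊕-cancel v t = trans (⊕-assoc v t (neg t)) (trans (cong (v ⊕_) (⊕-inverseʳ t)) (⊕-identityʳ v))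

    ⊕-cancel′ : ∀ {n} (v t : Vec Carrier n) → (v ⊕ neg t) ⊕ t ≡ v
    ⊕-cancel′ v t = trans (⊕-assoc v (neg t) t)
      (trans (cong (v ⊕_) (trans (⊕-comm (neg t) t) (⊕-inverseʳ t))) (⊕-identityʳ v))

    ⊙-neg : ∀ {n} a (v : Vec Carrier n) → (-F a) ⊙ v ≡ neg (a ⊙ v)
    ⊙-neg a v = trans (cong (_⊙ v) (sym (RP.-1*x≈-x a))) (⊙-assoc (-F 1#) a v)

    ⊕-interchange : ∀ {n} (a b c d : Vec Carrier n) → (a ⊕ b) ⊕ (c ⊕ d) ≡ (a ⊕ c) ⊕ (b ⊕ d)
    ⊕-interchange a b c d = trans (⊕-assoc a b (c ⊕ d)) (trans (cong (a ⊕_) (trans (sym (⊕-assoc b c d))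
      (trans (cong (_⊕ d) (⊕-comm b c)) (⊕-assoc c b d)))) (sym (⊕-assoc a c (b ⊕ d))))

    neg-unique : ∀ {n} (s t : Vec Carrier n) → s ⊕ t ≡ 𝟘 → t ≡ neg s
    neg-unique s t e = trans (sym (⊕-cancel t s)) (trans (cong (_⊕ neg s) (trans (⊕-comm t s) e))
      (trans (⊕-comm 𝟘 (neg s)) (⊕-identityʳ (neg s))))

    nonzero-inverse : ∀ a → a ≢ 0# → ∃ λ b → b *F a ≡ 1#
    nonzero-inverse a a≢0 with inverse a a≢0
    ... | b , e = b , trans (R.*-comm b a) e

    ⊙≡0 : ∀ {n} a (v : Vec Carrier n) → a ≢ 0# → a ⊙ v ≡ 𝟘 → v ≡ 𝟘
    ⊙≡0 a v a≢0 e with nonzero-inverse a a≢0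
    ... | b , ba≡1 = trans (sym (⊙-identity v)) (trans (cong (_⊙ v) (sym ba≡1))
      (trans (⊙-assoc b a v) (trans (cong (b ⊙_) e) (⊙-zeroʳ b))))

    dot : ∀ {n} → Vec Carrier n → Vec Carrier n → Carrier
    dot []      []      = 0#
    dot (a ∷ v) (b ∷ w) = (a *F b) +F dot v w

    dot-comm : ∀ {n} (v w : Vec Carrier n) → dot v w ≡ dot w v
    dot-comm []      []      = refl
    dot-comm (a ∷ v) (b ∷ w) = cong₂ _+F_ (R.*-comm a b) (dot-comm v w)

    +F-interchange : ∀ a b c d → (a +F b) +F (c +F d) ≡ (a +F c) +F (b +F d)
    +F-interchange a b c d = trans (R.+-assoc a b (c +F d)) (trans (cong (a +F_) (trans (sym (R.+-assoc b c d))
      (trans (cong (_+F d) (R.+-comm b c)) (R.+-assoc c b d)))) (sym (R.+-assoc a c (b +F d))))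

    dot-⊕ : ∀ {n} (u v w : Vec Carrier n) → dot u (v ⊕ w) ≡ dot u v +F dot u w
    dot-⊕ []      []      []      = sym (R.+-identityˡ 0#)
    dot-⊕ (a ∷ u) (b ∷ v) (c ∷ w) = trans (cong₂ _+F_ (R.distribˡ a b c) (dot-⊕ u v w))
      (+F-interchange (a *F b) (a *F c) (dot u v) (dot u w))

    dot-⊙ : ∀ {n} a (u v : Vec Carrier n) → dot u (a ⊙ v) ≡ a *F dot u v
    dot-⊙ a []      []      = sym (R.zeroʳ a)
    dot-⊙ a (b ∷ u) (c ∷ v) = trans (cong₂ _+F_
      (trans (sym (R.*-assoc b a c)) (trans (cong (_*F c) (R.*-comm b a)) (R.*-assoc a b c)))
      (dot-⊙ a u v)) (sym (R.distribˡ a (b *F c) (dot u v)))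

    dot-𝟘 : ∀ {n} (u : Vec Carrier n) → dot u 𝟘 ≡ 0#
    dot-𝟘 u = trans (cong (dot u) (sym (⊙-zeroˡ u))) (trans (dot-⊙ 0# u u) (R.zeroˡ _))

    dot-nondegenerate : ∀ {n} (u : Vec Carrier n) → u ≢ 𝟘 → ∃ λ w → dot w u ≢ 0#
    dot-nondegenerate []      u≢0 = ⊥-elim (u≢0 refl)
    dot-nondegenerate (a ∷ u) u≢0 with a ≟F 0#
    ... | no a≢0 = 1# ∷ 𝟘 , λ e → a≢0 (trans (sym (trans (cong₂ _+F_ (R.*-identityˡ a)
                     (trans (dot-comm 𝟘 u) (dot-𝟘 u))) (R.+-identityʳ a))) e)
    ... | yes a≡0 with dot-nondegenerate u (λ u≡0 → u≢0 (cong₂ _∷_ a≡0 u≡0))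
    ...   | w , h = 0# ∷ w , λ e → h (trans (sym (trans (cong (_+F dot w u) (R.zeroˡ a)) (R.+-identityˡ _))) e)

    qz : ℤ
    qz = + q

    ∑𝔽-const : ∀ c → ∑ 𝔽 (λ _ → c) ≡ qz * c
    ∑𝔽-const = ↔-∑-const enumeration

    ∑vec-const : ∀ n c → ∑ (vecEnum 𝔽 n) (λ _ → c) ≡ qz ^ n * c
    ∑vec-const zero    c = trans (+-identityʳ c) (sym (*-identityˡ c))
    ∑vec-const (suc n) c = trans (∑-vec-suc 𝔽 n (λ _ → c)) (trans (∑𝔽-const _)
      (trans (cong (qz *_) (∑vec-const n c)) (sym (*-assoc qz (qz ^ n) c))))

  -- Decidable subspaces and equidistribution of linear forms

  module Subspaces {q : ℕ} (F : FiniteField q) (q>1 : 1ℤ < + q) (n : ℕ) where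
    open VectorSpace F public

    V : Set
    V = Vec Carrier n

    𝕍 : Enum V
    𝕍 = vecEnum 𝔽 n

    _≟V_ = Enum._≟_ 𝕍

    q-1>0 : 0ℤ < qz - 1ℤ
    q-1>0 = subst (_< qz - 1ℤ) (+-inverseʳ 1ℤ) (+-monoˡ-< (- 1ℤ) q>1)

    q>0 : 0ℤ < qz
    q>0 = ≤-<-trans 0≤1 q>1

    ∑-translate : ∀ t g → ∑ 𝕍 (λ v → g (v ⊕ t)) ≡ ∑ 𝕍 g
    ∑-translate t = ∑-reindex 𝕍 𝕍 (_⊕ t) (_⊕ neg t) (λ v → ⊕-cancel v t) (λ v → ⊕-cancel′ v t)

    o : V → V → ℤ
    o w v = 𝟙 (dot w v ≟F 0#)

    o-comm : ∀ w v → o w v ≡ o v w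
    o-comm w v = cong (λ x → 𝟙 (x ≟F 0#)) (dot-comm w v)

    -- Membership is decidable so that it has an indicator that can be summed. The bare predicates
    -- of the theorem are brought into this form by `toSubspace`, through a basis.
    record Subspace : Set₁ where
      field
        _∋_  : V → Set
        _∋?_ : ∀ v → Dec (_∋_ v)
        ∋0   : _∋_ 𝟘
        ∋⊕   : ∀ {v w} → _∋_ v → _∋_ w → _∋_ (v ⊕ w)
        ∋⊙   : ∀ a {v} → _∋_ v → _∋_ (a ⊙ v)

    open Subspace public

    χ : Subspace → V → ℤ
    χ S v = 𝟙 ((S ∋? v))

    size : Subspace → ℤ
    size S = ∑ 𝕍 (χ S)

    χ-nonneg : ∀ S v → 0ℤ ≤ χ S v
    χ-nonneg S v = 𝟙-nonneg (S ∋? v)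

    module _ (S : Subspace) where

      ∋-shift : ∀ {v t} → S ∋ t → S ∋ (v ⊕ t) → S ∋ v
      ∋-shift {v} {t} St Svt = subst (S ∋_) (⊕-cancel v t) (∋⊕ S Svt (∋⊙ S (-F 1#) St))

      ∋-unscale : ∀ {a v} → a ≢ 0# → S ∋ (a ⊙ v) → S ∋ v
      ∋-unscale {a} {v} a≢0 Sav with nonzero-inverse a a≢0
      ... | b , ba≡1 = subst (S ∋_) (trans (sym (⊙-assoc b a v)) (trans (cong (_⊙ v) ba≡1) (⊙-identity v)))
        (∋⊙ S b Sav)

      χ-⊙ : ∀ a v → a ≢ 0# → χ S (a ⊙ v) ≡ χ S v
      χ-⊙ a v a≢0 = 𝟙-cong (S ∋? (a ⊙ v)) (S ∋? v) (∋-unscale a≢0) (∋⊙ S a)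

    zeroS : Subspace
    zeroS = record
      { _∋_  = _≡ 𝟘
      ; _∋?_ = _≟V 𝟘
      ; ∋0   = refl
      ; ∋⊕   = λ p r → trans (cong₂ _⊕_ p r) (⊕-identityʳ 𝟘)
      ; ∋⊙   = λ a p → trans (cong (a ⊙_) p) (⊙-zeroʳ a)
      }

    fullS : Subspace
    fullS = record
      { _∋_  = λ _ → ⊤
      ; _∋?_ = λ _ → yes tt
      ; ∋0   = tt
      ; ∋⊕   = λ _ _ → tt
      ; ∋⊙   = λ _ _ → tt
      }

    perp : Subspace → Subspace
    perp S = record
      { _∋_  = λ w → ∀ s → S ∋ s → dot w s ≡ 0#
      ; _∋?_ = λ w → dec-∀ 𝕍 (λ s → (S ∋? s) →-dec (dot w s ≟F 0#))
      ; ∋0   = λ s _ → trans (dot-comm 𝟘 s) (dot-𝟘 s)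
      ; ∋⊕   = λ {v} {w} p r s Ss → trans (dot-comm (v ⊕ w) s) (trans (dot-⊕ s v w)
                 (trans (cong₂ _+F_ (trans (dot-comm s v) (p s Ss)) (trans (dot-comm s w) (r s Ss))) (R.+-identityʳ 0#)))
      ; ∋⊙   = λ a {v} p s Ss → trans (dot-comm (a ⊙ v) s) (trans (dot-⊙ a s v)
                 (trans (cong (a *F_) (trans (dot-comm s v) (p s Ss))) (R.zeroʳ a)))
      }

    not-perp : ∀ S w → ¬ (perp S ∋ w) → ∃ λ s → S ∋ s × dot w s ≢ 0#
    not-perp S w h with counterexample 𝕍 (λ s → (S ∋? s) →-dec (dot w s ≟F 0#)) h
    ... | s , h′ with S ∋? s
    ...   | yes Ss = s , Ss , λ e → h′ (λ _ → e)
    ...   | no ¬Ss = ⊥-elim (h′ (⊥-elim ∘ ¬Ss))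

    -- Translation by `a ⊙ s₁`, where `s₁` in `S` has product 1 with `w`, permutes `S` and shifts
    -- the value of the form by `a`. So all `q` values are taken equally often. The shift `c` leaves
    -- room for the contribution of a second subspace.
    equidistributed : ∀ S w c → (∃ λ s → S ∋ s × dot w s ≢ 0#) →
      qz * ∑ 𝕍 (λ s → χ S s * 𝟙 ((dot w s +F c) ≟F 0#)) ≡ size S
    equidistributed S w c (s₀ , Ss₀ , h) = begin
      qz * ∑ 𝕍 g₀
        ≡⟨ sym (∑𝔽-const _) ⟩
      (∑[ a ∈ 𝔽 ] ∑ 𝕍 g₀)
        ≡⟨ ∑-cong 𝔽 (λ a → trans (sym (∑-translate (a ⊙ s₁) g₀)) (∑-cong 𝕍 (shift a))) ⟩
      (∑[ a ∈ 𝔽 ] ∑ 𝕍 (g a))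
        ≡⟨ ∑-swap 𝔽 𝕍 g ⟩
      (∑[ s ∈ 𝕍 ] ∑[ a ∈ 𝔽 ] g a s)
        ≡⟨ ∑-cong 𝕍 (λ s → trans (∑-*ˡ 𝔽 (χ S s) _) (trans (cong (χ S s *_) (unique s)) (*-identityʳ _))) ⟩
      size S ∎
      where
      open ≡-Reasoning
      b = proj₁ (nonzero-inverse (dot w s₀) h)
      s₁ = b ⊙ s₀
      g : Carrier → V → ℤ
      g a s = χ S s * 𝟙 (((dot w s +F c) +F a) ≟F 0#)
      g₀ : V → ℤ
      g₀ s = χ S s * 𝟙 ((dot w s +F c) ≟F 0#)
      Ss₁ : S ∋ s₁
      Ss₁ = ∋⊙ S b Ss₀
      dot-s₁ : dot w s₁ ≡ 1#
      dot-s₁ = trans (dot-⊙ b w s₀) (proj₂ (nonzero-inverse (dot w s₀) h))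
      value : ∀ a s → (dot w (s ⊕ a ⊙ s₁) +F c) ≡ ((dot w s +F c) +F a)
      value a s = (trans (cong (_+F c) (trans (dot-⊕ w s (a ⊙ s₁))
        (cong (dot w s +F_) (trans (dot-⊙ a w s₁) (trans (cong (a *F_) dot-s₁) (R.*-identityʳ a))))))
        (trans (R.+-assoc _ a c) (trans (cong (dot w s +F_) (R.+-comm a c)) (sym (R.+-assoc _ c a)))))
      shift : ∀ a s → g₀ (s ⊕ a ⊙ s₁) ≡ g a s
      shift a s = cong₂ _*_
        (𝟙-cong (S ∋? (s ⊕ a ⊙ s₁)) (S ∋? s) (∋-shift S (∋⊙ S a Ss₁)) (λ p → ∋⊕ S p (∋⊙ S a Ss₁)))
        (cong (λ x → 𝟙 (x ≟F 0#)) (value a s))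
      unique : ∀ s → ∑[ a ∈ 𝔽 ] 𝟙 (((dot w s +F c) +F a) ≟F 0#) ≡ 1ℤ
      unique s = trans (∑-cong 𝔽 (λ a → 𝟙-cong (((dot w s +F c) +F a) ≟F 0#) (a ≟F (-F (dot w s +F c)))
        (λ e → RP.+-inverseʳ-unique _ a e)
        (λ e → trans (cong ((dot w s +F c) +F_) e) (R.-‿inverseʳ _))))
        (Enum.once 𝔽 _)

  -- Sizes of orthogonal complements and of their intersections

  module Duality {q : ℕ} (F : FiniteField q) (q>1 : 1ℤ < + q) (n : ℕ) where
    open Subspaces F q>1 n public

    qⁿ : ℤ
    qⁿ = qz ^ n

    ∑𝕍-const : ∀ c → ∑ 𝕍 (λ _ → c) ≡ qⁿ * c
    ∑𝕍-const = ∑vec-const n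

    -- The two cases, everything for `u` zero and a `q`-th part otherwise, are merged into one
    -- formula so that it can be summed over `u`.
    ∑-orthogonal : ∀ u → qz * ∑ 𝕍 (λ w → o w u) ≡ (qz - 1ℤ) * qⁿ * 𝟙 (u ≟V 𝟘) + qⁿ
    ∑-orthogonal u with u ≟V 𝟘
    ... | yes refl = trans (cong (qz *_) (trans (∑-cong 𝕍 (λ w → 𝟙-yes (dot w 𝟘 ≟F 0#) (dot-𝟘 w))) (∑𝕍-const 1ℤ)))
                       (lemma qz qⁿ)
      where
      lemma : ∀ q r → q * (r * 1ℤ) ≡ (q - 1ℤ) * r * 1ℤ + r
      lemma = solve-∀
    ... | no u≢0 = trans (cong (qz *_) (∑-cong 𝕍 (λ w → trans (o-comm w u)
                     (trans (cong (λ x → 𝟙 (x ≟F 0#)) (sym (R.+-identityʳ _))) (sym (*-identityˡ _))))))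
                     (trans (equidistributed fullS u 0# full) (trans (∑𝕍-const 1ℤ) (lemma qz qⁿ)))
      where
      full : ∃ λ s → ⊤ × dot u s ≢ 0#
      full with dot-nondegenerate u u≢0
      ... | w , h = w , tt , λ e → h (trans (dot-comm w u) e)
      lemma : ∀ q r → r * 1ℤ ≡ (q - 1ℤ) * r * 0ℤ + r
      lemma = solve-∀

    module _ (x y : Subspace) where

      private
        -- Indicator of the triples to be counted in two ways: `s` in `x`, `t` in `y`, and `w`
        -- orthogonal to `s ⊕ t`. Fixing `w` leads to the meet of the complements, fixing `s` and
        -- `t` to the meet of `x` and `y`. This takes the place of characters and of the dimension
        -- formula.
        term : V → V → V → ℤ
        term w t s = χ y t * (χ x s * 𝟙 ((dot w s +F dot w t) ≟F 0#))

        -- If `w` annihilates both spaces, every pair counts. Otherwise equidistribution over a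
        -- space that `w` does not annihilate leaves exactly a `q`-th part of the pairs.
        indicator-sum : ∀ w → qz * ∑ 𝕍 (λ t → ∑ 𝕍 (term w t)) ≡
          (qz - 1ℤ) * (size x * size y) * (χ (perp x) w * χ (perp y) w) + size x * size y
        indicator-sum w with perp x ∋? w | perp y ∋? w
        ... | yes px | yes py = trans (cong (qz *_) (trans (∑-cong 𝕍 (λ t → trans (∑-*ˡ 𝕍 (χ y t) _)
                (𝟙-*-cong (y ∋? t) (λ yt → ∑-cong 𝕍 (λ s → trans (𝟙-*-cong (x ∋? s) (λ xs →
                  𝟙-yes ((dot w s +F dot w t) ≟F 0#) (trans (cong₂ _+F_ (px s xs) (py t yt)) (R.+-identityʳ 0#))))
                  (*-identityʳ _)))))) (∑-*ʳ 𝕍 (χ y) (size x)))) (lemma qz (size x) (size y))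
          where
          lemma : ∀ q a b → q * (b * a) ≡ (q - 1ℤ) * (a * b) * 1ℤ + a * b
          lemma = solve-∀
        ... | no ¬px | py = trans (trans (sym (∑-*ˡ 𝕍 qz _)) (trans (∑-cong 𝕍 (λ t →
                trans (cong (qz *_) (∑-*ˡ 𝕍 (χ y t) _)) (trans (lemma₁ qz (χ y t) _)
                (cong (χ y t *_) (equidistributed x w (dot w t) (not-perp x w ¬px)))))) (∑-*ʳ 𝕍 (χ y) (size x))))
                (lemma₂ qz (size x) (size y) (𝟙 py))
          where
          lemma₁ : ∀ q a b → q * (a * b) ≡ a * (q * b)
          lemma₁ = solve-∀
          lemma₂ : ∀ q a b p → b * a ≡ (q - 1ℤ) * (a * b) * (0ℤ * p) + a * b
          lemma₂ = solve-∀
        ... | yes px | no ¬py = trans (cong (qz *_) (∑-swap 𝕍 𝕍 (term w)))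
                (trans (trans (sym (∑-*ˡ 𝕍 qz _)) (trans (∑-cong 𝕍 (λ s →
                trans (cong (qz *_) (trans (∑-cong 𝕍 (λ t → trans (rearrange (χ y t) (χ x s) _)
                  (cong (λ z → χ x s * (χ y t * 𝟙 (z ≟F 0#))) (R.+-comm (dot w s) (dot w t)))))
                  (∑-*ˡ 𝕍 (χ x s) _)))
                (trans (lemma₁ qz (χ x s) _)
                (cong (χ x s *_) (equidistributed y w (dot w s) (not-perp y w ¬py)))))) (∑-*ʳ 𝕍 (χ x) (size y))))
                (lemma₂ qz (size x) (size y)))
          where
          rearrange : ∀ a b c → a * (b * c) ≡ b * (a * c)
          rearrange = solve-∀
          lemma₁ : ∀ q a b → q * (a * b) ≡ a * (q * b)
          lemma₁ = solve-∀
          lemma₂ : ∀ q a b → a * b ≡ (q - 1ℤ) * (a * b) * (1ℤ * 0ℤ) + a * b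
          lemma₂ = solve-∀

        meet meet⊥ : ℤ
        meet  = ∑ 𝕍 (λ v → χ x v * χ y v)
        meet⊥ = ∑ 𝕍 (λ v → χ (perp x) v * χ (perp y) v)

        by-w : qz * ∑ 𝕍 (λ w → ∑ 𝕍 (λ t → ∑ 𝕍 (term w t))) ≡
          (qz - 1ℤ) * (size x * size y) * meet⊥ + qⁿ * (size x * size y)
        by-w = trans (sym (∑-*ˡ 𝕍 qz _)) (trans (∑-cong 𝕍 indicator-sum) (trans (∑-+ 𝕍 _ _)
          (cong₂ _+_ (∑-*ˡ 𝕍 ((qz - 1ℤ) * (size x * size y)) _) (∑𝕍-const _))))

        pair-sum : ∀ t → ∑ 𝕍 (λ s → χ x s * 𝟙 ((s ⊕ t) ≟V 𝟘)) ≡ χ x t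
        pair-sum t = trans (∑-cong 𝕍 (λ s → trans (*-comm (χ x s) _) (cong (_* χ x s)
            (𝟙-cong ((s ⊕ t) ≟V 𝟘) (s ≟V neg t) (λ e → neg-unique t s (trans (⊕-comm t s) e))
              (λ { refl → trans (⊕-comm (neg t) t) (⊕-inverseʳ t) })))))
          (trans (∑-δ 𝕍 (neg t) (χ x)) (𝟙-cong (x ∋? neg t) (x ∋? t)
            (λ p → subst (x ∋_) (⊕-cancel-neg t) (∋⊙ x (-F 1#) p)) (∋⊙ x (-F 1#))))
          where
          ⊕-cancel-neg : ∀ t → neg (neg t) ≡ t
          ⊕-cancel-neg t = sym (neg-unique (neg t) t (trans (⊕-comm (neg t) t) (⊕-inverseʳ t)))

        by-pairs : qz * ∑ 𝕍 (λ w → ∑ 𝕍 (λ t → ∑ 𝕍 (term w t))) ≡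
          (qz - 1ℤ) * qⁿ * meet + qⁿ * (size x * size y)
        by-pairs = begin
          qz * ∑ 𝕍 (λ w → ∑ 𝕍 (λ t → ∑ 𝕍 (term w t)))
            ≡⟨ cong (qz *_) (trans (∑-swap 𝕍 𝕍 (λ w t → ∑ 𝕍 (term w t))) (∑-cong 𝕍 (λ t → ∑-swap 𝕍 𝕍 (λ w → term w t)))) ⟩
          qz * ∑ 𝕍 (λ t → ∑ 𝕍 (λ s → ∑ 𝕍 (λ w → term w t s)))
            ≡⟨ trans (sym (∑-*ˡ 𝕍 qz _)) (∑-cong 𝕍 (λ t → trans (sym (∑-*ˡ 𝕍 qz _)) (∑-cong 𝕍 (inner t)))) ⟩
          ∑ 𝕍 (λ t → ∑ 𝕍 (λ s → χ y t * ((qz - 1ℤ) * qⁿ * (χ x s * 𝟙 ((s ⊕ t) ≟V 𝟘)) + qⁿ * χ x s)))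
            ≡⟨ ∑-cong 𝕍 (λ t → trans (∑-*ˡ 𝕍 (χ y t) _) (cong (χ y t *_) (trans (∑-+ 𝕍 _ _)
                 (cong₂ _+_ (trans (∑-*ˡ 𝕍 ((qz - 1ℤ) * qⁿ) _) (cong ((qz - 1ℤ) * qⁿ *_) (pair-sum t))) (∑-*ˡ 𝕍 qⁿ (χ x)))))) ⟩
          ∑ 𝕍 (λ t → χ y t * ((qz - 1ℤ) * qⁿ * χ x t + qⁿ * size x))
            ≡⟨ ∑-cong 𝕍 (λ t → regroup (χ y t) (χ x t) ((qz - 1ℤ) * qⁿ) (qⁿ * size x)) ⟩
          ∑ 𝕍 (λ t → (qz - 1ℤ) * qⁿ * (χ x t * χ y t) + (qⁿ * size x) * χ y t)
            ≡⟨ trans (∑-+ 𝕍 _ _) (cong₂ _+_ (∑-*ˡ 𝕍 ((qz - 1ℤ) * qⁿ) _) (∑-*ˡ 𝕍 (qⁿ * size x) (χ y))) ⟩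
          (qz - 1ℤ) * qⁿ * meet + (qⁿ * size x) * size y
            ≡⟨ cong (_+_ ((qz - 1ℤ) * qⁿ * meet)) (*-assoc qⁿ (size x) (size y)) ⟩
          (qz - 1ℤ) * qⁿ * meet + qⁿ * (size x * size y) ∎
          where
          open ≡-Reasoning
          regroup : ∀ a b c d → a * (c * b + d) ≡ c * (b * a) + d * a
          regroup = solve-∀
          assemble : ∀ q r a b c → a * b * ((q - 1ℤ) * r * c + r) ≡ a * ((q - 1ℤ) * r * (b * c) + r * b)
          assemble = solve-∀
          inner : ∀ t s → qz * ∑ 𝕍 (λ w → term w t s) ≡
            χ y t * ((qz - 1ℤ) * qⁿ * (χ x s * 𝟙 ((s ⊕ t) ≟V 𝟘)) + qⁿ * χ x s)
          inner t s = trans (cong (qz *_) (trans (∑-cong 𝕍 (λ w → trans (sym (*-assoc (χ y t) (χ x s) _))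
              (cong (λ z → χ y t * χ x s * 𝟙 (z ≟F 0#)) (sym (dot-⊕ w s t)))))
              (∑-*ˡ 𝕍 (χ y t * χ x s) _)))
            (trans (pull qz (χ y t * χ x s) _) (trans (cong (χ y t * χ x s *_) (∑-orthogonal (s ⊕ t)))
              (assemble qz qⁿ (χ y t) (χ x s) _)))
            where
            pull : ∀ a b c → a * (b * c) ≡ b * (a * c)
            pull = solve-∀

      -- In the two counts of the triples the term `qⁿ * (size x * size y)` is the same and cancels,
      -- and then so does `qz - 1ℤ`. With `y` the zero space this gives the size of a complement.
      -- With both sizes equal to `Q` it says that the complements meet in as many vectors as the
      -- spaces, so duality preserves intersecting families.
      perp-meet : (size x * size y) * meet⊥ ≡ qⁿ * meet
      perp-meet = *-cancelˡ q-1>0 (trans (sym (*-assoc (qz - 1ℤ) (size x * size y) meet⊥))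
        (trans (+-cancelʳ (trans (sym by-w) by-pairs)) (*-assoc (qz - 1ℤ) qⁿ meet)))
        where
        +-cancelʳ : ∀ {a b c} → a + c ≡ b + c → a ≡ b
        +-cancelʳ {a} {b} {c} e = trans (sym (undo a c)) (trans (cong (_- c) e) (undo b c))
          where
          undo : ∀ a c → a + c - c ≡ a
          undo = solve-∀

    size-zeroS : size zeroS ≡ 1ℤ
    size-zeroS = Enum.once 𝕍 𝟘

    size-perp : ∀ S → size S * size (perp S) ≡ qⁿ
    size-perp S = trans (sym (cong₂ _*_ (trans (cong (size S *_) size-zeroS) (*-identityʳ (size S)))
        (∑-cong 𝕍 (λ w → trans (cong (χ (perp S) w *_) (perp-zeroS w)) (*-identityʳ (χ (perp S) w))))))
      (trans (perp-meet S zeroS) (trans (cong (qⁿ *_) meet-zero) (*-identityʳ qⁿ)))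
      where
      perp-zeroS : ∀ w → χ (perp zeroS) w ≡ 1ℤ
      perp-zeroS w = 𝟙-yes (perp zeroS ∋? w) (λ { s refl → dot-𝟘 w })
      meet-zero : ∑ 𝕍 (λ v → χ S v * χ zeroS v) ≡ 1ℤ
      meet-zero = trans (∑-cong 𝕍 (λ v → *-comm (χ S v) (χ zeroS v)))
        (trans (∑-δ 𝕍 𝟘 (χ S)) (𝟙-yes (S ∋? 𝟘) (∋0 S)))

    ⊆-size-≡ : ∀ S T → (∀ v → S ∋ v → T ∋ v) → size S ≡ size T → ∀ v → χ S v ≡ χ T v
    ⊆-size-≡ S T S⊆T = ∑-≡⇒pointwise 𝕍 (λ v → 𝟙-mono (S ∋? v) (T ∋? v) (S⊆T v))

    χ≡⇒⊇ : ∀ S T → (∀ v → χ S v ≡ χ T v) → ∀ v → T ∋ v → S ∋ v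
    χ≡⇒⊇ S T e v Tv = 𝟙-true (S ∋? v) (trans (e v) (𝟙-yes (T ∋? v) Tv))

  -- Spans, orthogonal tuples and independent tuples

  module Spans {q : ℕ} (F : FiniteField q) (q>1 : 1ℤ < + q) (n : ℕ) where
    open Duality F q>1 n public

    ext : Subspace → V → Subspace
    ext S w = record
      { _∋_  = λ v → ∃ λ a → S ∋ (v ⊕ (-F a) ⊙ w)
      ; _∋?_ = λ v → dec-∃ 𝔽 (λ a → S ∋? (v ⊕ (-F a) ⊙ w))
      ; ∋0   = 0# , subst (S ∋_) (sym (⊖0 𝟘)) (∋0 S)
      ; ∋⊕   = λ { {v} {v′} (a , p) (a′ , p′) → (a +F a′) , subst (S ∋_) (sum-eq v v′ a a′) (∋⊕ S p p′) }
      ; ∋⊙   = λ { c {v} (a , p) → (c *F a) , subst (S ∋_) (scale-eq c v a) (∋⊙ S c p) }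
      }
      where
      ⊖0 : ∀ v → v ⊕ (-F 0#) ⊙ w ≡ v
      ⊖0 v = trans (cong (v ⊕_) (trans (cong (_⊙ w) RP.-0#≈0#) (⊙-zeroˡ w))) (⊕-identityʳ v)
      sum-eq : ∀ v v′ a a′ → (v ⊕ (-F a) ⊙ w) ⊕ (v′ ⊕ (-F a′) ⊙ w) ≡ (v ⊕ v′) ⊕ (-F (a +F a′)) ⊙ w
      sum-eq v v′ a a′ = trans (⊕-interchange v _ v′ _) (cong ((v ⊕ v′) ⊕_)
        (trans (sym (⊙-distribʳ (-F a) (-F a′) w)) (cong (_⊙ w) (RP.-‿+-comm a a′))))
      scale-eq : ∀ c v a → c ⊙ (v ⊕ (-F a) ⊙ w) ≡ c ⊙ v ⊕ (-F (c *F a)) ⊙ w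
      scale-eq c v a = trans (⊙-distribˡ c v _) (cong (c ⊙ v ⊕_) (trans (sym (⊙-assoc c (-F a) w))
        (cong (_⊙ w) (sym (RP.-‿distribʳ-* c a)))))

    module _ (S : Subspace) (w : V) where

      ext-⊇ : ∀ v → S ∋ v → ext S w ∋ v
      ext-⊇ v Sv = 0# , subst (S ∋_) (sym (trans (cong (v ⊕_) (trans (cong (_⊙ w) RP.-0#≈0#) (⊙-zeroˡ w)))
        (⊕-identityʳ v))) Sv

      ext-∋ : ext S w ∋ w
      ext-∋ = 1# , subst (S ∋_) (sym (⊕-inverseʳ w)) (∋0 S)

      ext-least : ∀ T → (∀ v → S ∋ v → T ∋ v) → T ∋ w → ∀ v → ext S w ∋ v → T ∋ v
      ext-least T S⊆T Tw v (a , p) = ∋-shift T (∋⊙ T (-F a) Tw) (S⊆T _ p)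

      ext-trivial : S ∋ w → ∀ v → χ (ext S w) v ≡ χ S v
      ext-trivial Sw v = 𝟙-cong (ext S w ∋? v) (S ∋? v) (ext-least S (λ _ p → p) Sw v) (ext-⊇ v)

      size-ext-trivial : S ∋ w → size (ext S w) ≡ size S
      size-ext-trivial Sw = ∑-cong 𝕍 (ext-trivial Sw)

      module _ (w∉S : ¬ (S ∋ w)) where

        -- The coefficient of `w` is unique: two different ones would put a nonzero multiple of `w`,
        -- hence `w` itself, into `S`. So at most one term of the sum is 1.
        χ-ext : ∀ v → χ (ext S w) v ≡ ∑ 𝔽 (λ a → χ S (v ⊕ (-F a) ⊙ w))
        χ-ext v with dec-∃ 𝔽 (λ a → S ∋? (v ⊕ (-F a) ⊙ w))
        ... | no h = sym (trans (∑-cong 𝔽 (λ a → 𝟙-no (S ∋? (v ⊕ (-F a) ⊙ w)) (λ p → h (a , p)))) (∑-0 𝔽))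
        ... | yes (a , p) = sym (trans (∑-cong 𝔽 (λ b → 𝟙-cong (S ∋? (v ⊕ (-F b) ⊙ w)) (b ≟F a)
                (unique b) (λ { refl → p }))) (Enum.once 𝔽 a))
          where
          unique : ∀ b → S ∋ (v ⊕ (-F b) ⊙ w) → b ≡ a
          unique b p′ with b ≟F a
          ... | yes e = e
          ... | no b≢a = ⊥-elim (w∉S (∋-unscale S a-b≢0 (subst (S ∋_) eq (∋⊕ S p′ (∋⊙ S (-F 1#) p)))))
            where
            a-b≢0 : (a +F (-F b)) ≢ 0#
            a-b≢0 e = b≢a (RP.-‿injective (RP.+-cancelˡ a (-F b) (-F a) (trans e (sym (R.-‿inverseʳ a)))))
            eq : (v ⊕ (-F b) ⊙ w) ⊕ neg (v ⊕ (-F a) ⊙ w) ≡ (a +F (-F b)) ⊙ w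
            eq = begin
              (v ⊕ (-F b) ⊙ w) ⊕ neg (v ⊕ (-F a) ⊙ w)
                ≡⟨ cong ((v ⊕ (-F b) ⊙ w) ⊕_) (⊙-distribˡ (-F 1#) v _) ⟩
              (v ⊕ (-F b) ⊙ w) ⊕ (neg v ⊕ neg ((-F a) ⊙ w))
                ≡⟨ ⊕-interchange v _ (neg v) _ ⟩
              (v ⊕ neg v) ⊕ ((-F b) ⊙ w ⊕ neg ((-F a) ⊙ w))
                ≡⟨ cong₂ _⊕_ (⊕-inverseʳ v) (cong ((-F b) ⊙ w ⊕_) (trans (sym (⊙-neg (-F a) w))
                     (cong (_⊙ w) (RP.-‿involutive a)))) ⟩
              𝟘 ⊕ ((-F b) ⊙ w ⊕ a ⊙ w)
                ≡⟨ trans (⊕-comm 𝟘 _) (⊕-identityʳ _) ⟩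
              (-F b) ⊙ w ⊕ a ⊙ w
                ≡⟨ ⊕-comm _ _ ⟩
              a ⊙ w ⊕ (-F b) ⊙ w
                ≡⟨ sym (⊙-distribʳ a (-F b) w) ⟩
              (a +F (-F b)) ⊙ w ∎
              where open ≡-Reasoning

        ∑-ext : ∀ (g : V → ℤ) → ∑ 𝕍 (λ v → χ (ext S w) v * g v) ≡ ∑ 𝔽 (λ a → ∑ 𝕍 (λ v → χ S v * g (v ⊕ a ⊙ w)))
        ∑-ext g = begin
          ∑ 𝕍 (λ v → χ (ext S w) v * g v)
            ≡⟨ ∑-cong 𝕍 (λ v → trans (cong (_* g v) (χ-ext v)) (sym (∑-*ʳ 𝔽 (λ a → χ S (v ⊕ (-F a) ⊙ w)) (g v)))) ⟩
          ∑ 𝕍 (λ v → ∑ 𝔽 (λ a → χ S (v ⊕ (-F a) ⊙ w) * g v))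
            ≡⟨ ∑-swap 𝕍 𝔽 _ ⟩
          ∑ 𝔽 (λ a → ∑ 𝕍 (λ v → χ S (v ⊕ (-F a) ⊙ w) * g v))
            ≡⟨ ∑-cong 𝔽 (λ a → trans (sym (∑-translate (a ⊙ w) (λ v → χ S (v ⊕ (-F a) ⊙ w) * g v)))
                 (∑-cong 𝕍 (λ v → cong (λ z → χ S z * g (v ⊕ a ⊙ w)) (trans (cong ((v ⊕ a ⊙ w) ⊕_) (⊙-neg a w))
                   (⊕-cancel v (a ⊙ w)))))) ⟩
          ∑ 𝔽 (λ a → ∑ 𝕍 (λ v → χ S v * g (v ⊕ a ⊙ w))) ∎
          where open ≡-Reasoning

        size-ext : size (ext S w) ≡ qz * size S
        size-ext = trans (∑-cong 𝕍 (λ v → sym (*-identityʳ (χ (ext S w) v))))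
          (trans (∑-ext (λ _ → 1ℤ)) (trans (∑-cong 𝔽 (λ a → ∑-cong 𝕍 (λ v → *-identityʳ (χ S v)))) (∑𝔽-const (size S))))

    span : ∀ {j} → Vec V j → Subspace
    span []      = zeroS
    span (w ∷ W) = ext (span W) w

    ∑-zeroS : ∀ (g : V → ℤ) → ∑ 𝕍 (λ v → χ zeroS v * g v) ≡ g 𝟘
    ∑-zeroS = ∑-δ 𝕍 𝟘

    ∑-line : ∀ w → w ≢ 𝟘 → ∀ (g : V → ℤ) → ∑ 𝕍 (λ v → χ (span (w ∷ [])) v * g v) ≡ ∑ 𝔽 (λ a → g (a ⊙ w))
    ∑-line w w≢0 g = trans (∑-ext zeroS w w≢0 g) (∑-cong 𝔽 (λ a → trans (∑-zeroS (λ v → g (v ⊕ a ⊙ w)))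
      (cong g (trans (⊕-comm 𝟘 _) (⊕-identityʳ _)))))

    Homogeneous : (V → ℤ) → Set
    Homogeneous g = ∀ a v → a ≢ 0# → g (a ⊙ v) ≡ g v

    ∑𝔽-nonzero : ∀ c → ∑ 𝔽 (λ a → (1ℤ - 𝟙 (a ≟F 0#)) * c) ≡ (qz - 1ℤ) * c
    ∑𝔽-nonzero c = trans (∑-*ʳ 𝔽 (λ a → 1ℤ - 𝟙 (a ≟F 0#)) c) (cong (_* c)
      (trans (∑-sub 𝔽 (λ _ → 1ℤ) (λ a → 𝟙 (a ≟F 0#)))
      (cong₂ _-_ (trans (∑𝔽-const 1ℤ) (*-identityʳ qz)) (Enum.once 𝔽 0#))))

    ∑-line-homogeneous : ∀ g → Homogeneous g → g 𝟘 ≡ 0ℤ → ∀ w → w ≢ 𝟘 →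
      ∑ 𝕍 (λ v → χ (span (w ∷ [])) v * g v) ≡ (qz - 1ℤ) * g w
    ∑-line-homogeneous g hom g0 w w≢0 = trans (∑-line w w≢0 g) (trans (∑-cong 𝔽 value) (∑𝔽-nonzero (g w)))
      where
      value : ∀ a → g (a ⊙ w) ≡ (1ℤ - 𝟙 (a ≟F 0#)) * g w
      value a with a ≟F 0#
      ... | yes refl = trans (cong g (⊙-zeroˡ w)) g0
      ... | no a≢0   = trans (hom a w a≢0) (sym (*-identityˡ (g w)))

    perp-ext : ∀ S v w → χ (perp (ext S v)) w ≡ o w v * χ (perp S) w
    perp-ext S v w = 𝟙-× (perp (ext S v) ∋? w) (dot w v ≟F 0#) (perp S ∋? w)
      (λ p → p v (ext-∋ S v) , λ s Ss → p s (ext-⊇ S v s Ss))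
      -- Orthogonality is tested from the other side: the complement of the line through `w` is a
      -- subspace containing `S` and `v`, hence all of `ext S v`.
      (λ e p s Es → trans (dot-comm w s) (ext-least S v (perp lineW)
        (λ u Su → λ { x (a , r) → on-line x u (trans (dot-comm u w) (p u Su)) a r })
        (λ { x (a , r) → on-line x v (trans (dot-comm v w) e) a r }) s Es w (ext-∋ zeroS w)))
      where
      lineW : Subspace
      lineW = span (w ∷ [])
      on-line : ∀ x u → dot u w ≡ 0# → ∀ a → x ⊕ (-F a) ⊙ w ≡ 𝟘 → dot u x ≡ 0#
      on-line x u e a r = trans (cong (dot u) x≡aw) (trans (dot-⊙ a u w) (trans (cong (a *F_) e) (R.zeroʳ a)))
        where
        x≡aw : x ≡ a ⊙ w
        x≡aw = trans (sym (⊕-cancel′ x (a ⊙ w))) (trans (cong (_⊕ a ⊙ w)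
          (trans (cong (x ⊕_) (sym (⊙-neg a w))) r)) (trans (⊕-comm 𝟘 _) (⊕-identityʳ _)))

    -- With the second argument read as the rows of a matrix, this is the indicator of its kernel.
    Π⊥ : ∀ {j} → V → Vec V j → ℤ
    Π⊥ w []       = 1ℤ
    Π⊥ w (v ∷ vs) = o w v * Π⊥ w vs

    χ-perp-span : ∀ {j} (vs : Vec V j) w → χ (perp (span vs)) w ≡ Π⊥ w vs
    χ-perp-span []       w = 𝟙-yes (perp zeroS ∋? w) (λ { s refl → dot-𝟘 w })
    χ-perp-span (v ∷ vs) w = trans (perp-ext (span vs) v w) (cong (o w v *_) (χ-perp-span vs w))

    -- By `κ-size` this depends only on the size of the span. It is the one quantity through which
    -- all moments are evaluated.
    κ : ∀ {j} → Vec V j → ℤ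
    κ vs = ∑ 𝕍 (λ w → Π⊥ w vs)

    κ-size : ∀ {j} (vs : Vec V j) → size (span vs) * κ vs ≡ qⁿ
    κ-size vs = trans (cong (size (span vs) *_) (∑-cong 𝕍 (λ w → sym (χ-perp-span vs w)))) (size-perp (span vs))

    𝕍^ : ∀ k → Enum (Vec V k)
    𝕍^ k = vecEnum 𝕍 k

    Θ : ∀ {j k} → Vec V j → Vec V k → ℤ
    Θ []       W = 1ℤ
    Θ (v ∷ vs) W = Π⊥ v W * Θ vs W

    Θ-∷ : ∀ {j k} (vs : Vec V j) w (W : Vec V k) → Θ vs (w ∷ W) ≡ Π⊥ w vs * Θ vs W
    Θ-∷ []       w W = refl
    Θ-∷ (v ∷ vs) w W = trans (cong₂ _*_ (cong (_* Π⊥ v W) (o-comm v w)) (Θ-∷ vs w W)) (lemma (o w v) (Π⊥ v W) _ _)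
      where
      lemma : ∀ a b c d → (a * b) * (c * d) ≡ (a * c) * (b * d)
      lemma = solve-∀

    -- All of `vs` lie in the kernel of a matrix exactly when every row is orthogonal to all of
    -- them. The rows are chosen freely of each other, each in `κ vs` ways.
    ∑-Θ : ∀ {j} k (vs : Vec V j) → ∑ (𝕍^ k) (Θ vs) ≡ κ vs ^ k
    ∑-Θ zero vs = trans (+-identityʳ _) (empty vs)
      where
      empty : ∀ {j} (vs : Vec V j) → Θ vs [] ≡ 1ℤ
      empty []       = refl
      empty (v ∷ vs) = trans (*-identityˡ _) (empty vs)
    ∑-Θ (suc k) vs = trans (∑-vec-suc 𝕍 k (Θ vs)) (trans (∑-cong 𝕍 (λ w → ∑-cong (𝕍^ k) (Θ-∷ vs w)))
      (trans (∑-∑-* 𝕍 (𝕍^ k) (λ w → Π⊥ w vs) (Θ vs)) (cong (κ vs *_) (∑-Θ k vs))))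

    IndepIn : ∀ {j} → Subspace → Vec V j → Set
    IndepIn S []      = ⊤
    IndepIn S (w ∷ W) = (S ∋ w × ¬ (span W ∋ w)) × IndepIn S W

    indepIn? : ∀ {j} S (W : Vec V j) → Dec (IndepIn S W)
    indepIn? S []      = yes tt
    indepIn? S (w ∷ W) = ((S ∋? w) ×-dec ¬? (span W ∋? w)) ×-dec indepIn? S W

    span-⊆ : ∀ {j} S (W : Vec V j) → IndepIn S W → ∀ v → span W ∋ v → S ∋ v
    span-⊆ S []      _              v refl = ∋0 S
    span-⊆ S (w ∷ W) ((Sw , _) , h) = ext-least (span W) w S (span-⊆ S W h) Sw

    size-span : ∀ {j} S (W : Vec V j) → IndepIn S W → size (span W) ≡ qz ^ j
    size-span S []      _             = size-zeroS
    size-span S (w ∷ W) ((_ , h) , i) = trans (size-ext (span W) w h) (cong (qz *_) (size-span S W i))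

    count-indep : ∀ S j → ∑ (𝕍^ j) (λ W → 𝟙 (indepIn? S W)) ≡ falling qz (size S) j
    count-indep S zero    = +-identityʳ 1ℤ
    count-indep S (suc j) = begin
      ∑ (𝕍^ (suc j)) (λ W → 𝟙 (indepIn? S W))
        ≡⟨ ∑-vec-suc 𝕍 j _ ⟩
      ∑ 𝕍 (λ w → ∑ (𝕍^ j) (λ W → 𝟙 (indepIn? S (w ∷ W))))
        ≡⟨ ∑-swap 𝕍 (𝕍^ j) _ ⟩
      ∑ (𝕍^ j) (λ W → ∑ 𝕍 (λ w → 𝟙 (indepIn? S (w ∷ W))))
        ≡⟨ ∑-cong (𝕍^ j) (λ W → trans (∑-cong 𝕍 (λ w → trans (𝟙-× (indepIn? S (w ∷ W)) (indepIn? S W)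
              ((S ∋? w) ×-dec ¬? (span W ∋? w)) (λ { (a , b) → b , a }) (λ b a → a , b)) refl))
            (trans (∑-*ˡ 𝕍 (𝟙 (indepIn? S W)) _) (𝟙-*-cong (indepIn? S W) (new-vectors W)))) ⟩
      ∑ (𝕍^ j) (λ W → 𝟙 (indepIn? S W) * (size S - qz ^ j))
        ≡⟨ ∑-*ʳ (𝕍^ j) _ (size S - qz ^ j) ⟩
      ∑ (𝕍^ j) (λ W → 𝟙 (indepIn? S W)) * (size S - qz ^ j)
        ≡⟨ cong (_* (size S - qz ^ j)) (count-indep S j) ⟩
      falling qz (size S) j * (size S - qz ^ j)
        ≡⟨ *-comm (falling qz (size S) j) _ ⟩
      falling qz (size S) (suc j) ∎
      where
      open ≡-Reasoning
      new-vectors : ∀ W → IndepIn S W → ∑ 𝕍 (λ w → 𝟙 ((S ∋? w) ×-dec ¬? (span W ∋? w))) ≡ size S - qz ^ j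
      new-vectors W i = trans (∑-cong 𝕍 pointwise) (trans (∑-sub 𝕍 (χ S) (χ (span W))) (cong (_-_ (size S)) (size-span S W i)))
        where
        pointwise : ∀ w → 𝟙 ((S ∋? w) ×-dec ¬? (span W ∋? w)) ≡ χ S w - χ (span W) w
        pointwise w with S ∋? w | span W ∋? w
        ... | yes _ | yes _ = refl
        ... | yes _ | no  _ = refl
        ... | no  _ | no  _ = refl
        ... | no ¬p | yes p = ⊥-elim (¬p (span-⊆ S W i w p))

  ∑I : ∀ {m} → (Fin m → ℤ) → ℤ
  ∑I {m} = ∑ (finEnum m)

  module _ {A : Set} (E : Enum A) where

    at-most-one : {P : A → Set} (P? : ∀ a → Dec (P a)) → (∀ a b → P a → P b → a ≡ b) →
      ∑ E (λ a → 𝟙 (P? a)) ≤ 1ℤ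
    at-most-one P? uniq with dec-∃ E P?
    ... | no h = ≤-trans (≤-reflexive (trans (∑-cong E (λ a → 𝟙-no (P? a) (λ p → h (a , p)))) (∑-0 E))) 0≤1
    ... | yes (a , p) = ≤-trans (∑-mono E (λ b → 𝟙-mono (P? b) (Enum._≟_ E b a) (λ p′ → uniq b a p′ p)))
                          (≤-reflexive (Enum.once E a))

  -- Intersecting families and the passage to matrices

  module Families {q : ℕ} (F : FiniteField q) (q>1 : 1ℤ < + q) (k : ℕ) (2≤k : 2 ℕ.≤ k) where
    open Spans F q>1 (2 ℕ.* k) public

    -- `u` is the number of vectors orthogonal to four independent ones, the least value of `κ` that
    -- two pairs can produce. `γ` is the order of GL(k,q), the number of ordered bases of a k-space.
    Q u γ : ℤ
    Q = qz ^ k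
    u = qz ^ (2 ℕ.* k ℕ.∸ 4)
    γ = falling qz Q k

    Q>0 : 0ℤ < Q
    Q>0 = ^-pos k q>0

    u>0 : 0ℤ < u
    u>0 = ^-pos (2 ℕ.* k ℕ.∸ 4) q>0

    uᵏ>0 : 0ℤ < u ^ k
    uᵏ>0 = ^-pos k u>0

    qⁿ≡QQ : qⁿ ≡ Q * Q
    qⁿ≡QQ = trans (^-distribˡ-+-* qz k (k ℕ.+ 0)) (cong (λ z → Q * qz ^ z) (ℕ.+-identityʳ k))

    qⁿ≡uq⁴ : qⁿ ≡ qz * qz * (qz * qz * u)
    qⁿ≡uq⁴ = trans (cong (qz ^_) (sym (ℕ.m+[n∸m]≡n (ℕ.*-monoʳ-≤ 2 2≤k)))) (lemma qz u)
      where
      lemma : ∀ a b → a * (a * (a * (a * b))) ≡ a * a * (a * a * b)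
      lemma = solve-∀

    QQ≡uq⁴ : Q * Q ≡ qz * qz * (qz * qz * u)
    QQ≡uq⁴ = trans (sym qⁿ≡QQ) qⁿ≡uq⁴

    qz<Q : qz ≤ Q
    qz<Q = go k 2≤k
      where
      1≤^ : ∀ j → 1ℤ ≤ qz ^ j
      1≤^ j = i<j⇒suc[i]≤j (^-pos j q>0)
      go : ∀ k → 2 ℕ.≤ k → qz ≤ qz ^ k
      go (suc k) _ = ≤-trans (≤-reflexive (sym (*-identityʳ qz))) (*-monoˡ (<⇒≤ q>0) (1≤^ k))

    size-perp-Q : ∀ S → size S ≡ Q → size (perp S) ≡ Q
    size-perp-Q S e = *-cancelˡ Q>0 (trans (cong (_* size (perp S)) (sym e)) (trans (size-perp S) qⁿ≡QQ))

    -- `S` lies in the complement of the span of `W`, and both have `Q` elements.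
    Π⊥-basis : ∀ S → size S ≡ Q → (W : Vec V k) → IndepIn (perp S) W → ∀ v → Π⊥ v W ≡ χ S v
    Π⊥-basis S e W i v = trans (sym (χ-perp-span W v))
      (sym (⊆-size-≡ S (perp (span W)) (λ x Sx s s∈ → trans (dot-comm x s) (span-⊆ (perp S) W i s s∈ x Sx))
        (trans e (sym (size-perp-Q (span W) (size-span (perp S) W i)))) v))

    perp-perp : ∀ S → size S ≡ Q → ∀ v → χ S v ≡ χ (perp (perp S)) v
    perp-perp S e = ⊆-size-≡ S (perp (perp S)) (λ x Sx s s∈ → trans (dot-comm x s) (s∈ x Sx))
      (trans e (sym (size-perp-Q (perp S) (size-perp-Q S e))))

    -- `meets` covers `i` equal to `j` as well, so that `meet-size` can be summed over all members
    -- without an exception for the diagonal.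
    record Family (m : ℕ) : Set₁ where
      field
        Y        : Fin m → Subspace
        size-Y   : ∀ i → size (Y i) ≡ Q
        distinct : ∀ i j → (∀ v → χ (Y i) v ≡ χ (Y j) v) → i ≡ j
        meets    : ∀ i j → ∃ λ v → v ≢ 𝟘 × Y i ∋ v × Y j ∋ v

    module _ {m} (𝓕 : Family m) where
      open Family 𝓕

      -- By `distinct`, a tuple is a basis of the complement of at most one member. All remaining
      -- tuples, the dependent ones among them, contribute only nonnegative terms. `ψ i` has to be
      -- compared with `Ψ` only at matrices whose kernel is `Y i`.
      embed : (Ψ : Vec V k → ℤ) → (∀ W → 0ℤ ≤ Ψ W) → (ψ : Fin m → ℤ) →
        (∀ i W → IndepIn (perp (Y i)) W → (∀ v → Π⊥ v W ≡ χ (Y i) v) → ψ i ≤ Ψ W) →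
        γ * ∑I ψ ≤ ∑ (𝕍^ k) Ψ
      embed Ψ 0≤Ψ ψ ψ≤Ψ = begin
        γ * ∑I ψ
          ≡⟨ sym (∑-*ˡ I γ ψ) ⟩
        ∑I (λ i → γ * ψ i)
          ≡⟨ ∑-cong I (λ i → trans (cong (_* ψ i) (sym (trans (count-indep (perp (Y i)) k)
               (cong (λ s → falling qz s k) (size-perp-Q (Y i) (size-Y i)))))) (sym (∑-*ʳ (𝕍^ k) (β i) (ψ i)))) ⟩
        ∑I (λ i → ∑ (𝕍^ k) (λ W → β i W * ψ i))
          ≤⟨ ∑-mono I (λ i → ∑-mono (𝕍^ k) (λ W → 𝟙-*-mono (indepIn? (perp (Y i)) W)
               (λ b → ψ≤Ψ i W b (Π⊥-basis (Y i) (size-Y i) W b)))) ⟩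
        ∑I (λ i → ∑ (𝕍^ k) (λ W → β i W * Ψ W))
          ≡⟨ ∑-swap I (𝕍^ k) _ ⟩
        ∑ (𝕍^ k) (λ W → ∑I (λ i → β i W * Ψ W))
          ≡⟨ ∑-cong (𝕍^ k) (λ W → ∑-*ʳ I (λ i → β i W) (Ψ W)) ⟩
        ∑ (𝕍^ k) (λ W → ∑I (λ i → β i W) * Ψ W)
          ≤⟨ ∑-mono (𝕍^ k) (λ W → *-mono (∑-nonneg I (λ i → 𝟙-nonneg (indepIn? (perp (Y i)) W))) (0≤Ψ W)
               (at-most-one I (λ i → indepIn? (perp (Y i)) W) (same-basis W)) ≤-refl) ⟩
        ∑ (𝕍^ k) (λ W → 1ℤ * Ψ W)
          ≡⟨ ∑-cong (𝕍^ k) (λ W → *-identityˡ (Ψ W)) ⟩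
        ∑ (𝕍^ k) Ψ ∎
        where
        open ≤-Reasoning
        I = finEnum m
        β : Fin m → Vec V k → ℤ
        β i W = 𝟙 (indepIn? (perp (Y i)) W)
        same-basis : ∀ W i j → IndepIn (perp (Y i)) W → IndepIn (perp (Y j)) W → i ≡ j
        same-basis W i j b b′ = distinct i j (λ v → trans (sym (Π⊥-basis (Y i) (size-Y i) W b v))
          (Π⊥-basis (Y j) (size-Y j) W b′ v))

      meet-size : ∀ i j → qz ≤ ∑ 𝕍 (λ v → χ (Y i) v * χ (Y j) v)
      meet-size i j with meets i j
      ... | v₀ , v₀≢0 , p , r = ≤-trans
        (≤-reflexive (sym (trans (size-ext zeroS v₀ v₀≢0) (trans (cong (qz *_) size-zeroS) (*-identityʳ qz)))))
        (∑-mono 𝕍 (λ v → ≤-trans (𝟙-mono (span (v₀ ∷ []) ∋? v) ((Y i ∋? v) ×-dec (Y j ∋? v))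
          (λ s → line⊆ (Y i) p v s , line⊆ (Y j) r v s))
          (≤-reflexive (𝟙-× ((Y i ∋? v) ×-dec (Y j ∋? v)) (Y i ∋? v) (Y j ∋? v) (λ x → x) _,_))))
        where
        line⊆ : ∀ S → S ∋ v₀ → ∀ v → span (v₀ ∷ []) ∋ v → S ∋ v
        line⊆ S Sv₀ = ext-least zeroS v₀ S (λ { _ refl → ∋0 S }) Sv₀

      perpFamily : Family m
      perpFamily = record
        { Y        = λ i → perp (Y i)
        ; size-Y   = λ i → size-perp-Q (Y i) (size-Y i)
        ; distinct = λ i j e → distinct i j (λ v → trans (perp-perp (Y i) (size-Y i) v)
                       (trans (perp-cong (perp (Y i)) (perp (Y j)) e v) (sym (perp-perp (Y j) (size-Y j) v))))
        ; meets    = perp-meets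
        }
        where
        perp-cong : ∀ S T → (∀ v → χ S v ≡ χ T v) → ∀ v → χ (perp S) v ≡ χ (perp T) v
        perp-cong S T e v = 𝟙-cong (perp S ∋? v) (perp T ∋? v)
          (λ p t Tt → p t (χ≡⇒⊇ S T e t Tt)) (λ p s Ss → p s (χ≡⇒⊇ T S (λ x → sym (e x)) s Ss))
        perp-meets : ∀ i j → ∃ λ v → v ≢ 𝟘 × perp (Y i) ∋ v × perp (Y j) ∋ v
        perp-meets i j with dec-∃ 𝕍 (λ v → ¬? (v ≟V 𝟘) ×-dec ((perp (Y i) ∋? v) ×-dec (perp (Y j) ∋? v)))
        ... | yes h = h
        -- By `perp-meet` the complements share as many vectors as the members, thus at least `q` of
        -- them, whereas here zero would be the only one.
        ... | no  h = ⊥-elim (<⇒≱ q>1 (≤-trans (meet-size i j) (≤-trans (≤-reflexive (sym meet⊥≡meet)) meet⊥≤1)))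
          where
          meet⊥≡meet : ∑ 𝕍 (λ v → χ (perp (Y i)) v * χ (perp (Y j)) v) ≡ ∑ 𝕍 (λ v → χ (Y i) v * χ (Y j) v)
          meet⊥≡meet = *-cancelˡ (*-pos Q>0 Q>0) (trans (cong (_* ∑ 𝕍 (λ v → χ (perp (Y i)) v * χ (perp (Y j)) v))
            (sym (cong₂ _*_ (size-Y i) (size-Y j)))) (trans (perp-meet (Y i) (Y j)) (cong (_* ∑ 𝕍 (λ v → χ (Y i) v * χ (Y j) v)) qⁿ≡QQ)))
          meet⊥≤1 : ∑ 𝕍 (λ v → χ (perp (Y i)) v * χ (perp (Y j)) v) ≤ 1ℤ
          meet⊥≤1 = ≤-trans (∑-mono 𝕍 (λ v → ≤-trans
              (≤-reflexive (sym (𝟙-× ((perp (Y i) ∋? v) ×-dec (perp (Y j) ∋? v)) (perp (Y i) ∋? v) (perp (Y j) ∋? v) (λ x → x) _,_)))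
              (𝟙-mono ((perp (Y i) ∋? v) ×-dec (perp (Y j) ∋? v)) (v ≟V 𝟘) (only-zero v))))
            (≤-reflexive size-zeroS)
            where
            only-zero : ∀ v → perp (Y i) ∋ v × perp (Y j) ∋ v → v ≡ 𝟘
            only-zero v p with v ≟V 𝟘
            ... | yes e = e
            ... | no  e = ⊥-elim (h (v , e , p))

  -- Moments of sums over the kernel of a matrix

  module Moments {q : ℕ} (F : FiniteField q) (q>1 : 1ℤ < + q) (k : ℕ) (2≤k : 2 ℕ.≤ k) where
    open Families F q>1 k 2≤k public

    zero-or-not : ∀ w → w ≡ 𝟘 ⊎ w ≢ 𝟘
    zero-or-not w with w ≟V 𝟘
    ... | yes e = inj₁ e
    ... | no  e = inj₂ e

    q-1≥0 : 0ℤ ≤ qz - 1ℤ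
    q-1≥0 = <⇒≤ q-1>0

    -- The values of `κ` at tuples of rank 1, 2 and 3; at rank 4 the value is `u`.
    κ₁ κ₂ κ₃ : ℤ
    κ₃ = qz * u
    κ₂ = qz * κ₃
    κ₁ = qz * κ₂

    κ₂≥0 : 0ℤ ≤ κ₂
    κ₂≥0 = <⇒≤ (*-pos q>0 (*-pos q>0 u>0))

    κ₂≤κ₁ : κ₂ ≤ κ₁
    κ₂≤κ₁ = ≤-trans (≤-reflexive (sym (*-identityˡ κ₂))) (*-mono 0≤1 κ₂≥0 (<⇒≤ q>1) ≤-refl)

    κ-from-size : ∀ {j} (vs : Vec V j) s c → 0ℤ < s → size (span vs) ≡ s → s * c ≡ qⁿ → κ vs ≡ c
    κ-from-size vs s c 0<s e e′ = *-cancelˡ 0<s (trans (trans (cong (_* κ vs) (sym e)) (κ-size vs)) (sym e′))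

    size-line : ∀ v → v ≢ 𝟘 → size (span (v ∷ [])) ≡ qz
    size-line v v≢0 = trans (size-ext zeroS v v≢0) (trans (cong (qz *_) size-zeroS) (*-identityʳ qz))

    κ-dependent : ∀ v w → w ≢ 𝟘 → span (w ∷ []) ∋ v → κ (v ∷ w ∷ []) ≡ κ₁
    κ-dependent v w w≢0 d = κ-from-size (v ∷ w ∷ []) qz κ₁ q>0
      (trans (size-ext-trivial (span (w ∷ [])) v d) (size-line w w≢0)) (trans (lemma qz u) (sym qⁿ≡uq⁴))
      where
      lemma : ∀ q u → q * (q * (q * (q * u))) ≡ q * q * (q * q * u)
      lemma = solve-∀

    κ-independent : ∀ v w → w ≢ 𝟘 → ¬ (span (w ∷ []) ∋ v) → κ (v ∷ w ∷ []) ≡ κ₂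
    κ-independent v w w≢0 i = κ-from-size (v ∷ w ∷ []) (qz * qz) κ₂ (*-pos q>0 q>0)
      (trans (size-ext (span (w ∷ [])) v i) (cong (qz *_) (size-line w w≢0))) (trans (lemma qz u) (sym qⁿ≡uq⁴))
      where
      lemma : ∀ q u → q * q * (q * (q * u)) ≡ q * q * (q * q * u)
      lemma = solve-∀

    ∑-square : ∀ {A : Set} (E : Enum A) (x : A → ℤ) → ∑ E x * ∑ E x ≡ ∑ E (λ a → ∑ E (λ b → x a * x b))
    ∑-square E x = sym (∑-∑-* E E x x)

    φ C : (V → ℤ) → Subspace → ℤ
    φ f S = ∑ 𝕍 (λ v → χ S v * f v)
    C f S = ∑ 𝕍 (λ v → χ S v * (f v * f v))

    φᵂ : (V → ℤ) → ∀ {j} → Vec V j → ℤ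
    φᵂ f W = ∑ 𝕍 (λ v → Π⊥ v W * f v)

    ∑W-square : ∀ (f : V → ℤ) j → ∑ (𝕍^ j) (λ W → φᵂ f W * φᵂ f W) ≡
      ∑ 𝕍 (λ v → ∑ 𝕍 (λ w → f v * (f w * κ (w ∷ v ∷ []) ^ j)))
    ∑W-square f j = begin
      ∑ (𝕍^ j) (λ W → φᵂ f W * φᵂ f W)
        ≡⟨ ∑-cong (𝕍^ j) (λ W → ∑-square 𝕍 (λ v → Π⊥ v W * f v)) ⟩
      ∑ (𝕍^ j) (λ W → ∑ 𝕍 (λ v → ∑ 𝕍 (λ w → (Π⊥ v W * f v) * (Π⊥ w W * f w))))
        ≡⟨ trans (∑-swap (𝕍^ j) 𝕍 _) (∑-cong 𝕍 (λ v → ∑-swap (𝕍^ j) 𝕍 _)) ⟩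
      ∑ 𝕍 (λ v → ∑ 𝕍 (λ w → ∑ (𝕍^ j) (λ W → (Π⊥ v W * f v) * (Π⊥ w W * f w))))
        ≡⟨ ∑-cong 𝕍 (λ v → ∑-cong 𝕍 (λ w → trans (∑-cong (𝕍^ j) (λ W → lemma₁ (Π⊥ v W) (f v) (Π⊥ w W) (f w)))
             (trans (∑-*ˡ (𝕍^ j) (f v * f w) (Θ (w ∷ v ∷ []))) (trans (cong (f v * f w *_) (∑-Θ j (w ∷ v ∷ [])))
             (*-assoc (f v) (f w) _))))) ⟩
      ∑ 𝕍 (λ v → ∑ 𝕍 (λ w → f v * (f w * κ (w ∷ v ∷ []) ^ j))) ∎
      where
      open ≡-Reasoning
      lemma₁ : ∀ a b c d → (a * b) * (c * d) ≡ (b * d) * (c * (a * 1ℤ))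
      lemma₁ = solve-∀

    module CentredFunction (f : V → ℤ) (hom : Homogeneous f) (f0 : f 𝟘 ≡ 0ℤ) (∑f : ∑ 𝕍 f ≡ 0ℤ) where

      S₂ : ℤ
      S₂ = ∑ 𝕍 (λ v → f v * f v)

      S₂≥0 : 0ℤ ≤ S₂
      S₂≥0 = ∑-nonneg 𝕍 (λ v → square-nonneg (f v))

      -- For nonzero `v`, `κ` is `κ₁` when `w` lies on the line of `v` and `κ₂` otherwise. The part
      -- constant in `w` vanishes since `f` sums to zero, and on the line homogeneity leaves
      -- `(qz - 1ℤ) * f v`. The zero vector is harmless because `f` vanishes there.
      second-moment : ∀ j → ∑ (𝕍^ j) (λ W → φᵂ f W * φᵂ f W) ≡ (κ₁ ^ j - κ₂ ^ j) * ((qz - 1ℤ) * S₂)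
      second-moment j = begin
        ∑ (𝕍^ j) (λ W → φᵂ f W * φᵂ f W)
          ≡⟨ ∑W-square f j ⟩
        ∑ 𝕍 (λ v → ∑ 𝕍 (λ w → f v * (f w * κ (w ∷ v ∷ []) ^ j)))
          ≡⟨ ∑-cong 𝕍 (λ v → ∑-cong 𝕍 (λ w → pointwise v w)) ⟩
        ∑ 𝕍 (λ v → ∑ 𝕍 (λ w → f v * (κ₂ ^ j * f w + d * (χ (span (v ∷ [])) w * f w))))
          ≡⟨ ∑-cong 𝕍 inner ⟩
        ∑ 𝕍 (λ v → (d * (qz - 1ℤ)) * (f v * f v))
          ≡⟨ trans (∑-*ˡ 𝕍 (d * (qz - 1ℤ)) _) (*-assoc d (qz - 1ℤ) S₂) ⟩
        d * ((qz - 1ℤ) * S₂) ∎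
        where
        open ≡-Reasoning
        d = κ₁ ^ j - κ₂ ^ j
        pointwise : ∀ v w → f v * (f w * κ (w ∷ v ∷ []) ^ j) ≡ f v * (κ₂ ^ j * f w + d * (χ (span (v ∷ [])) w * f w))
        pointwise v w with zero-or-not v
        ... | inj₁ refl = trans (cong (_* (f w * κ (w ∷ 𝟘 ∷ []) ^ j)) f0)
                           (sym (cong (_* (κ₂ ^ j * f w + d * (χ (span (𝟘 ∷ [])) w * f w))) f0))
        ... | inj₂ v≢0 with span (v ∷ []) ∋? w
        ...   | yes p = cong (f v *_) (trans (cong (λ z → f w * z ^ j) (κ-dependent w v v≢0 p)) (lemma (f w) (κ₁ ^ j) (κ₂ ^ j)))
          where
          lemma : ∀ a x y → a * x ≡ y * a + (x - y) * (1ℤ * a)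
          lemma = solve-∀
        ...   | no ¬p = cong (f v *_) (trans (cong (λ z → f w * z ^ j) (κ-independent w v v≢0 ¬p)) (lemma (f w) (κ₁ ^ j) (κ₂ ^ j)))
          where
          lemma : ∀ a x y → a * y ≡ y * a + (x - y) * (0ℤ * a)
          lemma = solve-∀
        inner : ∀ v → ∑ 𝕍 (λ w → f v * (κ₂ ^ j * f w + d * (χ (span (v ∷ [])) w * f w))) ≡ (d * (qz - 1ℤ)) * (f v * f v)
        inner v = trans (∑-*ˡ 𝕍 (f v) _) (trans (cong (f v *_) (trans (∑-+ 𝕍 _ _) (cong₂ _+_
          (trans (∑-*ˡ 𝕍 (κ₂ ^ j) f) (cong (κ₂ ^ j *_) ∑f)) (∑-*ˡ 𝕍 d _)))) (finish v))
          where
          lemma₀ : ∀ a b → 0ℤ * (a * 0ℤ + b) ≡ 0ℤ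
          lemma₀ = solve-∀
          lemma₁ : ∀ a → a * (0ℤ * 0ℤ) ≡ 0ℤ
          lemma₁ = solve-∀
          lemma₂ : ∀ x a d c → x * (a * 0ℤ + d * (c * x)) ≡ (d * c) * (x * x)
          lemma₂ = solve-∀
          finish : ∀ v → f v * (κ₂ ^ j * 0ℤ + d * ∑ 𝕍 (λ w → χ (span (v ∷ [])) w * f w)) ≡ (d * (qz - 1ℤ)) * (f v * f v)
          finish v with zero-or-not v
          ... | inj₁ refl = trans (trans (cong (_* (κ₂ ^ j * 0ℤ + d * ∑ 𝕍 (λ w → χ (span (𝟘 ∷ [])) w * f w))) f0)
                  (lemma₀ (κ₂ ^ j) (d * ∑ 𝕍 (λ w → χ (span (𝟘 ∷ [])) w * f w)))) (sym (trans (cong (λ z → (d * (qz - 1ℤ)) * (z * z)) f0) (lemma₁ (d * (qz - 1ℤ)))))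
          ... | inj₂ v≢0 = trans (cong (λ z → f v * (κ₂ ^ j * 0ℤ + d * z)) (∑-line-homogeneous f hom f0 v v≢0))
                           (lemma₂ (f v) (κ₂ ^ j) d (qz - 1ℤ))

      ∑-pairs : ∀ (g : Vec V 2 → ℤ) → ∑ (𝕍^ 2) g ≡ ∑ 𝕍 (λ w → ∑ 𝕍 (λ v → g (v ∷ w ∷ [])))
      ∑-pairs g = trans (∑-vec-suc 𝕍 1 g) (trans (∑-cong 𝕍 (λ v → trans (∑-vec-suc 𝕍 0 _)
        (∑-cong 𝕍 (λ w → +-identityʳ (g (v ∷ w ∷ [])))))) (∑-swap 𝕍 𝕍 _))

      good : Vec V 2 → ℤ
      good π = 𝟙 (indepIn? fullS π)

      pair : (V → ℤ) → Vec V 2 → ℤ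
      pair g (v ∷ w ∷ []) = g v * g w

      h : Vec V 2 → ℤ
      h π = good π * pair f π

      sq : V → ℤ
      sq v = f v * f v

      ∑-pair : ∀ (g : V → ℤ) → ∑ (𝕍^ 2) (pair g) ≡ ∑ 𝕍 g * ∑ 𝕍 g
      ∑-pair g = trans (∑-pairs (pair g)) (trans (∑-swap 𝕍 𝕍 _) (∑-∑-* 𝕍 𝕍 g g))

      𝒢 : ∀ {j} → Vec V j → ℤ
      𝒢 W = ∑ (𝕍^ 2) (λ π → Θ π W * h π)

      -- The full double sum over `S` is the square of `φ f S`. The pairs to be removed have `v` on
      -- the line of `w`, where homogeneity makes them add up to `qz - 1ℤ` times the square of
      -- `f w`.
      𝒢-formula : ∀ {j} (W : Vec V j) S → (∀ v → Π⊥ v W ≡ χ S v) → 𝒢 W ≡ φ f S * φ f S - (qz - 1ℤ) * C f S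
      𝒢-formula W S e = begin
        𝒢 W
          ≡⟨ ∑-pairs (λ π → Θ π W * h π) ⟩
        ∑ 𝕍 (λ w → ∑ 𝕍 (λ v → Θ (v ∷ w ∷ []) W * h (v ∷ w ∷ [])))
          ≡⟨ ∑-cong 𝕍 (λ w → ∑-cong 𝕍 (λ v → trans (cong₂ (λ x y → x * (y * 1ℤ) * h (v ∷ w ∷ [])) (e v) (e w)) (pointwise v w))) ⟩
        ∑ 𝕍 (λ w → ∑ 𝕍 (λ v → (χ S w * f w) * (χ S v * f v - χ (span (w ∷ [])) v * f v)))
          ≡⟨ ∑-cong 𝕍 (λ w → trans (∑-*ˡ 𝕍 (χ S w * f w) _) (trans (cong (χ S w * f w *_) (∑-sub 𝕍 _ _)) (line w))) ⟩
        ∑ 𝕍 (λ w → φ f S * (χ S w * f w) - (qz - 1ℤ) * (χ S w * (f w * f w)))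
          ≡⟨ trans (∑-sub 𝕍 _ _) (cong₂ _-_ (∑-*ˡ 𝕍 (φ f S) _) (∑-*ˡ 𝕍 (qz - 1ℤ) _)) ⟩
        φ f S * φ f S - (qz - 1ℤ) * C f S ∎
        where
        open ≡-Reasoning
        pointwise : ∀ v w → χ S v * (χ S w * 1ℤ) * h (v ∷ w ∷ []) ≡ (χ S w * f w) * (χ S v * f v - χ (span (w ∷ [])) v * f v)
        pointwise v w with S ∋? w
        ... | no _ = lemma (χ S v) (h (v ∷ w ∷ [])) (f w) (χ S v * f v - χ (span (w ∷ [])) v * f v)
          where
          lemma : ∀ a b c d → a * (0ℤ * 1ℤ) * b ≡ (0ℤ * c) * d
          lemma = solve-∀
        ... | yes Sw with zero-or-not w
        ...   | inj₁ refl = trans (cong (λ z → χ S v * (1ℤ * 1ℤ) * (good (v ∷ 𝟘 ∷ []) * (f v * z))) f0)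
                  (trans (lemma (χ S v) (good (v ∷ 𝟘 ∷ [])) (f v) (χ S v * f v - χ (span (𝟘 ∷ [])) v * f v))
                  (cong (λ z → (1ℤ * z) * (χ S v * f v - χ (span (𝟘 ∷ [])) v * f v)) (sym f0)))
          where
          lemma : ∀ a b c d → a * (1ℤ * 1ℤ) * (b * (c * 0ℤ)) ≡ (1ℤ * 0ℤ) * d
          lemma = solve-∀
        ...   | inj₂ w≢0 = trans (cong (λ z → χ S v * (1ℤ * 1ℤ) * (z * (f v * f w))) good≡)
                  (trans (lemma (χ S v) (χ (span (w ∷ [])) v) (f v) (f w))
                  (cong (λ z → (1ℤ * f w) * (χ S v * f v - z * f v)) line⊆))
          where
          lemma : ∀ a b c d → a * (1ℤ * 1ℤ) * ((1ℤ - b) * (c * d)) ≡ (1ℤ * d) * (a * c - (a * b) * c)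
          lemma = solve-∀
          good≡ : good (v ∷ w ∷ []) ≡ 1ℤ - χ (span (w ∷ [])) v
          good≡ = 𝟙-¬ (indepIn? fullS (v ∷ w ∷ [])) (span (w ∷ []) ∋? v)
            (λ i → proj₂ (proj₁ i)) (λ ¬p → (tt , ¬p) , ((tt , w≢0) , tt))
          line⊆ : χ S v * χ (span (w ∷ [])) v ≡ χ (span (w ∷ [])) v
          line⊆ = sym (𝟙-× (span (w ∷ []) ∋? v) (S ∋? v) (span (w ∷ []) ∋? v)
            (λ p → ext-least zeroS w S (λ { _ refl → ∋0 S }) Sw v p , p) (λ _ p → p))
        line : ∀ w → χ S w * f w * (φ f S - ∑ 𝕍 (λ v → χ (span (w ∷ [])) v * f v)) ≡
          φ f S * (χ S w * f w) - (qz - 1ℤ) * (χ S w * (f w * f w))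
        line w with zero-or-not w
        ... | inj₂ w≢0 = trans (cong (λ z → χ S w * f w * (φ f S - z)) (∑-line-homogeneous f hom f0 w w≢0))
                (lemma (χ S w) (f w) (φ f S) (qz - 1ℤ))
          where
          lemma : ∀ s x p c → s * x * (p - c * x) ≡ p * (s * x) - c * (s * (x * x))
          lemma = solve-∀
        ... | inj₁ refl = trans (cong (λ z → χ S 𝟘 * z * (φ f S - ∑ 𝕍 (λ v → χ (span (𝟘 ∷ [])) v * f v))) f0)
                (trans (lemma (χ S 𝟘) _ (φ f S) (qz - 1ℤ))
                (cong (λ z → φ f S * (χ S 𝟘 * z) - (qz - 1ℤ) * (χ S 𝟘 * (z * z))) (sym f0)))
          where
          lemma : ∀ s y p c → s * 0ℤ * (p - y) ≡ p * (s * 0ℤ) - c * (s * (0ℤ * 0ℤ))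
          lemma = solve-∀

      _⧺_ : Vec V 2 → Vec V 2 → Vec V 4
      _⧺_ = Vec._++_

      Θ-⧺ : ∀ {j} π π′ (W : Vec V j) → Θ (π ⧺ π′) W ≡ Θ π W * Θ π′ W
      Θ-⧺ (v ∷ w ∷ []) π′ W = lemma (Π⊥ v W) (Π⊥ w W) (Θ π′ W)
        where
        lemma : ∀ a b c → a * (b * c) ≡ (a * (b * 1ℤ)) * c
        lemma = solve-∀

      -- Linear in `g`. This lets an identity between kernels such as `κ-power` be summed term by
      -- term.
      DS : (Vec V 2 → Vec V 2 → ℤ) → ℤ
      DS g = ∑ (𝕍^ 2) (λ π → ∑ (𝕍^ 2) (λ π′ → h π * h π′ * g π π′))

      DS-+ : ∀ g g′ → DS (λ π π′ → g π π′ + g′ π π′) ≡ DS g + DS g′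
      DS-+ g g′ = trans (∑-cong (𝕍^ 2) (λ π → trans (∑-cong (𝕍^ 2) (λ π′ →
        *-distribˡ-+ (h π * h π′) (g π π′) (g′ π π′))) (∑-+ (𝕍^ 2) _ _))) (∑-+ (𝕍^ 2) _ _)

      DS-* : ∀ c g → DS (λ π π′ → c * g π π′) ≡ c * DS g
      DS-* c g = trans (∑-cong (𝕍^ 2) (λ π → trans (∑-cong (𝕍^ 2) (λ π′ →
        lemma (h π * h π′) c (g π π′))) (∑-*ˡ (𝕍^ 2) c _))) (∑-*ˡ (𝕍^ 2) c _)
        where
        lemma : ∀ a c b → a * (c * b) ≡ c * (a * b)
        lemma = solve-∀

      M : ℕ → ℤ
      M j = ∑ (𝕍^ j) (λ W → 𝒢 W * 𝒢 W)

      -- Expanding the square puts two pairs into the kernel at once, so `∑-Θ` applies to their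
      -- concatenation. Only the exponent remembers the number of rows, which is why `j` equal to 1
      -- and to `k` can be compared.
      M-expand : ∀ j → M j ≡ DS (λ π π′ → κ (π ⧺ π′) ^ j)
      M-expand j = begin
        M j
          ≡⟨ ∑-cong (𝕍^ j) (λ W → ∑-square (𝕍^ 2) (λ π → Θ π W * h π)) ⟩
        ∑ (𝕍^ j) (λ W → ∑ (𝕍^ 2) (λ π → ∑ (𝕍^ 2) (λ π′ → (Θ π W * h π) * (Θ π′ W * h π′))))
          ≡⟨ trans (∑-swap (𝕍^ j) (𝕍^ 2) _) (∑-cong (𝕍^ 2) (λ π → ∑-swap (𝕍^ j) (𝕍^ 2) _)) ⟩
        ∑ (𝕍^ 2) (λ π → ∑ (𝕍^ 2) (λ π′ → ∑ (𝕍^ j) (λ W → (Θ π W * h π) * (Θ π′ W * h π′))))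
          ≡⟨ ∑-cong (𝕍^ 2) (λ π → ∑-cong (𝕍^ 2) (λ π′ → trans (∑-cong (𝕍^ j) (λ W →
               trans (lemma (Θ π W) (h π) (Θ π′ W) (h π′)) (cong (h π * h π′ *_) (sym (Θ-⧺ π π′ W)))))
               (trans (∑-*ˡ (𝕍^ j) (h π * h π′) (Θ (π ⧺ π′))) (cong (h π * h π′ *_) (∑-Θ j (π ⧺ π′)))))) ⟩
        DS (λ π π′ → κ (π ⧺ π′) ^ j) ∎
        where
        open ≡-Reasoning
        lemma : ∀ a b c d → (a * b) * (c * d) ≡ (b * d) * (a * c)
        lemma = solve-∀

      -- On independent pairs this is the indicator of spanning the same plane, that is, of joint
      -- dimension 2.
      τ : Vec V 2 → Vec V 2 → ℤ
      τ (v ∷ w ∷ []) π′ = χ (span π′) v * χ (span π′) w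

      A H : ℤ
      A = DS τ
      H = ∑ (𝕍^ 2) h

      -- κ takes one value for each dimension 2, 3, 4 of the joint span; the right-hand side interpolates κᵏ
      -- affinely at dimensions 3 and 4, and τ supplies the correction at dimension 2.
      κ-power : ∀ π π′ → IndepIn fullS π → IndepIn fullS π′ → u * (qz - 1ℤ) * κ (π ⧺ π′) ^ k ≡
        u ^ k * (u * (qz - Q)) * 1ℤ + (u ^ k * (Q - 1ℤ) * κ (π ⧺ π′) ^ 1
          + u ^ k * (u * (qz - 1ℤ) * (Q - 1ℤ) * (Q - qz)) * τ π π′)
      κ-power (v ∷ w ∷ []) π′ i i′ with span π′ ∋? w | span π′ ∋? v
      ... | yes Pw | yes Pv = trans (cong (λ z → u * (qz - 1ℤ) * z ^ k) κ≡)
              (trans (cong (u * (qz - 1ℤ) *_) (trans (*-^ qz κ₃ k) (cong (Q *_) (*-^ qz u k)))) (trans (lemma qz Q u (u ^ k))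
              (cong (λ z → u ^ k * (u * (qz - Q)) * 1ℤ + (u ^ k * (Q - 1ℤ) * (z * 1ℤ)
                + u ^ k * (u * (qz - 1ℤ) * (Q - 1ℤ) * (Q - qz)) * (1ℤ * 1ℤ))) (sym κ≡))))
        where
        κ≡ : κ ((v ∷ w ∷ []) ⧺ π′) ≡ κ₂
        κ≡ = κ-from-size (v ∷ w ∷ π′) (qz * qz) κ₂ (*-pos q>0 q>0)
          (trans (size-ext-trivial (span (w ∷ π′)) v (ext-⊇ (span π′) w v Pv))
            (trans (size-ext-trivial (span π′) w Pw) (trans (size-span fullS π′ i′) (cong (qz *_) (*-identityʳ qz)))))
          (trans (lemma′ qz u) (sym qⁿ≡uq⁴))
          where
          lemma′ : ∀ q u → q * q * (q * (q * u)) ≡ q * q * (q * q * u)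
          lemma′ = solve-∀
        lemma : ∀ q Q u U → u * (q - 1ℤ) * (Q * (Q * U)) ≡ U * (u * (q - Q)) * 1ℤ
          + (U * (Q - 1ℤ) * (q * (q * u) * 1ℤ) + U * (u * (q - 1ℤ) * (Q - 1ℤ) * (Q - q)) * (1ℤ * 1ℤ))
        lemma = solve-∀
      ... | yes Pw | no ¬Pv = trans (cong (λ z → u * (qz - 1ℤ) * z ^ k) κ≡)
              (trans (cong (u * (qz - 1ℤ) *_) (*-^ qz u k)) (trans (lemma qz Q u (u ^ k))
              (cong (λ z → u ^ k * (u * (qz - Q)) * 1ℤ + (u ^ k * (Q - 1ℤ) * (z * 1ℤ)
                + u ^ k * (u * (qz - 1ℤ) * (Q - 1ℤ) * (Q - qz)) * (0ℤ * 1ℤ))) (sym κ≡))))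
        where
        κ≡ : κ ((v ∷ w ∷ []) ⧺ π′) ≡ κ₃
        κ≡ = κ-from-size (v ∷ w ∷ π′) (qz * (qz * qz)) κ₃ (*-pos q>0 (*-pos q>0 q>0))
          (trans (size-ext (span (w ∷ π′)) v (λ p → ¬Pv (ext-least (span π′) w (span π′) (λ _ z → z) Pw v p)))
            (cong (qz *_) (trans (size-ext-trivial (span π′) w Pw) (trans (size-span fullS π′ i′) (cong (qz *_) (*-identityʳ qz))))))
          (trans (lemma′ qz u) (sym qⁿ≡uq⁴))
          where
          lemma′ : ∀ q u → q * (q * q) * (q * u) ≡ q * q * (q * q * u)
          lemma′ = solve-∀
        lemma : ∀ q Q u U → u * (q - 1ℤ) * (Q * U) ≡ U * (u * (q - Q)) * 1ℤ
          + (U * (Q - 1ℤ) * (q * u * 1ℤ) + U * (u * (q - 1ℤ) * (Q - 1ℤ) * (Q - q)) * (0ℤ * 1ℤ))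
        lemma = solve-∀
      ... | no ¬Pw | Pv? with span (w ∷ π′) ∋? v
      ...   | yes Ev = trans (cong (λ z → u * (qz - 1ℤ) * z ^ k) κ≡)
              (trans (cong (u * (qz - 1ℤ) *_) (*-^ qz u k)) (trans (lemma qz Q u (u ^ k) (𝟙 Pv?))
              (cong (λ z → u ^ k * (u * (qz - Q)) * 1ℤ + (u ^ k * (Q - 1ℤ) * (z * 1ℤ)
                + u ^ k * (u * (qz - 1ℤ) * (Q - 1ℤ) * (Q - qz)) * (𝟙 Pv? * 0ℤ))) (sym κ≡))))
        where
        κ≡ : κ ((v ∷ w ∷ []) ⧺ π′) ≡ κ₃
        κ≡ = κ-from-size (v ∷ w ∷ π′) (qz * (qz * qz)) κ₃ (*-pos q>0 (*-pos q>0 q>0))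
          (trans (size-ext-trivial (span (w ∷ π′)) v Ev)
            (trans (size-ext (span π′) w ¬Pw) (cong (qz *_) (trans (size-span fullS π′ i′) (cong (qz *_) (*-identityʳ qz))))))
          (trans (lemma′ qz u) (sym qⁿ≡uq⁴))
          where
          lemma′ : ∀ q u → q * (q * q) * (q * u) ≡ q * q * (q * q * u)
          lemma′ = solve-∀
        lemma : ∀ q Q u U p → u * (q - 1ℤ) * (Q * U) ≡ U * (u * (q - Q)) * 1ℤ
          + (U * (Q - 1ℤ) * (q * u * 1ℤ) + U * (u * (q - 1ℤ) * (Q - 1ℤ) * (Q - q)) * (p * 0ℤ))
        lemma = solve-∀
      ...   | no ¬Ev = trans (cong (λ z → u * (qz - 1ℤ) * z ^ k) κ≡) (trans (lemma qz Q u (u ^ k) (𝟙 Pv?))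
              (cong (λ z → u ^ k * (u * (qz - Q)) * 1ℤ + (u ^ k * (Q - 1ℤ) * (z * 1ℤ)
                + u ^ k * (u * (qz - 1ℤ) * (Q - 1ℤ) * (Q - qz)) * (𝟙 Pv? * 0ℤ))) (sym κ≡)))
        where
        κ≡ : κ ((v ∷ w ∷ []) ⧺ π′) ≡ u
        κ≡ = κ-from-size (v ∷ w ∷ π′) (qz * (qz * (qz * qz))) u (*-pos q>0 (*-pos q>0 (*-pos q>0 q>0)))
          (trans (size-ext (span (w ∷ π′)) v ¬Ev) (cong (qz *_)
            (trans (size-ext (span π′) w ¬Pw) (cong (qz *_) (trans (size-span fullS π′ i′) (cong (qz *_) (*-identityʳ qz)))))))
          (trans (lemma′ qz u) (sym qⁿ≡uq⁴))
          where
          lemma′ : ∀ q u → q * (q * (q * q)) * u ≡ q * q * (q * q * u)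
          lemma′ = solve-∀
        lemma : ∀ q Q u U p → u * (q - 1ℤ) * U ≡ U * (u * (q - Q)) * 1ℤ
          + (U * (Q - 1ℤ) * (u * 1ℤ) + U * (u * (q - 1ℤ) * (Q - 1ℤ) * (Q - q)) * (p * 0ℤ))
        lemma = solve-∀

  -- The second moment of the sum over independent pairs

  module FourthMoment {q : ℕ} (F : FiniteField q) (q>1 : 1ℤ < + q) (k : ℕ) (2≤k : 2 ℕ.≤ k)
    (f : Vec (FiniteField.Carrier F) (2 ℕ.* k) → ℤ) (hom : Spans.Homogeneous F q>1 (2 ℕ.* k) f)
    (f0 : f (VectorSpace.𝟘 F) ≡ 0ℤ) (∑f : ∑ (Spans.𝕍 F q>1 (2 ℕ.* k)) f ≡ 0ℤ) where
    open Moments F q>1 k 2≤k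
    open CentredFunction f hom f0 ∑f

    h-good : ∀ π π′ {x y} → (IndepIn fullS π → IndepIn fullS π′ → x ≡ y) → h π * h π′ * x ≡ h π * h π′ * y
    h-good π π′ {x} {y} e with indepIn? fullS π | indepIn? fullS π′
    ... | yes i | yes i′ = cong (1ℤ * pair f π * (1ℤ * pair f π′) *_) (e i i′)
    ... | yes i | no _   = lemma (pair f π) (pair f π′) x y
      where
      lemma : ∀ a b x y → 1ℤ * a * (0ℤ * b) * x ≡ 1ℤ * a * (0ℤ * b) * y
      lemma = solve-∀
    ... | no _  | i′ = lemma (pair f π) (𝟙 i′ * pair f π′) x y
      where
      lemma : ∀ a b x y → 0ℤ * a * b * x ≡ 0ℤ * a * b * y
      lemma = solve-∀

    DS-1 : DS (λ _ _ → 1ℤ) ≡ H * H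
    DS-1 = trans (∑-cong (𝕍^ 2) (λ π → ∑-cong (𝕍^ 2) (λ π′ → *-identityʳ (h π * h π′)))) (sym (∑-square (𝕍^ 2) h))

    M-identity : u * (qz - 1ℤ) * M k ≡
      u ^ k * (u * (qz - Q)) * (H * H) + (u ^ k * (Q - 1ℤ) * M 1 + u ^ k * (u * (qz - 1ℤ) * (Q - 1ℤ) * (Q - qz)) * A)
    M-identity = begin
      u * (qz - 1ℤ) * M k
        ≡⟨ cong (u * (qz - 1ℤ) *_) (M-expand k) ⟩
      u * (qz - 1ℤ) * DS κᵏ
        ≡⟨ sym (DS-* (u * (qz - 1ℤ)) κᵏ) ⟩
      DS (λ π π′ → u * (qz - 1ℤ) * κᵏ π π′)
        ≡⟨ ∑-cong (𝕍^ 2) (λ π → ∑-cong (𝕍^ 2) (λ π′ → h-good π π′ (κ-power π π′))) ⟩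
      DS (λ π π′ → c₀ * 1ℤ + (c₁ * κ¹ π π′ + c₂ * τ π π′))
        ≡⟨ trans (DS-+ (λ _ _ → c₀ * 1ℤ) (λ π π′ → c₁ * κ¹ π π′ + c₂ * τ π π′))
             (cong₂ _+_ (DS-* c₀ (λ _ _ → 1ℤ)) (trans (DS-+ (λ π π′ → c₁ * κ¹ π π′) (λ π π′ → c₂ * τ π π′))
               (cong₂ _+_ (DS-* c₁ κ¹) (DS-* c₂ τ)))) ⟩
      c₀ * DS (λ _ _ → 1ℤ) + (c₁ * DS κ¹ + c₂ * A)
        ≡⟨ cong₂ _+_ (cong (c₀ *_) DS-1) (cong (λ z → c₁ * z + c₂ * A) (sym (M-expand 1))) ⟩
      c₀ * (H * H) + (c₁ * M 1 + c₂ * A) ∎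
      where
      open ≡-Reasoning
      c₀ = u ^ k * (u * (qz - Q))
      c₁ = u ^ k * (Q - 1ℤ)
      c₂ = u ^ k * (u * (qz - 1ℤ) * (Q - 1ℤ) * (Q - qz))
      κᵏ κ¹ : Vec V 2 → Vec V 2 → ℤ
      κᵏ π π′ = κ (π ⧺ π′) ^ k
      κ¹ π π′ = κ (π ⧺ π′) ^ 1

    -- In `M-identity` the coefficient of `H * H` carries the factor `qz - Q`, which is not
    -- positive, so that term may be dropped. What is left are the one-row moment `M 1`, a sum over
    -- hyperplanes, and the contribution `A` of coinciding planes.
    M-bound : u * (qz - 1ℤ) * M k ≤ u ^ k * (Q - 1ℤ) * (M 1 + u * (qz - 1ℤ) * (Q - qz) * A)
    M-bound = ≤-witness (u ^ k * (u * (Q - qz)) * (H * H))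
      (*-nonneg (*-nonneg (<⇒≤ uᵏ>0) (*-nonneg (<⇒≤ u>0) (diff-≥0 qz<Q))) (square-nonneg H))
      (trans (lemma (u ^ k) u qz Q (H * H) (M 1) A) (cong (_+ u ^ k * (u * (Q - qz)) * (H * H)) (sym M-identity)))
      where
      lemma : ∀ U u q Q H M A → U * (Q - 1ℤ) * (M + u * (q - 1ℤ) * (Q - q) * A) ≡
        U * (u * (q - Q)) * H + (U * (Q - 1ℤ) * M + U * (u * (q - 1ℤ) * (Q - 1ℤ) * (Q - q)) * A) + U * (u * (Q - q)) * H
      lemma = solve-∀

    t : Vec V 2 → Vec V 2 → ℤ
    t π π′ = good π * good π′ * τ π π′

    good≥0 : ∀ π → 0ℤ ≤ good π
    good≥0 π = 𝟙-nonneg (indepIn? fullS π)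

    τ≥0 : ∀ π π′ → 0ℤ ≤ τ π π′
    τ≥0 (v ∷ w ∷ []) π′ = *-nonneg (χ-nonneg (span π′) v) (χ-nonneg (span π′) w)

    t≥0 : ∀ π π′ → 0ℤ ≤ t π π′
    t≥0 π π′ = *-nonneg (*-nonneg (good≥0 π) (good≥0 π′)) (τ≥0 π π′)

    sqp : Vec V 2 → ℤ
    sqp = pair sq

    sqp-square : ∀ π → pair f π * pair f π ≡ sqp π
    sqp-square (v ∷ w ∷ []) = lemma (f v) (f w)
      where
      lemma : ∀ a b → a * b * (a * b) ≡ a * a * (b * b)
      lemma = solve-∀

    sqp≥0 : ∀ π → 0ℤ ≤ sqp π
    sqp≥0 π = subst (0ℤ ≤_) (sqp-square π) (square-nonneg (pair f π))

    two : ℤ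
    two = + 2

    two≥0 : 0ℤ ≤ two
    two≥0 = +≤+ ℕ.z≤n

    amgm : ∀ π π′ → two * (h π * h π′ * τ π π′) ≤ t π π′ * sqp π + t π π′ * sqp π′
    amgm π π′ = subst₂ (λ x y → two * (h π * h π′ * τ π π′) ≤ t π π′ * x + t π π′ * y) (sqp-square π) (sqp-square π′)
      (≤-witness (t π π′ * ((x - y) * (x - y))) (*-nonneg (t≥0 π π′) (square-nonneg (x - y)))
        (lemma (good π) (good π′) (τ π π′) x y))
      where
      x = pair f π
      y = pair f π′
      lemma : ∀ g g′ τ x y → g * g′ * τ * (x * x) + g * g′ * τ * (y * y) ≡
        (+ 2) * (g * x * (g′ * y) * τ) + g * g′ * τ * ((x - y) * (x - y))
      lemma = solve-∀

    -- Independent pairs in the span of π′ are bases of it, so the relation is symmetric.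
    t-sym : ∀ π π′ → t π π′ ≤ t π′ π
    t-sym π@(v ∷ w ∷ []) π′@(v′ ∷ w′ ∷ []) with indepIn? fullS π | indepIn? fullS π′
    ... | no _  | i′    = ≤-reflexive (lemma (𝟙 i′) (τ π π′) (τ π′ π))
      where
      lemma : ∀ a x y → 0ℤ * a * x ≡ a * 0ℤ * y
      lemma = solve-∀
    ... | yes i | no _  = ≤-reflexive (lemma (τ π π′) (τ π′ π))
      where
      lemma : ∀ x y → 1ℤ * 0ℤ * x ≡ 0ℤ * 1ℤ * y
      lemma = solve-∀
    ... | yes i | yes i′ = *-monoˡ {1ℤ} 0≤1 (≤-trans
        (≤-reflexive (sym (𝟙-× ((span π′ ∋? v) ×-dec (span π′ ∋? w)) (span π′ ∋? v) (span π′ ∋? w) (λ p → p) _,_)))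
        (≤-trans (𝟙-mono ((span π′ ∋? v) ×-dec (span π′ ∋? w)) ((span π ∋? v′) ×-dec (span π ∋? w′)) swap)
        (≤-reflexive (𝟙-× ((span π ∋? v′) ×-dec (span π ∋? w′)) (span π ∋? v′) (span π ∋? w′) (λ p → p) _,_))))
      where
      swap : span π′ ∋ v × span π′ ∋ w → span π ∋ v′ × span π ∋ w′
      swap (pv , pw) = ⊇ v′ (ext-∋ (span (w′ ∷ [])) v′) , ⊇ w′ (ext-⊇ (span (w′ ∷ [])) v′ w′ (ext-∋ zeroS w′))
        where
        π⊆ : ∀ x → span π ∋ x → span π′ ∋ x
        π⊆ = ext-least (span (w ∷ [])) v (span π′) (ext-least zeroS w (span π′) (λ { _ refl → ∋0 (span π′) }) pw) pv
        ⊇ : ∀ x → span π′ ∋ x → span π ∋ x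
        ⊇ = χ≡⇒⊇ (span π) (span π′) (⊆-size-≡ (span π) (span π′) π⊆
          (trans (size-span fullS π i) (sym (size-span fullS π′ i′))))

    q⁴ : ℤ
    q⁴ = qz * qz * (qz * qz)

    q⁴≥0 : 0ℤ ≤ q⁴
    q⁴≥0 = square-nonneg (qz * qz)

    ∑-t : ∀ π′ → ∑ (𝕍^ 2) (λ π → t π π′) ≤ q⁴
    ∑-t π′ with indepIn? fullS π′
    ... | no _ = ≤-trans (≤-reflexive (trans (∑-cong (𝕍^ 2) (λ π → lemma (good π) (τ π π′))) (∑-0 (𝕍^ 2)))) q⁴≥0
      where
      lemma : ∀ a b → a * 0ℤ * b ≡ 0ℤ
      lemma = solve-∀
    ... | yes i′ = ≤-trans (∑-mono (𝕍^ 2) drop) (≤-reflexive (trans (trans (∑-cong (𝕍^ 2) as-pair) (∑-pair (χ (span π′))))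
            (cong₂ _*_ size≡ size≡)))
      where
      size≡ : size (span π′) ≡ qz * qz
      size≡ = trans (size-span fullS π′ i′) (cong (qz *_) (*-identityʳ qz))
      drop : ∀ π → good π * 1ℤ * τ π π′ ≤ 1ℤ * τ π π′
      drop π = *-mono (*-nonneg (good≥0 π) 0≤1) (τ≥0 π π′)
        (≤-trans (≤-reflexive (*-identityʳ (good π))) (𝟙-≤1 (indepIn? fullS π))) ≤-refl
      as-pair : ∀ π → 1ℤ * τ π π′ ≡ pair (χ (span π′)) π
      as-pair (v ∷ w ∷ []) = *-identityˡ (χ (span π′) v * χ (span π′) w)

    -- The inequality of the two means splits each product into squares, and the symmetry of `t`
    -- makes both halves alike. A given plane contains at most `q⁴` pairs of vectors, and the
    -- squares of the pair products sum to at most `S₂ * S₂`.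
    A-bound : A ≤ q⁴ * (S₂ * S₂)
    A-bound = *-cancelˡ-≤ {two} (+<+ (ℕ.s≤s ℕ.z≤n)) (begin
      two * A
        ≡⟨ sym (trans (∑-cong (𝕍^ 2) (λ π → ∑-*ˡ (𝕍^ 2) two _)) (∑-*ˡ (𝕍^ 2) two _)) ⟩
      ∑ (𝕍^ 2) (λ π → ∑ (𝕍^ 2) (λ π′ → two * (h π * h π′ * τ π π′)))
        ≤⟨ ∑-mono (𝕍^ 2) (λ π → ∑-mono (𝕍^ 2) (λ π′ → ≤-trans (amgm π π′)
             (+-monoˡ-≤ (t π π′ * sqp π′) (*-mono (t≥0 π π′) (sqp≥0 π) (t-sym π π′) ≤-refl)))) ⟩
      ∑ (𝕍^ 2) (λ π → ∑ (𝕍^ 2) (λ π′ → t π′ π * sqp π + t π π′ * sqp π′))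
        ≡⟨ trans (∑-cong (𝕍^ 2) (λ π → ∑-+ (𝕍^ 2) _ _)) (∑-+ (𝕍^ 2) _ _) ⟩
      ∑ (𝕍^ 2) (λ π → ∑ (𝕍^ 2) (λ π′ → t π′ π * sqp π)) + ∑ (𝕍^ 2) (λ π → ∑ (𝕍^ 2) (λ π′ → t π π′ * sqp π′))
        ≡⟨ cong (_+_ (∑ (𝕍^ 2) (λ π → ∑ (𝕍^ 2) (λ π′ → t π′ π * sqp π)))) (∑-swap (𝕍^ 2) (𝕍^ 2) _) ⟩
      ∑ (𝕍^ 2) (λ π → ∑ (𝕍^ 2) (λ π′ → t π′ π * sqp π)) + ∑ (𝕍^ 2) (λ π → ∑ (𝕍^ 2) (λ π′ → t π′ π * sqp π))
        ≤⟨ +-mono-≤ one-side one-side ⟩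
      q⁴ * (S₂ * S₂) + q⁴ * (S₂ * S₂)
        ≡⟨ lemma (q⁴ * (S₂ * S₂)) ⟩
      two * (q⁴ * (S₂ * S₂)) ∎)
      where
      open ≤-Reasoning
      lemma : ∀ a → a + a ≡ (+ 2) * a
      lemma = solve-∀
      one-side : ∑ (𝕍^ 2) (λ π → ∑ (𝕍^ 2) (λ π′ → t π′ π * sqp π)) ≤ q⁴ * (S₂ * S₂)
      one-side = ≤-trans (∑-mono (𝕍^ 2) (λ π → ≤-trans (≤-reflexive (∑-*ʳ (𝕍^ 2) (λ π′ → t π′ π) (sqp π)))
          (*-mono (∑-nonneg (𝕍^ 2) (λ π′ → t≥0 π′ π)) (sqp≥0 π) (∑-t π) ≤-refl)))
        (≤-reflexive (trans (∑-*ˡ (𝕍^ 2) q⁴ sqp) (cong (q⁴ *_) (∑-pair sq))))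

    sq≥0 : ∀ v → 0ℤ ≤ sq v
    sq≥0 v = square-nonneg (f v)

    -- Since `sq` is nonnegative there is no cancellation to exploit. It is enough to replace `κ` by
    -- its largest value for nonzero `v`.
    C-moment : ∑ (𝕍^ 1) (λ W → φᵂ sq W * φᵂ sq W) ≤ κ₁ * (S₂ * S₂)
    C-moment = ≤-trans (≤-reflexive (∑W-square sq 1)) (≤-trans
        (∑-mono 𝕍 (λ v → ∑-mono 𝕍 (λ w → pointwise v w)))
        (≤-reflexive (trans (∑-cong 𝕍 (λ v → ∑-*ˡ 𝕍 κ₁ _)) (trans (∑-*ˡ 𝕍 κ₁ _) (cong (κ₁ *_) (∑-∑-* 𝕍 𝕍 sq sq))))))
      where
      κ₁≥0 = ≤-trans κ₂≥0 κ₂≤κ₁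
      rearrange : ∀ x y c → x * (y * (c * 1ℤ)) ≡ c * (x * y)
      rearrange = solve-∀
      κ≤κ₁ : ∀ v w → v ≢ 𝟘 → κ (w ∷ v ∷ []) ≤ κ₁
      κ≤κ₁ v w v≢0 with span (v ∷ []) ∋? w
      ... | yes p = ≤-reflexive (κ-dependent w v v≢0 p)
      ... | no ¬p = ≤-trans (≤-reflexive (κ-independent w v v≢0 ¬p)) κ₂≤κ₁
      pointwise : ∀ v w → sq v * (sq w * κ (w ∷ v ∷ []) ^ 1) ≤ κ₁ * (sq v * sq w)
      pointwise v w with zero-or-not v
      ... | inj₁ refl = ≤-reflexive (trans (cong (λ z → z * z * (sq w * κ (w ∷ 𝟘 ∷ []) ^ 1)) f0)
              (trans (vanish (sq w * κ (w ∷ 𝟘 ∷ []) ^ 1) κ₁ (sq w)) (cong (λ z → κ₁ * (z * z * sq w)) (sym f0))))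
        where
        vanish : ∀ a b c → 0ℤ * 0ℤ * a ≡ b * (0ℤ * 0ℤ * c)
        vanish = solve-∀
      ... | inj₂ v≢0 = ≤-trans (≤-reflexive (rearrange (sq v) (sq w) (κ (w ∷ v ∷ []))))
              (*-mono (∑-nonneg 𝕍 (λ x → Π⊥≥0 x (w ∷ v ∷ []))) (*-nonneg (sq≥0 v) (sq≥0 w)) (κ≤κ₁ v w v≢0) ≤-refl)
        where
        Π⊥≥0 : ∀ {j} x (vs : Vec V j) → 0ℤ ≤ Π⊥ x vs
        Π⊥≥0 x []       = 0≤1
        Π⊥≥0 x (v ∷ vs) = *-nonneg (𝟙-nonneg (dot x v ≟F 0#)) (Π⊥≥0 x vs)

    module _ (c E : ℤ) (c≥0 : 0ℤ ≤ c) (E≥0 : 0ℤ ≤ E) (hyperplane : ∀ (W : Vec V 1) → c * (φᵂ f W * φᵂ f W) ≤ E) where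

      𝒢-bound : ∀ (W : Vec V 1) → c * (𝒢 W * 𝒢 W) ≤
        E * (φᵂ f W * φᵂ f W) + c * (qz - 1ℤ) * (qz - 1ℤ) * (φᵂ sq W * φᵂ sq W)
      𝒢-bound W = ≤-trans (≤-reflexive (cong (λ z → c * (z * z)) formula))
          (≤-trans (≤-witness (c * (two * ((qz - 1ℤ) * ((T * T) * K))))
            (*-nonneg c≥0 (*-nonneg {two} two≥0 (*-nonneg q-1≥0 (*-nonneg (square-nonneg T) K≥0))))
            (lemma c (qz - 1ℤ) T K))
          (+-monoˡ-≤ _ (*-mono (*-nonneg c≥0 (square-nonneg T)) (square-nonneg T) (hyperplane W) ≤-refl)))
        where
        S = perp (span W)
        e : ∀ v → Π⊥ v W ≡ χ S v
        e v = sym (χ-perp-span W v)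
        T K : ℤ
        T = φᵂ f W
        K = φᵂ sq W
        K≥0 : 0ℤ ≤ K
        K≥0 = ∑-nonneg 𝕍 (λ v → *-nonneg (subst (0ℤ ≤_) (sym (e v)) (χ-nonneg S v)) (sq≥0 v))
        formula : 𝒢 W ≡ T * T - (qz - 1ℤ) * K
        formula = trans (𝒢-formula W S e) (cong₂ (λ x y → x * x - (qz - 1ℤ) * y)
          (∑-cong 𝕍 (λ v → cong (_* f v) (sym (e v)))) (∑-cong 𝕍 (λ v → cong (_* (f v * f v)) (sym (e v)))))
        lemma : ∀ c a T K → c * (T * T) * (T * T) + c * a * a * (K * K) ≡
          c * ((T * T - a * K) * (T * T - a * K)) + c * ((+ 2) * (a * ((T * T) * K)))
        lemma = solve-∀

      M₁-bound : c * M 1 ≤ E * (κ₂ * (qz - 1ℤ) * ((qz - 1ℤ) * S₂)) + c * (qz - 1ℤ) * (qz - 1ℤ) * (κ₁ * (S₂ * S₂))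
      M₁-bound = begin
        c * M 1
          ≡⟨ sym (∑-*ˡ (𝕍^ 1) c _) ⟩
        ∑ (𝕍^ 1) (λ W → c * (𝒢 W * 𝒢 W))
          ≤⟨ ∑-mono (𝕍^ 1) 𝒢-bound ⟩
        ∑ (𝕍^ 1) (λ W → E * (φᵂ f W * φᵂ f W) + c * (qz - 1ℤ) * (qz - 1ℤ) * (φᵂ sq W * φᵂ sq W))
          ≡⟨ trans (∑-+ (𝕍^ 1) _ _) (cong₂ _+_ (∑-*ˡ (𝕍^ 1) E _) (∑-*ˡ (𝕍^ 1) (c * (qz - 1ℤ) * (qz - 1ℤ)) _)) ⟩
        E * ∑ (𝕍^ 1) (λ W → φᵂ f W * φᵂ f W) + c * (qz - 1ℤ) * (qz - 1ℤ) * ∑ (𝕍^ 1) (λ W → φᵂ sq W * φᵂ sq W)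
          ≤⟨ +-mono-≤ (≤-reflexive (cong (E *_) (trans (second-moment 1) (lemma qz κ₂ ((qz - 1ℤ) * S₂)))))
               (*-monoˡ (*-nonneg (*-nonneg c≥0 q-1≥0) q-1≥0) C-moment) ⟩
        E * (κ₂ * (qz - 1ℤ) * ((qz - 1ℤ) * S₂)) + c * (qz - 1ℤ) * (qz - 1ℤ) * (κ₁ * (S₂ * S₂)) ∎
        where
        open ≤-Reasoning
        lemma : ∀ q x s → (q * x * 1ℤ - x * 1ℤ) * s ≡ x * (q - 1ℤ) * s
        lemma = solve-∀

      fourth-moment : c * M k ≤ u ^ k * (Q - 1ℤ) * (E * (qz * qz * (qz - 1ℤ)) * S₂ + c * (Q * q⁴) * (S₂ * S₂))
      fourth-moment = *-cancelˡ-≤ (*-pos u>0 q-1>0) (begin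
        u * (qz - 1ℤ) * (c * M k)
          ≡⟨ swap (u * (qz - 1ℤ)) c (M k) ⟩
        c * (u * (qz - 1ℤ) * M k)
          ≤⟨ *-monoˡ c≥0 M-bound ⟩
        c * (u ^ k * (Q - 1ℤ) * (M 1 + d * A))
          ≡⟨ distribute c (u ^ k * (Q - 1ℤ)) (M 1) d A ⟩
        u ^ k * (Q - 1ℤ) * (c * M 1 + c * d * A)
          ≤⟨ *-monoˡ UQ≥0 (+-mono-≤ M₁-bound (*-monoˡ (*-nonneg c≥0 d≥0) A-bound)) ⟩
        u ^ k * (Q - 1ℤ) * (E * (κ₂ * (qz - 1ℤ) * ((qz - 1ℤ) * S₂)) + c * (qz - 1ℤ) * (qz - 1ℤ) * (κ₁ * (S₂ * S₂))
          + c * d * (q⁴ * (S₂ * S₂)))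
          -- After removing `c * u * (q - 1)`, the coefficient of the square of `S₂` is (q - 1) q³ +
          -- (Q - q) q⁴ = Q q⁴ - q³ (q² - q + 1). The last product is the slack.
          ≤⟨ *-monoˡ UQ≥0 (≤-witness (c * u * (qz - 1ℤ) * (qz * qz * qz * (qz * qz - qz + 1ℤ)) * (S₂ * S₂))
               (*-nonneg (*-nonneg (*-nonneg (*-nonneg c≥0 (<⇒≤ u>0)) q-1≥0) (*-nonneg (*-nonneg (square-nonneg qz) (<⇒≤ q>0)) slack≥0))
                 (square-nonneg S₂)) (expand qz u Q c E S₂)) ⟩
        u ^ k * (Q - 1ℤ) * (u * (qz - 1ℤ) * (E * (qz * qz * (qz - 1ℤ)) * S₂ + c * (Q * q⁴) * (S₂ * S₂)))
          ≡⟨ swap (u ^ k * (Q - 1ℤ)) (u * (qz - 1ℤ)) (E * (qz * qz * (qz - 1ℤ)) * S₂ + c * (Q * q⁴) * (S₂ * S₂)) ⟩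
        u * (qz - 1ℤ) * (u ^ k * (Q - 1ℤ) * (E * (qz * qz * (qz - 1ℤ)) * S₂ + c * (Q * q⁴) * (S₂ * S₂))) ∎)
        where
        open ≤-Reasoning
        d : ℤ
        d = u * (qz - 1ℤ) * (Q - qz)
        d≥0 : 0ℤ ≤ d
        d≥0 = *-nonneg (*-nonneg (<⇒≤ u>0) q-1≥0) (diff-≥0 qz<Q)
        UQ≥0 : 0ℤ ≤ u ^ k * (Q - 1ℤ)
        UQ≥0 = *-nonneg (<⇒≤ uᵏ>0) (diff-≥0 (≤-trans (<⇒≤ q>1) qz<Q))
        slack≥0 : 0ℤ ≤ qz * qz - qz + 1ℤ
        slack≥0 = subst (0ℤ ≤_) (factor qz) (+-nonneg (*-nonneg (<⇒≤ q>0) q-1≥0) 0≤1)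
          where
          factor : ∀ q → q * (q - 1ℤ) + 1ℤ ≡ q * q - q + 1ℤ
          factor = solve-∀
        swap : ∀ a b c → a * (b * c) ≡ b * (a * c)
        swap = solve-∀
        distribute : ∀ c x m d a → c * (x * (m + d * a)) ≡ x * (c * m + c * d * a)
        distribute = solve-∀
        expand : ∀ q u Q c E s → u * (q - 1ℤ) * (E * (q * q * (q - 1ℤ)) * s + c * (Q * (q * q * (q * q))) * (s * s)) ≡
          (E * (q * (q * u) * (q - 1ℤ) * ((q - 1ℤ) * s)) + c * (q - 1ℤ) * (q - 1ℤ) * (q * (q * (q * u)) * (s * s))
          + c * (u * (q - 1ℤ) * (Q - q)) * (q * q * (q * q) * (s * s)))
          + c * u * (q - 1ℤ) * (q * q * q * (q * q - q + 1ℤ)) * (s * s)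
        expand = solve-∀

  -- The weighted Cauchy-Schwarz inequality

  module _ {A : Set} (E : Enum A) where

    -- Lagrange's identity: twice the difference of the two sides is the sum of `a i * a j` times
    -- the squares of `x i - x j`.
    cauchy : ∀ (a x : A → ℤ) → (∀ i → 0ℤ ≤ a i) →
      ∑ E (λ i → a i * x i) * ∑ E (λ i → a i * x i) ≤ ∑ E a * ∑ E (λ i → a i * (x i * x i))
    cauchy a x a≥0 = *-cancelˡ-≤ {+ 2} (+<+ (ℕ.s≤s ℕ.z≤n)) (≤-witness
      (∑ E (λ i → ∑ E (λ j → a i * a j * ((x i - x j) * (x i - x j)))))
      (∑-nonneg E (λ i → ∑-nonneg E (λ j → *-nonneg (*-nonneg (a≥0 i) (a≥0 j)) (square-nonneg (x i - x j))))) (sym total))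
      where
      open ≡-Reasoning
      n X X₂ : ℤ
      n  = ∑ E a
      X  = ∑ E (λ i → a i * x i)
      X₂ = ∑ E (λ i → a i * (x i * x i))
      expand : ∀ a b x y → a * b * ((x - y) * (x - y)) ≡ (a * (x * x)) * b + (a * (b * (y * y)) + (- + 2) * ((a * x) * (b * y)))
      expand = solve-∀
      collect : ∀ n X Y → (+ 2) * (X * X) + (Y * n + (n * Y + (- + 2) * (X * X))) ≡ (+ 2) * (n * Y)
      collect = solve-∀
      total : (+ 2) * (X * X) + ∑ E (λ i → ∑ E (λ j → a i * a j * ((x i - x j) * (x i - x j)))) ≡ (+ 2) * (n * X₂)
      total = trans (cong (_+_ ((+ 2) * (X * X))) (begin
        ∑ E (λ i → ∑ E (λ j → a i * a j * ((x i - x j) * (x i - x j))))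
          ≡⟨ ∑-cong E (λ i → ∑-cong E (λ j → expand (a i) (a j) (x i) (x j))) ⟩
        ∑ E (λ i → ∑ E (λ j → (a i * (x i * x i)) * a j + (a i * (a j * (x j * x j)) + (- + 2) * ((a i * x i) * (a j * x j)))))
          ≡⟨ ∑-cong E (λ i → trans (∑-+ E _ _) (cong (_+_ (∑ E (λ j → (a i * (x i * x i)) * a j))) (trans (∑-+ E _ _)
               (cong (_+_ (∑ E (λ j → a i * (a j * (x j * x j))))) (∑-*ˡ E (- + 2) _))))) ⟩
        ∑ E (λ i → ∑ E (λ j → (a i * (x i * x i)) * a j)
          + (∑ E (λ j → a i * (a j * (x j * x j))) + (- + 2) * ∑ E (λ j → (a i * x i) * (a j * x j))))
          ≡⟨ trans (∑-+ E _ _) (cong₂ _+_ (∑-∑-* E E (λ i → a i * (x i * x i)) a) (trans (∑-+ E _ _)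
               (cong₂ _+_ (∑-∑-* E E a (λ j → a j * (x j * x j)))
                 (trans (∑-*ˡ E (- + 2) _) (cong ((- + 2) *_) (∑-∑-* E E (λ i → a i * x i) (λ j → a j * x j))))))) ⟩
        X₂ * n + (n * X₂ + (- + 2) * (X * X)) ∎)) (collect n X X₂)

  square-≤ : ∀ {x y} → - y ≤ x → x ≤ y → x * x ≤ y * y
  square-≤ {x} {y} -y≤x x≤y = ≤-witness ((y - x) * (x - - y)) (*-nonneg (diff-≥0 x≤y) (diff-≥0 -y≤x)) (lemma x y)
    where
    lemma : ∀ x y → y * y ≡ x * x + (y - x) * (x - - y)
    lemma = solve-∀

  -- The inequality obtained by eliminating all sums but m from the moment bounds.
  phase₁-algebra : ∀ N m b q Q U γ S Φ P C G G₂ M → 0ℤ < N → 0ℤ < m → 0ℤ ≤ b → + 2 < q → 1ℤ ≤ Q → 0ℤ ≤ U → 0ℤ ≤ γ →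
    0ℤ ≤ b * (q - + 2) - (q - 1ℤ) → S ≡ N * Φ → Φ * Φ ≤ m * P → b * C ≤ m * S → G ≡ P - (q - 1ℤ) * C → G * G ≤ m * G₂ →
    γ * G₂ ≤ M → b * b * M ≤ U * (Q - 1ℤ) * ((q - 1ℤ) * (q - 1ℤ) * (q - 1ℤ) * Q * Q * (N * m * (N * m)) * S + b * b * Q * (q * q * (q * q)) * (S * S)) →
    (q - + 2) * (N * m * (N * m)) ≤ S →
    m * γ * ((q - + 2) * ((b * (q - + 2) - (q - 1ℤ)) * (b * (q - + 2) - (q - 1ℤ)))) ≤
      U * Q * (Q - 1ℤ) * ((q - 1ℤ) * (q - 1ℤ) * (q - 1ℤ) * Q + (q - + 2) * (b * b * (q * q * (q * q))))
  phase₁-algebra N m b q Q U γ S Φ P C G G₂ M N>0 m>0 b≥0 q>2 Q≥1 U≥0 γ≥0 ρ≥0 S≡ h₁ h₂ G≡ h₄ h₅ h₆ h₇ =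
    *-cancelˡ-≤ scale>0 (begin
      N * N * (N * N) * (m * m * m) * (m * γ * (e * (ρ * ρ)))
        ≡⟨ l₀ N m γ e ρ ⟩
      e * (γ * ((ρ * X) * (ρ * X)))
        ≤⟨ *-monoˡ e≥0 (*-monoˡ γ≥0 (*-mono ρX≥0 R≥0 ρX≤R ρX≤R)) ⟩
      e * (γ * (R * R))
        ≤⟨ *-cancelˡ-≤ (*-pos S>0 S>0) squared ⟩
      N * N * (N * N) * (m * m * m) * (U * Q * (Q - 1ℤ) * (a * a * a * Q + e * (b * b * (q * q * (q * q))))) ∎)
    where
    open ≤-Reasoning
    e a X ρ R : ℤ
    e = q - + 2
    a = q - 1ℤ
    X = N * m * (N * m)
    ρ = b * e - a
    R = b * S - a * X
    e>0 : 0ℤ < e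
    e>0 = +-monoˡ-< (- + 2) q>2
    e≥0 = <⇒≤ e>0
    a≥0 : 0ℤ ≤ a
    a≥0 = subst (0ℤ ≤_) (lemma q) (+-nonneg e≥0 0≤1)
      where
      lemma : ∀ q → q - + 2 + 1ℤ ≡ q - 1ℤ
      lemma = solve-∀
    Nm>0 = *-pos N>0 m>0
    X>0 : 0ℤ < X
    X>0 = *-pos Nm>0 Nm>0
    S>0 : 0ℤ < S
    S>0 = <-≤-trans (*-pos e>0 X>0) h₇
    scale>0 : 0ℤ < N * N * (N * N) * (m * m * m)
    scale>0 = *-pos (*-pos (*-pos N>0 N>0) (*-pos N>0 N>0)) (*-pos (*-pos m>0 m>0) m>0)
    ρX≥0 : 0ℤ ≤ ρ * X
    ρX≥0 = *-nonneg ρ≥0 (<⇒≤ X>0)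
    ρX≤R : ρ * X ≤ R
    ρX≤R = ≤-witness (b * (S - e * X)) (*-nonneg b≥0 (diff-≥0 h₇)) (lemma b S a X e)
      where
      lemma : ∀ b S a X e → b * S - a * X ≡ (b * e - a) * X + b * (S - e * X)
      lemma = solve-∀
    R≥0 : 0ℤ ≤ R
    R≥0 = ≤-trans ρX≥0 ρX≤R
    l₀ : ∀ N m γ e ρ → N * N * (N * N) * (m * m * m) * (m * γ * (e * (ρ * ρ))) ≡
      e * (γ * ((ρ * (N * m * (N * m))) * (ρ * (N * m * (N * m)))))
    l₀ = solve-∀
    -- By `G≡`, the right side is `b * (N * N) * m * P` minus `a * b * (N * N) * m * C`. Hypothesis
    -- `h₁` with `S` equal to `N * Φ` bounds the first below by `b * (S * S)`, and `h₂` bounds the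
    -- second above by `a * X * S`. The difference of these is `S * R`.
    SR≤ : S * R ≤ b * (N * N) * m * G
    SR≤ = ≤-witness (b * (N * N) * (m * P - Φ * Φ) + a * (N * N) * m * (m * S - b * C))
      (+-nonneg (*-nonneg (*-nonneg b≥0 (square-nonneg N)) (diff-≥0 h₁))
        (*-nonneg (*-nonneg (*-nonneg a≥0 (square-nonneg N)) (<⇒≤ m>0)) (diff-≥0 h₂)))
      (trans (cong (b * (N * N) * m *_) G≡) (trans (lemma b N m P a C Φ S)
        (trans (cong (λ z → S * R + b * (z * z - S * S) + w) (sym S≡)) (vanish (S * R) b S w))))
      where
      w = b * (N * N) * (m * P - Φ * Φ) + a * (N * N) * m * (m * S - b * C)
      vanish : ∀ x b s w → x + b * (s * s - s * s) + w ≡ x + w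
      vanish = solve-∀
      lemma : ∀ b N m P a C Φ S → b * (N * N) * m * (P - a * C) ≡ S * (b * S - a * (N * m * (N * m)))
        + b * (N * Φ * (N * Φ) - S * S) + (b * (N * N) * (m * P - Φ * Φ) + a * (N * N) * m * (m * S - b * C))
      lemma = solve-∀
    squared : S * S * (e * (γ * (R * R))) ≤ S * S * (N * N * (N * N) * (m * m * m) * (U * Q * (Q - 1ℤ) * (a * a * a * Q + e * (b * b * (q * q * (q * q))))))
    squared = begin
      S * S * (e * (γ * (R * R)))
        ≡⟨ l₁ S e γ R ⟩
      e * (γ * (S * R * (S * R)))
        ≤⟨ *-monoˡ e≥0 (*-monoˡ γ≥0 (*-mono SR≥0 (≤-trans SR≥0 SR≤) SR≤ SR≤)) ⟩
      e * (γ * (b * (N * N) * m * G * (b * (N * N) * m * G)))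
        ≡⟨ l₂ e γ b N m (G) ⟩
      e * (γ * (b * b * (N * N * (N * N)) * (m * m))) * (G * G)
        ≤⟨ *-monoˡ (*-nonneg e≥0 (*-nonneg γ≥0 (*-nonneg (*-nonneg (square-nonneg b) (square-nonneg (N * N))) (square-nonneg m)))) h₄ ⟩
      e * (γ * (b * b * (N * N * (N * N)) * (m * m))) * (m * G₂)
        ≡⟨ l₃ e γ b N m G₂ ⟩
      e * (N * N * (N * N) * (m * m * m)) * (b * b * (γ * G₂))
        ≤⟨ *-monoˡ (*-nonneg e≥0 (<⇒≤ scale>0)) (≤-trans (*-monoˡ (square-nonneg b) h₅) h₆) ⟩
      e * (N * N * (N * N) * (m * m * m)) * (U * (Q - 1ℤ) * (a * a * a * Q * Q * X * S + b * b * Q * (q * q * (q * q)) * (S * S)))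
        -- The term containing `X * S` is raised to one containing `S * S` by means of `e * X ≤ S`,
        -- so that the square of `S` becomes a common factor and can be cancelled.
        ≤⟨ ≤-witness (N * N * (N * N) * (m * m * m) * (U * (Q - 1ℤ)) * (a * a * a * (Q * Q) * S) * (S - e * X))
             (*-nonneg (*-nonneg (*-nonneg (<⇒≤ scale>0) (*-nonneg U≥0 (diff-≥0 Q≥1)))
               (*-nonneg (*-nonneg (*-nonneg (*-nonneg a≥0 a≥0) a≥0) (square-nonneg Q)) (<⇒≤ S>0))) (diff-≥0 h₇))
             (l₄ (N * N * (N * N) * (m * m * m)) U Q a X S b (q * q * (q * q)) e) ⟩
      S * S * (N * N * (N * N) * (m * m * m) * (U * Q * (Q - 1ℤ) * (a * a * a * Q + e * (b * b * (q * q * (q * q)))))) ∎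
      where
      SR≥0 : 0ℤ ≤ S * R
      SR≥0 = *-nonneg (<⇒≤ S>0) R≥0
      l₁ : ∀ S e γ R → S * S * (e * (γ * (R * R))) ≡ e * (γ * (S * R * (S * R)))
      l₁ = solve-∀
      l₂ : ∀ e γ b N m G → e * (γ * (b * (N * N) * m * G * (b * (N * N) * m * G))) ≡ e * (γ * (b * b * (N * N * (N * N)) * (m * m))) * (G * G)
      l₂ = solve-∀
      l₃ : ∀ e γ b N m G → e * (γ * (b * b * (N * N * (N * N)) * (m * m))) * (m * G) ≡ e * (N * N * (N * N) * (m * m * m)) * (b * b * (γ * G))
      l₃ = solve-∀
      l₄ : ∀ K U Q a X S b w e → S * S * (K * (U * Q * (Q - 1ℤ) * (a * a * a * Q + e * (b * b * w)))) ≡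
        e * K * (U * (Q - 1ℤ) * (a * a * a * Q * Q * X * S + b * b * Q * w * (S * S))) + K * (U * (Q - 1ℤ)) * (a * a * a * (Q * Q) * S) * (S - e * X)
      l₄ = solve-∀

  -- Families in which every point and every hyperplane is sparse

  module Phase₁ {q : ℕ} (F : FiniteField q) (q>1 : 1ℤ < + q) (k : ℕ) (2≤k : 2 ℕ.≤ k)
    {m : ℕ} (𝓕 : Families.Family F q>1 k 2≤k m) where
    open Moments F q>1 k 2≤k
    open Family 𝓕

    I = finEnum m

    mz N : ℤ
    mz = + m
    N  = Q + 1ℤ

    mz≥0 : 0ℤ ≤ mz
    mz≥0 = +≤+ ℕ.z≤n

    N>0 : 0ℤ < N
    N>0 = +-mono-<-≤ Q>0 0≤1

    D D⊥ : V → ℤ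
    D v  = ∑I (λ i → χ (Y i) v)
    D⊥ w = ∑I (λ i → χ (perp (Y i)) w)

    ∑I-const : ∀ c → ∑I {m} (λ _ → c) ≡ mz * c
    ∑I-const = sumFin-const m

    D≥0 : ∀ v → 0ℤ ≤ D v
    D≥0 v = ∑-nonneg I (λ i → χ-nonneg (Y i) v)

    D⊥≥0 : ∀ v → 0ℤ ≤ D⊥ v
    D⊥≥0 v = ∑-nonneg I (λ i → χ-nonneg (perp (Y i)) v)

    D-𝟘 : D 𝟘 ≡ mz
    D-𝟘 = trans (∑-cong I (λ i → 𝟙-yes (Y i ∋? 𝟘) (∋0 (Y i)))) (trans (∑I-const 1ℤ) (*-identityʳ mz))

    -- The average of `D` over the Q² - 1 nonzero vectors is m (Q - 1) / (Q² - 1) = m / (Q + 1). The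
    -- factor `N` keeps the deviation from it integral. Zero lies in every member and would distort
    -- the sums, so it is blanked out.
    f : V → ℤ
    f v = (1ℤ - 𝟙 (v ≟V 𝟘)) * (N * D v - mz)

    f-𝟘 : f 𝟘 ≡ 0ℤ
    f-𝟘 = trans (cong (λ z → (1ℤ - z) * (N * D 𝟘 - mz)) (𝟙-yes (𝟘 ≟V 𝟘) refl)) (*-zeroˡ (N * D 𝟘 - mz))

    f-nonzero : ∀ v → v ≢ 𝟘 → f v ≡ N * D v - mz
    f-nonzero v v≢0 = trans (cong (λ z → (1ℤ - z) * (N * D v - mz)) (𝟙-no (v ≟V 𝟘) v≢0)) (*-identityˡ (N * D v - mz))

    f-hom : Homogeneous f
    f-hom a v a≢0 = cong₂ (λ x y → (1ℤ - x) * (N * y - mz))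
      (𝟙-cong ((a ⊙ v) ≟V 𝟘) (v ≟V 𝟘) (⊙≡0 a v a≢0) (λ e → trans (cong (a ⊙_) e) (⊙-zeroʳ a)))
      (∑-cong I (λ i → χ-⊙ (Y i) a v a≢0))

    f-sum : ∀ (p : V → ℤ) → ∑ 𝕍 (λ v → p v * f v) ≡
      N * (∑I (λ i → ∑ 𝕍 (λ v → p v * χ (Y i) v)) - mz * p 𝟘) - mz * (∑ 𝕍 p - p 𝟘)
    f-sum p = begin
      ∑ 𝕍 (λ v → p v * f v)
        ≡⟨ ∑-cong 𝕍 (λ v → l₁ (p v) (𝟙 (v ≟V 𝟘)) N (D v) mz) ⟩
      ∑ 𝕍 (λ v → (N * (p v * D v) - mz * p v) - 𝟙 (v ≟V 𝟘) * (p v * (N * D v - mz)))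
        ≡⟨ trans (∑-sub 𝕍 _ _) (cong₂ _-_ (trans (∑-sub 𝕍 _ _) (cong₂ _-_ (∑-*ˡ 𝕍 N _) (∑-*ˡ 𝕍 mz p)))
             (∑-δ 𝕍 𝟘 (λ v → p v * (N * D v - mz)))) ⟩
      (N * ∑ 𝕍 (λ v → p v * D v) - mz * ∑ 𝕍 p) - p 𝟘 * (N * D 𝟘 - mz)
        ≡⟨ cong₂ (λ x y → (N * x - mz * ∑ 𝕍 p) - p 𝟘 * (N * y - mz))
             (trans (∑-cong 𝕍 (λ v → sym (∑-*ˡ I (p v) (λ i → χ (Y i) v)))) (∑-swap 𝕍 I _)) D-𝟘 ⟩
      (N * X - mz * ∑ 𝕍 p) - p 𝟘 * (N * mz - mz)
        ≡⟨ l₂ N X mz (∑ 𝕍 p) (p 𝟘) ⟩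
      N * (X - mz * p 𝟘) - mz * (∑ 𝕍 p - p 𝟘) ∎
      where
      open ≡-Reasoning
      X = ∑I (λ i → ∑ 𝕍 (λ v → p v * χ (Y i) v))
      l₁ : ∀ p δ N D m → p * ((1ℤ - δ) * (N * D - m)) ≡ (N * (p * D) - m * p) - δ * (p * (N * D - m))
      l₁ = solve-∀
      l₂ : ∀ N X m P p → (N * X - m * P) - p * (N * m - m) ≡ N * (X - m * p) - m * (P - p)
      l₂ = solve-∀

    ∑f : ∑ 𝕍 f ≡ 0ℤ
    ∑f = trans (∑-cong 𝕍 (λ v → sym (*-identityˡ (f v)))) (trans (f-sum (λ _ → 1ℤ))
      (trans (cong₂ (λ x y → N * (x - mz * 1ℤ) - mz * (y - 1ℤ))
        (trans (∑-cong I (λ i → trans (∑-cong 𝕍 (λ v → *-identityˡ (χ (Y i) v))) (size-Y i))) (∑I-const Q))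
        (trans (∑𝕍-const 1ℤ) (trans (*-identityʳ qⁿ) qⁿ≡QQ))) (lemma Q mz)))
      where
      lemma : ∀ Q m → (Q + 1ℤ) * (m * Q - m * 1ℤ) - m * (Q * Q - 1ℤ) ≡ 0ℤ
      lemma = solve-∀

    open CentredFunction f f-hom f-𝟘 ∑f
    module FM = FourthMoment F q>1 k 2≤k f f-hom f-𝟘 ∑f

    Φ : ℤ
    Φ = ∑I (λ i → φ f (Y i))

    -- `Y i` shares at least `q` vectors with each member. Without zero this yields N m (q - 1) - m
    -- (Q - 1), which equals (q - 2) N m + 2 m.
    φ-lower : ∀ i → (qz - + 2) * (N * mz) ≤ φ f (Y i)
    φ-lower i = ≤-trans (≤-witness ((+ 2) * mz + N * (X - mz * qz))
        (+-nonneg (*-nonneg {+ 2} FM.two≥0 mz≥0) (*-nonneg (<⇒≤ N>0) (diff-≥0 X≥)))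
        (lemma Q mz qz X))
      (≤-reflexive (sym (trans (f-sum (χ (Y i))) (cong₂ (λ x y → N * (X - mz * x) - mz * (y - x))
        (𝟙-yes (Y i ∋? 𝟘) (∋0 (Y i))) (size-Y i)))))
      where
      X = ∑I (λ j → ∑ 𝕍 (λ v → χ (Y i) v * χ (Y j) v))
      X≥ : mz * qz ≤ X
      X≥ = ≤-trans (≤-reflexive (sym (∑I-const qz))) (∑-mono I (λ j → meet-size 𝓕 i j))
      lemma : ∀ Q m q X → (Q + 1ℤ) * (X - m * 1ℤ) - m * (Q - 1ℤ) ≡ (q - + 2) * ((Q + 1ℤ) * m) + ((+ 2) * m + (Q + 1ℤ) * (X - m * q))
      lemma = solve-∀

    ∑φ : ∀ (g : V → ℤ) → ∑I (λ i → ∑ 𝕍 (λ v → χ (Y i) v * g v)) ≡ ∑ 𝕍 (λ v → D v * g v)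
    ∑φ g = trans (∑-swap I 𝕍 _) (∑-cong 𝕍 (λ v → ∑-*ʳ I (λ i → χ (Y i) v) (g v)))

    -- Away from zero one factor of the square of `f` is `N * D v - mz`, and its constant part
    -- contributes nothing since `f` sums to zero.
    S₂≡NΦ : S₂ ≡ N * Φ
    S₂≡NΦ = sym (trans (cong (N *_) (∑φ f)) (trans (sym (∑-*ˡ 𝕍 N _)) (trans (∑-cong 𝕍 pointwise)
      (trans (∑-+ 𝕍 _ _) (trans (cong (_+_ S₂) (trans (∑-*ˡ 𝕍 mz f) (trans (cong (mz *_) ∑f) (*-zeroʳ mz)))) (+-identityʳ S₂))))))
      where
      pointwise : ∀ v → N * (D v * f v) ≡ f v * f v + mz * f v
      pointwise v with zero-or-not v
      ... | inj₁ refl = trans (cong (λ z → N * (D 𝟘 * z)) f-𝟘) (trans (lemma N (D 𝟘) mz) (cong (λ z → z * z + mz * z) (sym f-𝟘)))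
        where
        lemma : ∀ N D m → N * (D * 0ℤ) ≡ 0ℤ * 0ℤ + m * 0ℤ
        lemma = solve-∀
      ... | inj₂ v≢0 = trans (cong (λ z → N * (D v * z)) (f-nonzero v v≢0)) (trans (lemma N (D v) mz)
              (cong (λ z → z * z + mz * z) (sym (f-nonzero v v≢0))))
        where
        lemma : ∀ N D m → N * (D * (N * D - m)) ≡ (N * D - m) * (N * D - m) + m * (N * D - m)
        lemma = solve-∀

    hyperplane-meet : ∀ w i → qz * ∑ 𝕍 (λ v → o v w * χ (Y i) v) ≡ Q + (qz - 1ℤ) * Q * χ (perp (Y i)) w
    hyperplane-meet w i with perp (Y i) ∋? w
    ... | yes p = trans (cong (qz *_) (trans (∑-cong 𝕍 (λ v → trans (*-comm (o v w) _) (trans (𝟙-*-cong (Y i ∋? v)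
            (λ Yv → 𝟙-yes (dot v w ≟F 0#) (trans (dot-comm v w) (p v Yv)))) (*-identityʳ (χ (Y i) v))))) (size-Y i))) (lemma qz Q)
      where
      lemma : ∀ q Q → q * Q ≡ Q + (q - 1ℤ) * Q * 1ℤ
      lemma = solve-∀
    ... | no ¬p = trans (cong (qz *_) (∑-cong 𝕍 (λ v → trans (*-comm (o v w) _) (cong (χ (Y i) v *_)
            (trans (o-comm v w) (cong (λ x → 𝟙 (x ≟F 0#)) (sym (R.+-identityʳ (dot w v)))))))))
            (trans (equidistributed (Y i) w 0# (not-perp (Y i) w ¬p)) (trans (size-Y i) (lemma qz Q)))
      where
      lemma : ∀ q Q → Q ≡ Q + (q - 1ℤ) * Q * 0ℤ
      lemma = solve-∀

    -- A hyperplane sum is, up to a constant factor, the centred function of the dual family: `D⊥ w`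
    -- counts the members inside the hyperplane orthogonal to `w`. Here the sparsity of hyperplanes
    -- comes in.
    φ-hyperplane : ∀ w → w ≢ 𝟘 → qz * ∑ 𝕍 (λ v → o v w * f v) ≡ (qz - 1ℤ) * Q * (N * D⊥ w - mz)
    φ-hyperplane w w≢0 = begin
      qz * ∑ 𝕍 (λ v → o v w * f v)
        ≡⟨ cong (qz *_) (f-sum (λ v → o v w)) ⟩
      qz * (N * (X - mz * o 𝟘 w) - mz * (P - o 𝟘 w))
        ≡⟨ cong (λ z → qz * (N * (X - mz * z) - mz * (P - z))) (𝟙-yes (dot 𝟘 w ≟F 0#) (trans (dot-comm 𝟘 w) (dot-𝟘 w))) ⟩
      qz * (N * (X - mz * 1ℤ) - mz * (P - 1ℤ))
        ≡⟨ l₁ qz N X mz P ⟩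
      N * (qz * X - qz * mz) - mz * (qz * P - qz)
        ≡⟨ cong₂ (λ x y → N * (x - qz * mz) - mz * (y - qz)) qX qP ⟩
      N * (mz * Q + (qz - 1ℤ) * Q * D⊥ w - qz * mz) - mz * (Q * Q - qz)
        ≡⟨ l₂ qz Q mz (D⊥ w) ⟩
      (qz - 1ℤ) * Q * (N * D⊥ w - mz) ∎
      where
      open ≡-Reasoning
      X P : ℤ
      X = ∑I (λ i → ∑ 𝕍 (λ v → o v w * χ (Y i) v))
      P = ∑ 𝕍 (λ v → o v w)
      qX : qz * X ≡ mz * Q + (qz - 1ℤ) * Q * D⊥ w
      qX = trans (sym (∑-*ˡ I qz _)) (trans (∑-cong I (hyperplane-meet w)) (trans (∑-+ I _ _)
        (cong₂ _+_ (∑I-const Q) (∑-*ˡ I ((qz - 1ℤ) * Q) _))))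
      qP : qz * P ≡ Q * Q
      qP = trans (∑-orthogonal w) (trans (cong (λ z → (qz - 1ℤ) * qⁿ * z + qⁿ) (𝟙-no (w ≟V 𝟘) w≢0)) (trans (lemma ((qz - 1ℤ) * qⁿ) qⁿ) qⁿ≡QQ))
        where
        lemma : ∀ a b → a * 0ℤ + b ≡ b
        lemma = solve-∀
      l₁ : ∀ q N X m P → q * (N * (X - m * 1ℤ) - m * (P - 1ℤ)) ≡ N * (q * X - q * m) - m * (q * P - q)
      l₁ = solve-∀
      l₂ : ∀ q Q m d → (Q + 1ℤ) * (m * Q + (q - 1ℤ) * Q * d - q * m) - m * (Q * Q - q) ≡ (q - 1ℤ) * Q * ((Q + 1ℤ) * d - m)
      l₂ = solve-∀

    module _ (b : ℤ) (b≥0 : 0ℤ ≤ b) (b≤N : b ≤ N) (m>0 : 0ℤ < mz) (q>2 : + 2 < qz) (γ≥0 : 0ℤ ≤ γ)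
      (ρ≥0 : 0ℤ ≤ b * (qz - + 2) - (qz - 1ℤ))
      (points : ∀ v → v ≢ 𝟘 → b * D v ≤ mz) (hyperplanes : ∀ w → w ≢ 𝟘 → b * D⊥ w ≤ mz) where

      private
        c E g₁ : ℤ
        c  = b * qz * (b * qz)
        g₁ = (qz - 1ℤ) * Q
        E  = g₁ * (N * mz) * (g₁ * (N * mz))

      hyperplane-bound : ∀ (W : Vec V 1) → c * (φᵂ f W * φᵂ f W) ≤ E
      hyperplane-bound W@(w ∷ []) with zero-or-not w
      -- For the zero row the kernel is the whole space, over which `f` sums to zero.
      ... | inj₁ refl = ≤-trans (≤-reflexive (trans (cong (λ z → c * (z * z)) T≡0) (lemma c))) (square-nonneg (g₁ * (N * mz)))
        where
        lemma : ∀ c → c * (0ℤ * 0ℤ) ≡ 0ℤ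
        lemma = solve-∀
        T≡0 : φᵂ f W ≡ 0ℤ
        T≡0 = trans (∑-cong 𝕍 (λ v → trans (cong (λ z → z * 1ℤ * f v) (𝟙-yes (dot v 𝟘 ≟F 0#) (dot-𝟘 v)))
          (trans (cong (_* f v) (*-identityʳ 1ℤ)) (*-identityˡ (f v))))) ∑f
      ... | inj₂ w≢0 = ≤-trans (≤-reflexive (trans (l₁ b qz (φᵂ f W)) (trans (cong (λ z → b * z * (b * z)) qT) (l₂ b g₁ (N * D⊥ w - mz)))))
            (≤-trans (*-monoˡ (square-nonneg g₁) (square-≤ lower upper)) (≤-reflexive (l₃ g₁ (N * mz))))
        where
        qT : qz * φᵂ f W ≡ g₁ * (N * D⊥ w - mz)
        qT = trans (cong (qz *_) (∑-cong 𝕍 (λ v → cong (_* f v) (*-identityʳ (o v w))))) (φ-hyperplane w w≢0)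
        l₁ : ∀ b q T → b * q * (b * q) * (T * T) ≡ b * (q * T) * (b * (q * T))
        l₁ = solve-∀
        l₂ : ∀ b g x → b * (g * x) * (b * (g * x)) ≡ g * g * (b * x * (b * x))
        l₂ = solve-∀
        l₃ : ∀ g x → g * g * (x * x) ≡ g * x * (g * x)
        l₃ = solve-∀
        upper : b * (N * D⊥ w - mz) ≤ N * mz
        upper = ≤-witness (N * (mz - b * D⊥ w) + b * mz)
          (+-nonneg (*-nonneg (<⇒≤ N>0) (diff-≥0 (hyperplanes w w≢0))) (*-nonneg b≥0 mz≥0)) (lemma b N (D⊥ w) mz)
          where
          lemma : ∀ b N d m → N * m ≡ b * (N * d - m) + (N * (m - b * d) + b * m)
          lemma = solve-∀
        -- `D⊥ w` may be zero, and then `b ≤ N` is what the estimate rests on.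
        lower : - (N * mz) ≤ b * (N * D⊥ w - mz)
        lower = ≤-witness (b * (N * D⊥ w) + (N - b) * mz)
          (+-nonneg (*-nonneg b≥0 (*-nonneg (<⇒≤ N>0) (D⊥≥0 w))) (*-nonneg (diff-≥0 b≤N) mz≥0)) (lemma b N (D⊥ w) mz)
          where
          lemma : ∀ b N d m → b * (N * d - m) ≡ - (N * m) + (b * (N * d) + (N - b) * m)
          lemma = solve-∀

      ∑C-bound : b * ∑I (λ i → C f (Y i)) ≤ mz * S₂
      ∑C-bound = ≤-trans (≤-reflexive (trans (cong (b *_) (∑φ sq)) (sym (∑-*ˡ 𝕍 b _))))
        (≤-trans (∑-mono 𝕍 pointwise) (≤-reflexive (∑-*ˡ 𝕍 mz sq)))
        where
        pointwise : ∀ v → b * (D v * sq v) ≤ mz * sq v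
        pointwise v with zero-or-not v
        ... | inj₁ refl = ≤-reflexive (trans (cong (λ z → b * (D 𝟘 * (z * z))) f-𝟘) (trans (lemma b (D 𝟘) mz) (cong (λ z → mz * (z * z)) (sym f-𝟘))))
          where
          lemma : ∀ b d m → b * (d * (0ℤ * 0ℤ)) ≡ m * (0ℤ * 0ℤ)
          lemma = solve-∀
        ... | inj₂ v≢0 = ≤-trans (≤-reflexive (sym (*-assoc b (D v) (sq v))))
                (*-mono (*-nonneg b≥0 (D≥0 v)) (square-nonneg (f v)) (points v v≢0) ≤-refl)

      g : Fin m → ℤ
      g i = φ f (Y i) * φ f (Y i) - (qz - 1ℤ) * C f (Y i)

      Q≥1 : 1ℤ ≤ Q
      Q≥1 = ≤-trans (<⇒≤ q>1) qz<Q

      -- At every basis of the complement of `Y i`, `𝒢` takes the value `g i`, so `embed` bounds `γ`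
      -- times the sum of the squares of `g` by `M k`. Sparse points make the diagonal part of `g`
      -- small, sparse hyperplanes make `M k` small, and `S₂-lower` is what the intersection
      -- property contributes.
      no-dense-star : mz * γ * ((qz - + 2) * ((b * (qz - + 2) - (qz - 1ℤ)) * (b * (qz - + 2) - (qz - 1ℤ)))) ≤
        u ^ k * Q * (Q - 1ℤ) * ((qz - 1ℤ) * (qz - 1ℤ) * (qz - 1ℤ) * Q + (qz - + 2) * (b * b * (qz * qz * (qz * qz))))
      no-dense-star = phase₁-algebra N mz b qz Q (u ^ k) γ S₂ Φ (∑I (λ i → φ f (Y i) * φ f (Y i))) (∑I (λ i → C f (Y i)))
        (∑I g) (∑I (λ i → g i * g i)) (M k)
        N>0 m>0 b≥0 q>2 Q≥1 (<⇒≤ uᵏ>0) γ≥0 ρ≥0 S₂≡NΦ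
        (cauchyI (λ i → φ f (Y i))) ∑C-bound
        (trans (∑-sub I _ _) (cong (_-_ (∑I (λ i → φ f (Y i) * φ f (Y i)))) (∑-*ˡ I (qz - 1ℤ) _)))
        (cauchyI g)
        (embed 𝓕 (λ W → 𝒢 W * 𝒢 W) (λ W → square-nonneg (𝒢 W)) (λ i → g i * g i)
          (λ i W _ e → ≤-reflexive (cong (λ z → z * z) (sym (𝒢-formula W (Y i) e)))))
        fourth S₂-lower
        where
        open ≤-Reasoning
        cauchyI : ∀ (x : Fin m → ℤ) → ∑I x * ∑I x ≤ mz * ∑I (λ i → x i * x i)
        cauchyI x = subst₂ _≤_ (cong₂ _*_ unit unit)
          (cong₂ _*_ (trans (∑I-const 1ℤ) (*-identityʳ mz)) (∑-cong I (λ i → *-identityˡ (x i * x i))))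
          (cauchy I (λ _ → 1ℤ) x (λ _ → 0≤1))
          where
          unit : ∑I (λ i → 1ℤ * x i) ≡ ∑I x
          unit = ∑-cong I (λ i → *-identityˡ (x i))
        S₂-lower : (qz - + 2) * (N * mz * (N * mz)) ≤ S₂
        S₂-lower = begin
          (qz - + 2) * (N * mz * (N * mz))
            ≡⟨ lemma (qz - + 2) N mz ⟩
          N * (mz * ((qz - + 2) * (N * mz)))
            ≤⟨ *-monoˡ (<⇒≤ N>0) (≤-trans (≤-reflexive (sym (∑I-const ((qz - + 2) * (N * mz))))) (∑-mono I φ-lower)) ⟩
          N * Φ
            ≡⟨ sym S₂≡NΦ ⟩
          S₂ ∎
          where
          lemma : ∀ e N m → e * (N * m * (N * m)) ≡ N * (m * (e * (N * m)))
          lemma = solve-∀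
        fourth : b * b * M k ≤ u ^ k * (Q - 1ℤ) * ((qz - 1ℤ) * (qz - 1ℤ) * (qz - 1ℤ) * Q * Q * (N * mz * (N * mz)) * S₂
          + b * b * Q * (qz * qz * (qz * qz)) * (S₂ * S₂))
        fourth = *-cancelˡ-≤ (*-pos q>0 q>0) (begin
          qz * qz * (b * b * M k)
            ≡⟨ l₁ qz b (M k) ⟩
          c * M k
            ≤⟨ FM.fourth-moment c E (square-nonneg (b * qz)) (square-nonneg (g₁ * (N * mz))) hyperplane-bound ⟩
          u ^ k * (Q - 1ℤ) * (E * (qz * qz * (qz - 1ℤ)) * S₂ + c * (Q * FM.q⁴) * (S₂ * S₂))
            ≡⟨ l₂ (u ^ k * (Q - 1ℤ)) qz Q (N * mz) S₂ b ⟩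
          qz * qz * (u ^ k * (Q - 1ℤ) * ((qz - 1ℤ) * (qz - 1ℤ) * (qz - 1ℤ) * Q * Q * (N * mz * (N * mz)) * S₂
            + b * b * Q * (qz * qz * (qz * qz)) * (S₂ * S₂))) ∎)
          where
          l₁ : ∀ q b M → q * q * (b * b * M) ≡ b * q * (b * q) * M
          l₁ = solve-∀
          l₂ : ∀ U q Q x S b → U * ((q - 1ℤ) * Q * x * ((q - 1ℤ) * Q * x) * (q * q * (q - 1ℤ)) * S + b * q * (b * q) * (Q * (q * q * (q * q))) * (S * S)) ≡
            q * q * (U * ((q - 1ℤ) * (q - 1ℤ) * (q - 1ℤ) * Q * Q * (x * x) * S + b * b * Q * (q * q * (q * q)) * (S * S)))
          l₂ = solve-∀

  -- Families with a dense point

  phase₂-algebra : ∀ γ B U Q q E₂ N Φ d m → 0ℤ < N → 0ℤ < d → 0ℤ ≤ U → 0ℤ ≤ γ → 1ℤ ≤ Q → 1ℤ ≤ q → 0ℤ ≤ E₂ →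
    γ * B ≤ U * (Q * Q - Q) * ((q - 1ℤ) * q * E₂) → E₂ ≡ N * Φ → Φ * Φ ≤ d * B →
    γ * ((m - d) * ((q - + 2) * (N * d) * ((q - + 2) * (N * d)))) ≤ U * (Q * Q * Q - Q * Q) * ((q - 1ℤ) * E₂) →
    γ * γ * ((m - d) * ((q - + 2) * (q - + 2) * d)) ≤ U * U * (Q * Q * Q) * ((Q - 1ℤ) * (Q - 1ℤ)) * (q * ((q - 1ℤ) * (q - 1ℤ)))
  phase₂-algebra γ B U Q q E₂ N Φ d m N>0 d>0 U≥0 γ≥0 Q≥1 q≥1 E₂≥0 h₁ E₂≡ h₃ h₄ =
    *-cancelˡ-≤ (*-pos (*-pos N>0 N>0) d>0) (begin
      N * N * d * (γ * γ * ((m - d) * ((q - + 2) * (q - + 2) * d)))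
        ≡⟨ l₁ N d γ m (q - + 2) ⟩
      γ * (γ * ((m - d) * ((q - + 2) * (N * d) * ((q - + 2) * (N * d)))))
        ≤⟨ *-monoˡ γ≥0 h₄ ⟩
      γ * (U * (Q * Q * Q - Q * Q) * ((q - 1ℤ) * E₂))
        ≡⟨ l₂ γ U Q (q - 1ℤ) E₂ ⟩
      U * (Q * Q * (Q - 1ℤ)) * (q - 1ℤ) * (γ * E₂)
        ≤⟨ *-monoˡ (*-nonneg (*-nonneg U≥0 (*-nonneg (square-nonneg Q) Q-1≥0)) q-1≥0) energy ⟩
      U * (Q * Q * (Q - 1ℤ)) * (q - 1ℤ) * (N * N * d * (U * (Q * (Q - 1ℤ)) * ((q - 1ℤ) * q)))
        ≡⟨ l₃ U Q q N d ⟩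
      N * N * d * (U * U * (Q * Q * Q) * ((Q - 1ℤ) * (Q - 1ℤ)) * (q * ((q - 1ℤ) * (q - 1ℤ)))) ∎)
    where
    open ≤-Reasoning
    Q-1≥0 = diff-≥0 Q≥1
    q-1≥0 = diff-≥0 q≥1
    l₁ : ∀ N d γ m e → N * N * d * (γ * γ * ((m - d) * (e * e * d))) ≡ γ * (γ * ((m - d) * (e * (N * d) * (e * (N * d)))))
    l₁ = solve-∀
    l₂ : ∀ γ U Q a E → γ * (U * (Q * Q * Q - Q * Q) * (a * E)) ≡ U * (Q * Q * (Q - 1ℤ)) * a * (γ * E)
    l₂ = solve-∀
    l₃ : ∀ U Q q N d → U * (Q * Q * (Q - 1ℤ)) * (q - 1ℤ) * (N * N * d * (U * (Q * (Q - 1ℤ)) * ((q - 1ℤ) * q))) ≡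
      N * N * d * (U * U * (Q * Q * Q) * ((Q - 1ℤ) * (Q - 1ℤ)) * (q * ((q - 1ℤ) * (q - 1ℤ))))
    l₃ = solve-∀
    K : ℤ
    K = N * N * d * (U * (Q * (Q - 1ℤ)) * ((q - 1ℤ) * q))
    K≥0 : 0ℤ ≤ K
    K≥0 = *-nonneg (*-nonneg (square-nonneg N) (<⇒≤ d>0))
      (*-nonneg (*-nonneg U≥0 (*-nonneg (≤-trans 0≤1 Q≥1) Q-1≥0)) (*-nonneg q-1≥0 (≤-trans 0≤1 q≥1)))
    energy : γ * E₂ ≤ K
    -- The square of `E₂` is at most `N * N * d * B` by `E₂≡` and `h₃`, and `h₁` bounds `γ * B` by a
    -- multiple of `E₂`. One factor `E₂` then cancels, unless it is zero.
    energy with E₂ ≤? 0ℤ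
    ... | yes E₂≤0 = ≤-trans (≤-reflexive (trans (cong (γ *_) (≤-antisym E₂≤0 E₂≥0)) (*-zeroʳ γ))) K≥0
    ... | no  E₂≰0 = *-cancelˡ-≤ (≰⇒> E₂≰0) (begin
      E₂ * (γ * E₂)
        ≡⟨ trans (cong (λ z → z * (γ * z)) E₂≡) (m₁ γ N Φ) ⟩
      γ * (N * N) * (Φ * Φ)
        ≤⟨ *-monoˡ (*-nonneg γ≥0 (square-nonneg N)) h₃ ⟩
      γ * (N * N) * (d * B)
        ≡⟨ m₂ γ N d B ⟩
      N * N * d * (γ * B)
        ≤⟨ *-monoˡ (*-nonneg (square-nonneg N) (<⇒≤ d>0)) h₁ ⟩
      N * N * d * (U * (Q * Q - Q) * ((q - 1ℤ) * q * E₂))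
        ≡⟨ m₃ N d U Q q E₂ ⟩
      E₂ * K ∎)
      where
      m₁ : ∀ γ N Φ → N * Φ * (γ * (N * Φ)) ≡ γ * (N * N) * (Φ * Φ)
      m₁ = solve-∀
      m₂ : ∀ γ N d B → γ * (N * N) * (d * B) ≡ N * N * d * (γ * B)
      m₂ = solve-∀
      m₃ : ∀ N d U Q q E → N * N * d * (U * (Q * Q - Q) * ((q - 1ℤ) * q * E)) ≡ E * (N * N * d * (U * (Q * (Q - 1ℤ)) * ((q - 1ℤ) * q)))
      m₃ = solve-∀

  module Phase₂ {q : ℕ} (F : FiniteField q) (q>1 : 1ℤ < + q) (k : ℕ) (2≤k : 2 ℕ.≤ k)
    {m : ℕ} (𝓕 : Families.Family F q>1 k 2≤k m)
    (p : Vec (FiniteField.Carrier F) (2 ℕ.* k)) (p≢0 : p ≢ VectorSpace.𝟘 F) where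
    open Moments F q>1 k 2≤k
    open Family 𝓕

    I = finEnum m

    P : Subspace
    P = span (p ∷ [])

    a : Fin m → ℤ
    a i = χ (Y i) p

    a≥0 : ∀ i → 0ℤ ≤ a i
    a≥0 i = χ-nonneg (Y i) p

    Q₁ d₀ N E mz : ℤ
    Q₁ = qz ^ (k ℕ.∸ 1)
    d₀ = ∑I a
    N  = Q₁ * Q - 1ℤ
    E  = (Q₁ - 1ℤ) * d₀
    mz = + m

    d₀≥0 : 0ℤ ≤ d₀
    d₀≥0 = ∑-nonneg I a≥0

    Q≡qQ₁ : Q ≡ qz * Q₁
    Q≡qQ₁ = go k 2≤k
      where
      go : ∀ k → 2 ℕ.≤ k → qz ^ k ≡ qz * qz ^ (k ℕ.∸ 1)
      go (suc k) _ = refl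

    Q₁≥1 : 1ℤ ≤ Q₁
    Q₁≥1 = i<j⇒suc[i]≤j (^-pos (k ℕ.∸ 1) q>0)

    Q≥1 : 1ℤ ≤ Q
    Q≥1 = ≤-trans (<⇒≤ q>1) qz<Q

    N>0 : 0ℤ < N
    N>0 = +-monoˡ-< (- 1ℤ) (<-≤-trans q>1 (≤-trans qz<Q (≤-trans (≤-reflexive (sym (*-identityˡ Q)))
      (*-mono 0≤1 (<⇒≤ Q>0) Q₁≥1 ≤-refl))))

    e : V → ℤ
    e v = ∑I (λ i → a i * χ (Y i) v)

    e≥0 : ∀ v → 0ℤ ≤ e v
    e≥0 v = ∑-nonneg I (λ i → *-nonneg (a≥0 i) (χ-nonneg (Y i) v))

    P⊆Y : ∀ i → Y i ∋ p → ∀ v → P ∋ v → Y i ∋ v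
    P⊆Y i Yp = ext-least zeroS p (Y i) (λ { _ refl → ∋0 (Y i) }) Yp

    e-on-P : ∀ v → P ∋ v → e v ≡ d₀
    e-on-P v Pv = ∑-cong I (λ i → trans (𝟙-*-cong (Y i ∋? p) (λ Yp → 𝟙-yes (Y i ∋? v) (P⊆Y i Yp v Pv))) (*-identityʳ (a i)))

    -- `e v` counts the members through both `p` and `v`. It is `d₀` on `P`, and off `P` its average
    -- is d₀ (Q - q) / (Q² - q) = E / N. The deviation is cleared of denominators and blanked out on
    -- `P`.
    ê : V → ℤ
    ê v = (1ℤ - χ P v) * (N * e v - E)

    ê-on-P : ∀ v → P ∋ v → ê v ≡ 0ℤ
    ê-on-P v Pv = trans (cong (λ z → (1ℤ - z) * (N * e v - E)) (𝟙-yes (P ∋? v) Pv)) (*-zeroˡ (N * e v - E))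

    ê-off-P : ∀ v → ¬ (P ∋ v) → ê v ≡ N * e v - E
    ê-off-P v ¬Pv = trans (cong (λ z → (1ℤ - z) * (N * e v - E)) (𝟙-no (P ∋? v) ¬Pv)) (*-identityˡ (N * e v - E))

    ê-𝟘 : ê 𝟘 ≡ 0ℤ
    ê-𝟘 = ê-on-P 𝟘 (∋0 P)

    ê-hom : Homogeneous ê
    ê-hom c v c≢0 = cong₂ (λ x y → (1ℤ - x) * (N * y - E)) (χ-⊙ P c v c≢0) (∑-cong I (λ i → cong (a i *_) (χ-⊙ (Y i) c v c≢0)))

    -- Every member counted by `e` contains `P`. So `ê` is in effect a function on the quotient by
    -- `P`.
    ê-invariant : ∀ x w → P ∋ w → ê (w ⊕ x) ≡ ê x
    ê-invariant x w Pw = cong₂ (λ x y → (1ℤ - x) * (N * y - E)) (shift P Pw)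
        (∑-cong I (λ i → 𝟙-*-cong (Y i ∋? p) (λ Yp → shift (Y i) (P⊆Y i Yp w Pw))))
      where
      shift : ∀ S → S ∋ w → χ S (w ⊕ x) ≡ χ S x
      shift S Sw = 𝟙-cong (S ∋? (w ⊕ x)) (S ∋? x) (λ h → ∋-shift S Sw (subst (S ∋_) (⊕-comm w x) h)) (∋⊕ S Sw)

    ∑e-weighted : ∀ (g : V → ℤ) → ∑ 𝕍 (λ v → g v * e v) ≡ ∑I (λ i → a i * ∑ 𝕍 (λ v → g v * χ (Y i) v))
    ∑e-weighted g = trans (∑-cong 𝕍 (λ v → trans (sym (∑-*ˡ I (g v) _)) (∑-cong I (λ i → lemma (g v) (a i) (χ (Y i) v)))))
      (trans (∑-swap 𝕍 I _) (∑-cong I (λ i → ∑-*ˡ 𝕍 (a i) _)))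
      where
      lemma : ∀ g a x → g * (a * x) ≡ a * (g * x)
      lemma = solve-∀

    ∑ê : ∑ 𝕍 ê ≡ 0ℤ
    ∑ê = begin
      ∑ 𝕍 ê
        ≡⟨ ∑-cong 𝕍 (λ v → l₁ (χ P v) N (e v) E) ⟩
      ∑ 𝕍 (λ v → N * (1ℤ * e v - χ P v * e v) - (E * 1ℤ - E * χ P v))
        ≡⟨ trans (∑-sub 𝕍 _ _) (cong₂ _-_ (trans (∑-*ˡ 𝕍 N _) (cong (N *_) (∑-sub 𝕍 _ _)))
             (trans (∑-sub 𝕍 _ _) (cong₂ _-_ (∑𝕍-const (E * 1ℤ)) (∑-*ˡ 𝕍 E (χ P))))) ⟩
      N * (∑ 𝕍 (λ v → 1ℤ * e v) - ∑ 𝕍 (λ v → χ P v * e v)) - (qⁿ * (E * 1ℤ) - E * size P)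
        ≡⟨ cong₂ (λ x y → N * x - (y * (E * 1ℤ) - E * size P)) (cong₂ _-_ all-e P-e) (trans qⁿ≡QQ refl) ⟩
      N * (d₀ * Q - qz * d₀) - (Q * Q * (E * 1ℤ) - E * size P)
        ≡⟨ cong (λ z → N * (d₀ * Q - qz * d₀) - (Q * Q * (E * 1ℤ) - E * z)) (size-line p p≢0) ⟩
      N * (d₀ * Q - qz * d₀) - (Q * Q * (E * 1ℤ) - E * qz)
        ≡⟨ cong (λ z → (Q₁ * z - 1ℤ) * (d₀ * z - qz * d₀) - (z * z * (E * 1ℤ) - E * qz)) Q≡qQ₁ ⟩
      (Q₁ * (qz * Q₁) - 1ℤ) * (d₀ * (qz * Q₁) - qz * d₀) - (qz * Q₁ * (qz * Q₁) * (E * 1ℤ) - E * qz)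
        ≡⟨ l₂ Q₁ qz d₀ ⟩
      0ℤ ∎
      where
      open ≡-Reasoning
      l₁ : ∀ x N e E → (1ℤ - x) * (N * e - E) ≡ N * (1ℤ * e - x * e) - (E * 1ℤ - E * x)
      l₁ = solve-∀
      l₂ : ∀ R q d → (R * (q * R) - 1ℤ) * (d * (q * R) - q * d) - (q * R * (q * R) * ((R - 1ℤ) * d * 1ℤ) - (R - 1ℤ) * d * q) ≡ 0ℤ
      l₂ = solve-∀
      all-e : ∑ 𝕍 (λ v → 1ℤ * e v) ≡ d₀ * Q
      all-e = trans (∑e-weighted (λ _ → 1ℤ)) (trans (∑-cong I (λ i → cong (a i *_)
        (trans (∑-cong 𝕍 (λ v → *-identityˡ (χ (Y i) v))) (size-Y i)))) (∑-*ʳ I a Q))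
      P-e : ∑ 𝕍 (λ v → χ P v * e v) ≡ qz * d₀
      P-e = trans (∑-cong 𝕍 (λ v → 𝟙-*-cong (P ∋? v) (e-on-P v))) (trans (∑-*ʳ 𝕍 (χ P) d₀) (cong (_* d₀) (size-line p p≢0)))

    open CentredFunction ê ê-hom ê-𝟘 ∑ê

    -- The weight keeps only the matrices with `p` in the kernel, which adds `p` to the tuple in
    -- `κ`. For `v` off `P` the value is `κ₂` if `w` lies in the plane of `v` and `p`, and `κ₃`
    -- otherwise. Over that plane `ê` sums to `(qz - 1ℤ) * (qz * ê v)`: a factor `qz` from the
    -- invariance under `P`, and `qz - 1ℤ` from homogeneity.
    star-moment : ∑ (𝕍^ k) (λ W → Π⊥ p W * (φᵂ ê W * φᵂ ê W)) ≡ (κ₂ ^ k - κ₃ ^ k) * ((qz - 1ℤ) * qz * S₂)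
    star-moment = begin
      ∑ (𝕍^ k) (λ W → Π⊥ p W * (φᵂ ê W * φᵂ ê W))
        ≡⟨ ∑-cong (𝕍^ k) (λ W → trans (cong (Π⊥ p W *_) (∑-square 𝕍 (λ v → Π⊥ v W * ê v)))
             (trans (sym (∑-*ˡ 𝕍 (Π⊥ p W) _)) (∑-cong 𝕍 (λ v → sym (∑-*ˡ 𝕍 (Π⊥ p W) _))))) ⟩
      ∑ (𝕍^ k) (λ W → ∑ 𝕍 (λ v → ∑ 𝕍 (λ w → Π⊥ p W * ((Π⊥ v W * ê v) * (Π⊥ w W * ê w)))))
        ≡⟨ trans (∑-swap (𝕍^ k) 𝕍 _) (∑-cong 𝕍 (λ v → ∑-swap (𝕍^ k) 𝕍 _)) ⟩
      ∑ 𝕍 (λ v → ∑ 𝕍 (λ w → ∑ (𝕍^ k) (λ W → Π⊥ p W * ((Π⊥ v W * ê v) * (Π⊥ w W * ê w)))))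
        ≡⟨ ∑-cong 𝕍 (λ v → ∑-cong 𝕍 (λ w → trans (∑-cong (𝕍^ k) (λ W → l₁ (Π⊥ p W) (Π⊥ v W) (ê v) (Π⊥ w W) (ê w)))
             (trans (∑-*ˡ (𝕍^ k) (ê v * ê w) (Θ (w ∷ v ∷ p ∷ []))) (trans (cong (ê v * ê w *_) (∑-Θ k (w ∷ v ∷ p ∷ [])))
             (*-assoc (ê v) (ê w) _))))) ⟩
      ∑ 𝕍 (λ v → ∑ 𝕍 (λ w → ê v * (ê w * κ (w ∷ v ∷ p ∷ []) ^ k)))
        ≡⟨ ∑-cong 𝕍 (λ v → trans (∑-*ˡ 𝕍 (ê v) _) (by-line v (P ∋? v))) ⟩
      ∑ 𝕍 (λ v → (d * ((qz - 1ℤ) * qz)) * (ê v * ê v))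
        ≡⟨ trans (∑-*ˡ 𝕍 (d * ((qz - 1ℤ) * qz)) _) (*-assoc d ((qz - 1ℤ) * qz) S₂) ⟩
      d * ((qz - 1ℤ) * qz * S₂) ∎
      where
      open ≡-Reasoning
      d : ℤ
      d = κ₂ ^ k - κ₃ ^ k
      l₁ : ∀ x a b c d → x * ((a * b) * (c * d)) ≡ (b * d) * (c * (a * (x * 1ℤ)))
      l₁ = solve-∀
      by-line : ∀ v → Dec (P ∋ v) → ê v * ∑ 𝕍 (λ w → ê w * κ (w ∷ v ∷ p ∷ []) ^ k) ≡ (d * ((qz - 1ℤ) * qz)) * (ê v * ê v)
      by-line v (yes Pv) = trans (cong (_* ∑ 𝕍 (λ w → ê w * κ (w ∷ v ∷ p ∷ []) ^ k)) (ê-on-P v Pv))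
        (trans (l₂ (∑ 𝕍 (λ w → ê w * κ (w ∷ v ∷ p ∷ []) ^ k)) (d * ((qz - 1ℤ) * qz)))
        (cong (λ z → (d * ((qz - 1ℤ) * qz)) * (z * z)) (sym (ê-on-P v Pv))))
        where
        l₂ : ∀ x y → 0ℤ * x ≡ y * (0ℤ * 0ℤ)
        l₂ = solve-∀
      by-line v (no ¬Pv) = trans (cong (ê v *_) (begin
        ∑ 𝕍 (λ w → ê w * κ (w ∷ v ∷ p ∷ []) ^ k)
          ≡⟨ ∑-cong 𝕍 pointwise ⟩
        ∑ 𝕍 (λ w → κ₃ ^ k * ê w + d * (χ plane w * ê w))
          ≡⟨ trans (∑-+ 𝕍 _ _) (cong₂ _+_ (trans (∑-*ˡ 𝕍 (κ₃ ^ k) ê) (cong (κ₃ ^ k *_) ∑ê)) (∑-*ˡ 𝕍 d _)) ⟩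
        κ₃ ^ k * 0ℤ + d * ∑ 𝕍 (λ w → χ plane w * ê w)
          ≡⟨ cong (λ z → κ₃ ^ k * 0ℤ + d * z) plane-sum ⟩
        κ₃ ^ k * 0ℤ + d * ((qz - 1ℤ) * (qz * ê v)) ∎)) (l₄ (κ₃ ^ k) d (qz - 1ℤ) qz (ê v))
        where
        plane : Subspace
        plane = span (v ∷ p ∷ [])
        size-plane : size plane ≡ qz * qz
        size-plane = trans (size-ext P v ¬Pv) (cong (qz *_) (size-line p p≢0))
        l₄ : ∀ x d c q y → y * (x * 0ℤ + d * (c * (q * y))) ≡ d * (c * q) * (y * y)
        l₄ = solve-∀
        pointwise : ∀ w → ê w * κ (w ∷ v ∷ p ∷ []) ^ k ≡ κ₃ ^ k * ê w + d * (χ plane w * ê w)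
        pointwise w with plane ∋? w
        ... | yes h = trans (cong (λ z → ê w * z ^ k) (κ-from-size (w ∷ v ∷ p ∷ []) (qz * qz) κ₂ (*-pos q>0 q>0)
                        (trans (size-ext-trivial plane w h) size-plane) (trans (sizes qz u) (sym qⁿ≡uq⁴))))
                        (combine (ê w) (κ₂ ^ k) (κ₃ ^ k))
          where
          sizes : ∀ q u → q * q * (q * (q * u)) ≡ q * q * (q * q * u)
          sizes = solve-∀
          combine : ∀ a x y → a * x ≡ y * a + (x - y) * (1ℤ * a)
          combine = solve-∀
        ... | no ¬h = trans (cong (λ z → ê w * z ^ k) (κ-from-size (w ∷ v ∷ p ∷ []) (qz * (qz * qz)) κ₃ (*-pos q>0 (*-pos q>0 q>0))
                        (trans (size-ext plane w ¬h) (cong (qz *_) size-plane)) (trans (sizes qz u) (sym qⁿ≡uq⁴))))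
                        (combine (ê w) (κ₂ ^ k) (κ₃ ^ k))
          where
          sizes : ∀ q u → q * (q * q) * (q * u) ≡ q * q * (q * q * u)
          sizes = solve-∀
          combine : ∀ a x y → a * y ≡ y * a + (x - y) * (0ℤ * a)
          combine = solve-∀
        plane-sum : ∑ 𝕍 (λ w → χ plane w * ê w) ≡ (qz - 1ℤ) * (qz * ê v)
        plane-sum = trans (∑-ext P v ¬Pv ê) (trans (∑-cong 𝔽 on-coset) (∑𝔽-nonzero (qz * ê v)))
          where
          scaled : ∀ c → ê (c ⊙ v) ≡ (1ℤ - 𝟙 (c ≟F 0#)) * ê v
          scaled c with c ≟F 0#
          ... | yes refl = trans (cong ê (⊙-zeroˡ v)) ê-𝟘
          ... | no c≢0   = trans (ê-hom c v c≢0) (sym (*-identityˡ (ê v)))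
          on-coset : ∀ c → ∑ 𝕍 (λ w → χ P w * ê (w ⊕ c ⊙ v)) ≡ (1ℤ - 𝟙 (c ≟F 0#)) * (qz * ê v)
          on-coset c = trans (∑-cong 𝕍 (λ w → 𝟙-*-cong (P ∋? w) (ê-invariant (c ⊙ v) w)))
            (trans (∑-*ʳ 𝕍 (χ P) (ê (c ⊙ v))) (trans (cong₂ _*_ (size-line p p≢0) (scaled c))
            (l₅ qz (1ℤ - 𝟙 (c ≟F 0#)) (ê v))))
            where
            l₅ : ∀ q x y → q * (x * y) ≡ x * (q * y)
            l₅ = solve-∀

    B Φ : ℤ
    B = ∑I (λ i → a i * (φ ê (Y i) * φ ê (Y i)))
    Φ = ∑I (λ i → a i * φ ê (Y i))

    κ₃ᵏ : κ₃ ^ k ≡ Q * u ^ k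
    κ₃ᵏ = *-^ qz u k

    κ₂ᵏ : κ₂ ^ k ≡ Q * (Q * u ^ k)
    κ₂ᵏ = trans (*-^ qz κ₃ k) (cong (Q *_) κ₃ᵏ)

    κ₁ᵏ : κ₁ ^ k ≡ Q * (Q * (Q * u ^ k))
    κ₁ᵏ = trans (*-^ qz κ₂ k) (cong (Q *_) κ₂ᵏ)

    -- The variance over the members through `p`. Requiring `p` in the kernel replaces the
    -- difference of the powers of `κ₁` and `κ₂` by that of `κ₂` and `κ₃`, which is smaller by a
    -- factor `Q`.
    B-bound : γ * B ≤ u ^ k * (Q * Q - Q) * ((qz - 1ℤ) * qz * S₂)
    B-bound = ≤-trans (embed 𝓕 (λ W → Π⊥ p W * (φᵂ ê W * φᵂ ê W))
        (λ W → *-nonneg (Π⊥≥0 W) (square-nonneg (φᵂ ê W)))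
        (λ i → a i * (φ ê (Y i) * φ ê (Y i)))
        (λ i W _ h → ≤-reflexive (sym (cong₂ (λ x y → x * (y * y)) (h p) (∑-cong 𝕍 (λ v → cong (_* ê v) (h v)))))))
      (≤-reflexive (trans star-moment (cong (_* ((qz - 1ℤ) * qz * S₂)) (trans (cong₂ _-_ κ₂ᵏ κ₃ᵏ) (lemma Q (u ^ k))))))
      where
      Π⊥≥0 : ∀ {j} (W : Vec V j) → 0ℤ ≤ Π⊥ p W
      Π⊥≥0 []      = 0≤1
      Π⊥≥0 (w ∷ W) = *-nonneg (𝟙-nonneg (dot p w ≟F 0#)) (Π⊥≥0 W)
      lemma : ∀ Q U → Q * (Q * U) - Q * U ≡ U * (Q * Q - Q)
      lemma = solve-∀

    S₂≡NΦ : S₂ ≡ N * Φ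
    S₂≡NΦ = sym (trans (cong (N *_) (trans (∑-cong I (λ i → cong (a i *_) (∑-cong 𝕍 (λ v → *-comm (χ (Y i) v) (ê v))))) (sym (∑e-weighted ê))))
      (trans (sym (∑-*ˡ 𝕍 N _)) (trans (∑-cong 𝕍 (λ v → pointwise v (P ∋? v))) (trans (∑-+ 𝕍 _ _)
      (trans (cong (_+_ S₂) (trans (∑-*ˡ 𝕍 E ê) (trans (cong (E *_) ∑ê) (*-zeroʳ E)))) (+-identityʳ S₂))))))
      where
      pointwise : ∀ v → Dec (P ∋ v) → N * (ê v * e v) ≡ ê v * ê v + E * ê v
      pointwise v (yes Pv) = trans (cong (λ z → N * (z * e v)) (ê-on-P v Pv)) (trans (lemma N (e v) E) (cong (λ z → z * z + E * z) (sym (ê-on-P v Pv))))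
        where
        lemma : ∀ N e E → N * (0ℤ * e) ≡ 0ℤ * 0ℤ + E * 0ℤ
        lemma = solve-∀
      pointwise v (no ¬Pv) = trans (cong (λ z → N * (z * e v)) (ê-off-P v ¬Pv)) (trans (lemma N (e v) E)
          (cong (λ z → z * z + E * z) (sym (ê-off-P v ¬Pv))))
        where
        lemma : ∀ N e E → N * ((N * e - E) * e) ≡ (N * e - E) * (N * e - E) + E * (N * e - E)
        lemma = solve-∀

    module _ (j : Fin m) (p∉Yj : ¬ (Y j ∋ p)) where

      Y∩P : ∀ v → Y j ∋ v → P ∋ v → v ≡ 𝟘
      Y∩P v Yv (c , h) with c ≟F 0#
      ... | yes refl = trans (sym (⊕-identityʳ v)) (trans (cong (v ⊕_) (sym (trans (cong (_⊙ p) RP.-0#≈0#) (⊙-zeroˡ p)))) h)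
      ... | no c≢0 = ⊥-elim (p∉Yj (∋-unscale (Y j) c≢0 (subst (Y j ∋_) v≡cp Yv)))
        where
        v≡cp : v ≡ c ⊙ p
        v≡cp = trans (sym (⊕-cancel′ v (c ⊙ p))) (trans (cong (_⊕ c ⊙ p) (trans (cong (v ⊕_) (sym (⊙-neg c p))) h))
          (trans (⊕-comm 𝟘 _) (⊕-identityʳ _)))

      X : ℤ
      X = ∑I (λ i → a i * ∑ 𝕍 (λ v → χ (Y j) v * χ (Y i) v))

      X-lower : d₀ * qz ≤ X
      X-lower = ≤-trans (≤-reflexive (sym (∑-*ʳ I a qz))) (∑-mono I (λ i → *-monoˡ (a≥0 i) (meet-size 𝓕 j i)))

      -- `Y j` meets `P` in zero only, so blanking out `P` removes no other vector of it. It shares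
      -- at least `q` vectors with each of the `d₀` members through `p`.
      φ-lower : (qz - + 2) * (N * d₀) ≤ φ ê (Y j)
      φ-lower = ≤-trans (≤-witness (N * (X - d₀ * qz) + (Q₁ + Q - + 2) * d₀)
          (+-nonneg (*-nonneg (<⇒≤ N>0) (diff-≥0 X-lower))
            (*-nonneg (subst (0ℤ ≤_) (regroup Q₁ Q) (+-nonneg (diff-≥0 Q₁≥1) (diff-≥0 Q≥1))) d₀≥0))
          (l₃ Q₁ Q d₀ X qz))
        (≤-reflexive (sym (begin
          φ ê (Y j)
            ≡⟨ ∑-cong 𝕍 (λ v → trans (𝟙-*-cong (Y j ∋? v) (λ Yv → cong (λ z → (1ℤ - z) * (N * e v - E))
                 (𝟙-cong (P ∋? v) (v ≟V 𝟘) (Y∩P v Yv) (λ { refl → ∋0 P })))) (l₁ (χ (Y j) v) (𝟙 (v ≟V 𝟘)) N (e v) E)) ⟩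
          ∑ 𝕍 (λ v → (N * (χ (Y j) v * e v) - E * χ (Y j) v) - 𝟙 (v ≟V 𝟘) * (χ (Y j) v * (N * e v - E)))
            ≡⟨ trans (∑-sub 𝕍 _ _) (cong₂ _-_ (trans (∑-sub 𝕍 _ _) (cong₂ _-_ (trans (∑-*ˡ 𝕍 N _) (cong (N *_) (∑e-weighted (χ (Y j)))))
                 (trans (∑-*ˡ 𝕍 E (χ (Y j))) (cong (E *_) (size-Y j))))) (trans (∑-δ 𝕍 𝟘 (λ v → χ (Y j) v * (N * e v - E)))
                 (cong₂ (λ x y → x * (N * y - E)) (𝟙-yes (Y j ∋? 𝟘) (∋0 (Y j))) (e-on-P 𝟘 (∋0 P))))) ⟩
          (N * X - E * Q) - 1ℤ * (N * d₀ - E) ∎)))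
        where
        open ≡-Reasoning
        l₁ : ∀ c δ N e E → c * ((1ℤ - δ) * (N * e - E)) ≡ (N * (c * e) - E * c) - δ * (c * (N * e - E))
        l₁ = solve-∀
        regroup : ∀ a b → a - 1ℤ + (b - 1ℤ) ≡ a + b - + 2
        regroup = solve-∀
        l₃ : ∀ R Q d X q → ((R * Q - 1ℤ) * X - (R - 1ℤ) * d * Q) - 1ℤ * ((R * Q - 1ℤ) * d - (R - 1ℤ) * d) ≡
          (q - + 2) * ((R * Q - 1ℤ) * d) + ((R * Q - 1ℤ) * (X - d * q) + (R + Q - + 2) * d)
        l₃ = solve-∀

    module _ (q>2 : + 2 < qz) (γ≥0 : 0ℤ ≤ γ) where

      private
        Z : ℤ
        Z = (qz - + 2) * (N * d₀)
        q-2≥0 : 0ℤ ≤ qz - + 2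
        q-2≥0 = diff-≥0 (<⇒≤ q>2)
        Z≥0 : 0ℤ ≤ Z
        Z≥0 = *-nonneg q-2≥0 (*-nonneg (<⇒≤ N>0) d₀≥0)

      -- The variance over all kernels: each member that misses `p` contributes at least the square
      -- of `Z`.
      avoiding-bound : γ * ((mz - d₀) * (Z * Z)) ≤ u ^ k * (Q * Q * Q - Q * Q) * ((qz - 1ℤ) * S₂)
      avoiding-bound = ≤-trans (≤-reflexive (cong (γ *_) (sym count)))
        (≤-trans (embed 𝓕 (λ W → φᵂ ê W * φᵂ ê W) (λ W → square-nonneg (φᵂ ê W)) (λ i → (1ℤ - a i) * (Z * Z))
          (λ i W _ h → ≤-trans (by-case i) (≤-reflexive (sym (cong (λ z → z * z) (∑-cong 𝕍 (λ v → cong (_* ê v) (h v))))))))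
        (≤-reflexive (trans (second-moment k) (cong (_* ((qz - 1ℤ) * S₂)) (trans (cong₂ _-_ κ₁ᵏ κ₂ᵏ) (lemma Q (u ^ k)))))))
        where
        lemma : ∀ Q U → Q * (Q * (Q * U)) - Q * (Q * U) ≡ U * (Q * Q * Q - Q * Q)
        lemma = solve-∀
        count : ∑I (λ i → (1ℤ - a i) * (Z * Z)) ≡ (mz - d₀) * (Z * Z)
        count = trans (∑-*ʳ I _ (Z * Z)) (cong (_* (Z * Z)) (trans (∑-sub I (λ _ → 1ℤ) a)
          (cong (_- d₀) (trans (sumFin-const m 1ℤ) (*-identityʳ mz)))))
        by-case : ∀ i → (1ℤ - a i) * (Z * Z) ≤ φ ê (Y i) * φ ê (Y i)
        by-case i with Y i ∋? p
        ... | yes _ = ≤-trans (≤-reflexive (*-zeroˡ (Z * Z))) (square-nonneg (φ ê (Y i)))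
        ... | no ¬p = ≤-trans (≤-reflexive (*-identityˡ (Z * Z)))
                        (*-mono Z≥0 (≤-trans Z≥0 (φ-lower i ¬p)) (φ-lower i ¬p) (φ-lower i ¬p))

      dense-star : 0ℤ < d₀ → γ * γ * ((mz - d₀) * ((qz - + 2) * (qz - + 2) * d₀)) ≤
        u ^ k * u ^ k * (Q * Q * Q) * ((Q - 1ℤ) * (Q - 1ℤ)) * (qz * ((qz - 1ℤ) * (qz - 1ℤ)))
      dense-star d₀>0 = phase₂-algebra γ B (u ^ k) Q qz S₂ N Φ d₀ mz N>0 d₀>0 (<⇒≤ uᵏ>0) γ≥0 Q≥1 (<⇒≤ q>1) S₂≥0
        B-bound S₂≡NΦ (cauchy I a (λ i → φ ê (Y i)) a≥0) avoiding-bound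

    IndepIn-mono : ∀ {j} S T → (∀ v → S ∋ v → T ∋ v) → (W : Vec V j) → IndepIn S W → IndepIn T W
    IndepIn-mono S T S⊆T []      _             = tt
    IndepIn-mono S T S⊆T (w ∷ W) ((s , h) , i) = (S⊆T w s , h) , IndepIn-mono S T S⊆T W i

    -- A member through `p` and `v` contains their plane, so the bases of its complement are
    -- independent tuples in the complement of the plane, which has `κ₂` elements. After division by
    -- `γ` the bound is the Gaussian coefficient [2k-2, k] = [2k-2, k-2].
    line-degree : ∀ v → ¬ (P ∋ v) → γ * e v ≤ falling qz κ₂ k
    line-degree v ¬Pv = ≤-trans (embed 𝓕 (λ W → 𝟙 (indepIn? T W)) (λ W → 𝟙-nonneg (indepIn? T W)) (λ i → a i * χ (Y i) v)
        (λ i W b _ → ≤-trans (≤-reflexive (sym (𝟙-× ((Y i ∋? p) ×-dec (Y i ∋? v)) (Y i ∋? p) (Y i ∋? v) (λ x → x) _,_)))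
          (𝟙-mono ((Y i ∋? p) ×-dec (Y i ∋? v)) (indepIn? T W) (λ { (Yp , Yv) →
            IndepIn-mono (perp (Y i)) T (λ w h s s∈ → h s (ext-least P v (Y i) (P⊆Y i Yp) Yv s s∈)) W b }))))
      (≤-reflexive (trans (count-indep T k) (cong (λ s → falling qz s k) size-T)))
      where
      T : Subspace
      T = perp (span (v ∷ p ∷ []))
      size-T : size T ≡ κ₂
      size-T = *-cancelˡ (*-pos q>0 q>0) (trans (cong (_* size T) (sym (trans (size-ext P v ¬Pv) (cong (qz *_) (size-line p p≢0)))))
        (trans (size-perp (span (v ∷ p ∷ []))) (trans qⁿ≡uq⁴ (lemma qz u))))
        where
        lemma : ∀ q u → q * q * (q * q * u) ≡ q * q * (q * (q * u))
        lemma = solve-∀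

    -- Each of the `d₀` members through `p` contains at least `q - 1` nonzero vectors of `Y j`. Each
    -- of the `Q - 1` nonzero vectors of `Y j` is off `P` and therefore subject to `line-degree`.
    degree-bound : 0ℤ ≤ γ → ∀ j → ¬ (Y j ∋ p) → (qz - 1ℤ) * d₀ * γ ≤ (Q - 1ℤ) * falling qz κ₂ k
    degree-bound γ≥0 j p∉Yj = begin
      (qz - 1ℤ) * d₀ * γ
        ≡⟨ l₁ qz d₀ γ ⟩
      γ * (d₀ * qz - d₀)
        ≤⟨ *-monoˡ γ≥0 (+-monoˡ-≤ (- d₀) (X-lower j p∉Yj)) ⟩
      γ * (X j p∉Yj - d₀)
        ≡⟨ cong (γ *_) (sym punctured) ⟩
      γ * ∑ 𝕍 (λ v → (χ (Y j) v - 𝟙 (v ≟V 𝟘)) * e v)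
        ≡⟨ sym (∑-*ˡ 𝕍 γ _) ⟩
      ∑ 𝕍 (λ v → γ * ((χ (Y j) v - 𝟙 (v ≟V 𝟘)) * e v))
        ≤⟨ ∑-mono 𝕍 pointwise ⟩
      ∑ 𝕍 (λ v → (χ (Y j) v - 𝟙 (v ≟V 𝟘)) * falling qz κ₂ k)
        ≡⟨ trans (∑-*ʳ 𝕍 _ (falling qz κ₂ k)) (cong (_* falling qz κ₂ k) (trans (∑-sub 𝕍 _ _) (cong₂ _-_ (size-Y j) (Enum.once 𝕍 𝟘)))) ⟩
      (Q - 1ℤ) * falling qz κ₂ k ∎
      where
      open ≤-Reasoning
      l₁ : ∀ q d γ → (q - 1ℤ) * d * γ ≡ γ * (d * q - d)
      l₁ = solve-∀
      l₂ : ∀ x δ e → (x - δ) * e ≡ x * e - δ * e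
      l₂ = solve-∀
      swap : ∀ a b c → a * (b * c) ≡ b * (a * c)
      swap = solve-∀
      punctured : ∑ 𝕍 (λ v → (χ (Y j) v - 𝟙 (v ≟V 𝟘)) * e v) ≡ X j p∉Yj - d₀
      punctured = trans (∑-cong 𝕍 (λ v → l₂ (χ (Y j) v) (𝟙 (v ≟V 𝟘)) (e v))) (trans (∑-sub 𝕍 _ _)
        (cong₂ _-_ (∑e-weighted (χ (Y j))) (trans (∑-δ 𝕍 𝟘 e) (e-on-P 𝟘 (∋0 P)))))
      pointwise : ∀ v → γ * ((χ (Y j) v - 𝟙 (v ≟V 𝟘)) * e v) ≤ (χ (Y j) v - 𝟙 (v ≟V 𝟘)) * falling qz κ₂ k
      pointwise v = ≤-trans (≤-reflexive (swap γ (χ (Y j) v - 𝟙 (v ≟V 𝟘)) (e v))) (by-case (zero-or-not v))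
        where
        by-case : v ≡ 𝟘 ⊎ v ≢ 𝟘 → (χ (Y j) v - 𝟙 (v ≟V 𝟘)) * (γ * e v) ≤ (χ (Y j) v - 𝟙 (v ≟V 𝟘)) * falling qz κ₂ k
        by-case (inj₁ refl) = ≤-reflexive (trans (cong (_* (γ * e 𝟘)) z) (trans (vanish (γ * e 𝟘) (falling qz κ₂ k)) (cong (_* falling qz κ₂ k) (sym z))))
          where
          z : χ (Y j) 𝟘 - 𝟙 (𝟘 ≟V 𝟘) ≡ 0ℤ
          z = cong₂ _-_ (𝟙-yes (Y j ∋? 𝟘) (∋0 (Y j))) (𝟙-yes (𝟘 ≟V 𝟘) refl)
          vanish : ∀ a b → 0ℤ * a ≡ 0ℤ * b
          vanish = solve-∀
        by-case (inj₂ v≢0) = subst (λ z → z * (γ * e v) ≤ z * falling qz κ₂ k) (sym punct)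
            (𝟙-*-mono (Y j ∋? v) (λ Yv → line-degree v (λ Pv → v≢0 (Y∩P j p∉Yj v Yv Pv))))
          where
          punct : χ (Y j) v - 𝟙 (v ≟V 𝟘) ≡ χ (Y j) v
          punct = trans (cong (_-_ (χ (Y j) v)) (𝟙-no (v ≟V 𝟘) v≢0)) (+-identityʳ (χ (Y j) v))

  -- The two polynomial inequalities behind the constants

  module _ {t : ℤ} (t≥0 : 0ℤ ≤ t) where

    horner≥0 : ∀ c {x} → 0ℤ ≤ x → 0ℤ ≤ + c + t * x
    horner≥0 c x≥0 = +-nonneg {+ c} (+≤+ ℕ.z≤n) (*-nonneg t≥0 x≥0)

    horner>0 : ∀ c {x} → 0ℤ ≤ x → 0ℤ < + suc c + t * x
    horner>0 c x≥0 = +-mono-<-≤ {0ℤ} {+ suc c} {0ℤ} (+<+ (ℕ.s≤s ℕ.z≤n)) (*-nonneg t≥0 x≥0)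

  const≥0 : ∀ c → 0ℤ ≤ + c
  const≥0 c = +≤+ ℕ.z≤n

  exceeds : ∀ {x y} r → 0ℤ < r → x ≡ y + r → ¬ (x ≤ y)
  exceeds {x} {y} r r>0 x≡ x≤y = <⇒≱ (subst₂ _<_ (+-identityʳ y) (sym x≡) (+-monoʳ-< y r>0)) x≤y

  -- Both are polynomial inequalities in t = q - 3 and w = Q - q⁵ with non-negative coefficients.
  module _ (q Q : ℤ) (q≥3 : + 3 ≤ q) (Q≥q⁵ : q * q * q * q * q ≤ Q) where

    private
      t w : ℤ
      t = q - + 3
      w = Q - q * q * q * q * q
      t≥0 : 0ℤ ≤ t
      t≥0 = diff-≥0 q≥3
      w≥0 : 0ℤ ≤ w
      w≥0 = diff-≥0 Q≥q⁵
      -- `numeric₁` asks for a large `b`, `numeric₂` for a small one. In the extreme case q = 3 and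
      -- Q = 3⁵ the only positive integers satisfying both are 7, 8 and 9; `2 * q + 2` is 8 there.
      b ρ : ℤ
      b = + 2 * q + + 2
      ρ = b * (q - + 2) - (q - 1ℤ)

    ρ≥0 : 0ℤ ≤ ρ
    ρ≥0 = subst (0ℤ ≤_) (trans (lemma t) (cong (λ z → (+ 2 * z + + 2) * (z - + 2) - (z - 1ℤ)) (undo q)))
        (horner≥0 t≥0 6 (horner≥0 t≥0 9 (const≥0 2)))
      where
      undo : ∀ q → q - + 3 + + 3 ≡ q
      undo = solve-∀
      lemma : ∀ t → + 6 + t * (+ 9 + t * + 2) ≡ (+ 2 * (t + + 3) + + 2) * (t + + 3 - + 2) - (t + + 3 - 1ℤ)
      lemma = solve-∀

    numeric₁ : ¬ ((q + + 3) * (Q - + 2 * q) * ((q - + 2) * (ρ * ρ)) ≤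
      q * (q - 1ℤ) * ((q - 1ℤ) * (q - 1ℤ) * (q - 1ℤ) * Q + (q - + 2) * (b * b * (q * q * (q * q)))))
    numeric₁ = exceeds (w * K + L) (+-mono-≤-< (*-nonneg w≥0 K≥0) L>0) (trans (cong₂ lhs q≡ Q≡)
        (trans (identity t w) (cong (_+ (w * K + L)) (sym (cong₂ rhs q≡ Q≡)))))
      where
      lhs rhs : ℤ → ℤ → ℤ
      lhs q Q = (q + + 3) * (Q - + 2 * q) * ((q - + 2) * (((+ 2 * q + + 2) * (q - + 2) - (q - 1ℤ)) * ((+ 2 * q + + 2) * (q - + 2) - (q - 1ℤ))))
      rhs q Q = q * (q - 1ℤ) * ((q - 1ℤ) * (q - 1ℤ) * (q - 1ℤ) * Q + (q - + 2) * ((+ 2 * q + + 2) * (+ 2 * q + + 2) * (q * q * (q * q))))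
      K L : ℤ
      K = + 168 + t * (+ 788 + t * (+ 1318 + t * (+ 1011 + t * (+ 370 + t * (+ 63 + t * + 4)))))
      L = + 8424 + t * (+ 139644 + t * (+ 495378 + t * (+ 838773 + t * (+ 835149 + t * (+ 535003 + t * (+ 229967
        + t * (+ 67217 + t * (+ 13207 + t * (+ 1671 + t * (+ 123 + t * + 4))))))))))
      K≥0 : 0ℤ ≤ K
      K≥0 = horner≥0 t≥0 168 (horner≥0 t≥0 788 (horner≥0 t≥0 1318 (horner≥0 t≥0 1011 (horner≥0 t≥0 370 (horner≥0 t≥0 63 (const≥0 4))))))
      L>0 : 0ℤ < L
      L>0 = horner>0 t≥0 8423 (horner≥0 t≥0 139644 (horner≥0 t≥0 495378 (horner≥0 t≥0 838773 (horner≥0 t≥0 835149 (horner≥0 t≥0 535003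
        (horner≥0 t≥0 229967 (horner≥0 t≥0 67217 (horner≥0 t≥0 13207 (horner≥0 t≥0 1671 (horner≥0 t≥0 123 (const≥0 4)))))))))))
      q≡ : q ≡ t + + 3
      q≡ = undo q
        where
        undo : ∀ q → q ≡ q - + 3 + + 3
        undo = solve-∀
      Q≡ : Q ≡ (t + + 3) * (t + + 3) * (t + + 3) * (t + + 3) * (t + + 3) + w
      Q≡ = undo q Q
        where
        undo : ∀ q Q → Q ≡ (q - + 3 + + 3) * (q - + 3 + + 3) * (q - + 3 + + 3) * (q - + 3 + + 3) * (q - + 3 + + 3) + (Q - q * q * q * q * q)
        undo = solve-∀
      identity : ∀ t w → (t + + 3 + + 3) * ((t + + 3) * (t + + 3) * (t + + 3) * (t + + 3) * (t + + 3) + w - + 2 * (t + + 3)) * ((t + + 3 - + 2) * (((+ 2 * (t + + 3) + + 2) * (t + + 3 - + 2) - (t + + 3 - 1ℤ)) * ((+ 2 * (t + + 3) + + 2) * (t + + 3 - + 2) - (t + + 3 - 1ℤ)))) ≡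
        (t + + 3) * (t + + 3 - 1ℤ) * ((t + + 3 - 1ℤ) * (t + + 3 - 1ℤ) * (t + + 3 - 1ℤ) * ((t + + 3) * (t + + 3) * (t + + 3) * (t + + 3) * (t + + 3) + w) + (t + + 3 - + 2) * ((+ 2 * (t + + 3) + + 2) * (+ 2 * (t + + 3) + + 2) * ((t + + 3) * (t + + 3) * ((t + + 3) * (t + + 3)))))
        + (w * (+ 168 + t * (+ 788 + t * (+ 1318 + t * (+ 1011 + t * (+ 370 + t * (+ 63 + t * + 4))))))
        + (+ 8424 + t * (+ 139644 + t * (+ 495378 + t * (+ 838773 + t * (+ 835149 + t * (+ 535003 + t * (+ 229967
        + t * (+ 67217 + t * (+ 13207 + t * (+ 1671 + t * (+ 123 + t * + 4))))))))))))
      identity = solve-∀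

    numeric₂ : ¬ (+ 3 * ((q - + 2) * (q - + 2)) * (q + + 3) * (Q - + 4 * q) ≤
      b * ((q - 1ℤ) * (q - 1ℤ) * ((q - 1ℤ) * (q - 1ℤ))) * (q * q * q))
    numeric₂ = exceeds (w * K + L) (+-mono-≤-< (*-nonneg w≥0 K≥0) L>0) (trans (cong₂ lhs q≡ Q≡)
        (trans (identity t w) (cong (_+ (w * K + L)) (sym (cong rhs q≡)))))
      where
      lhs : ℤ → ℤ → ℤ
      lhs q Q = + 3 * ((q - + 2) * (q - + 2)) * (q + + 3) * (Q - + 4 * q)
      rhs : ℤ → ℤ
      rhs q = (+ 2 * q + + 2) * ((q - 1ℤ) * (q - 1ℤ) * ((q - 1ℤ) * (q - 1ℤ))) * (q * q * q)
      K L : ℤ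
      K = + 18 + t * (+ 39 + t * (+ 24 + t * + 3))
      L = + 702 + t * (+ 4995 + t * (+ 10203 + t * (+ 9811 + t * (+ 5199 + t * (+ 1607 + t * (+ 287 + t * (+ 27 + t * + 1)))))))
      K≥0 : 0ℤ ≤ K
      K≥0 = horner≥0 t≥0 18 (horner≥0 t≥0 39 (horner≥0 t≥0 24 (const≥0 3)))
      L>0 : 0ℤ < L
      L>0 = horner>0 t≥0 701 (horner≥0 t≥0 4995 (horner≥0 t≥0 10203 (horner≥0 t≥0 9811 (horner≥0 t≥0 5199 (horner≥0 t≥0 1607
        (horner≥0 t≥0 287 (horner≥0 t≥0 27 (const≥0 1))))))))
      q≡ : q ≡ t + + 3
      q≡ = undo q
        where
        undo : ∀ q → q ≡ q - + 3 + + 3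
        undo = solve-∀
      Q≡ : Q ≡ (t + + 3) * (t + + 3) * (t + + 3) * (t + + 3) * (t + + 3) + w
      Q≡ = undo q Q
        where
        undo : ∀ q Q → Q ≡ (q - + 3 + + 3) * (q - + 3 + + 3) * (q - + 3 + + 3) * (q - + 3 + + 3) * (q - + 3 + + 3) + (Q - q * q * q * q * q)
        undo = solve-∀
      identity : ∀ t w → + 3 * ((t + + 3 - + 2) * (t + + 3 - + 2)) * (t + + 3 + + 3) * ((t + + 3) * (t + + 3) * (t + + 3) * (t + + 3) * (t + + 3) + w - + 4 * (t + + 3)) ≡
        (+ 2 * (t + + 3) + + 2) * ((t + + 3 - 1ℤ) * (t + + 3 - 1ℤ) * ((t + + 3 - 1ℤ) * (t + + 3 - 1ℤ))) * ((t + + 3) * (t + + 3) * (t + + 3))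
        + (w * (+ 18 + t * (+ 39 + t * (+ 24 + t * + 3)))
        + (+ 702 + t * (+ 4995 + t * (+ 10203 + t * (+ 9811 + t * (+ 5199 + t * (+ 1607 + t * (+ 287 + t * (+ 27 + t * + 1)))))))))
      identity = solve-∀

  -- Gaussian binomials by the q-Pascal rule

  qbinom : ℕ → ℕ → ℕ → ℕ
  qbinom q n       zero    = 1
  qbinom q zero    (suc m) = 0
  qbinom q (suc n) (suc m) = qbinom q n m ℕ.+ q ℕ.^ suc m ℕ.* qbinom q n (suc m)

  gaussNum-suc : ∀ q n m → gaussNum q (suc n) (suc m) ≡ (q ℕ.^ suc n ℕ.∸ 1) ℕ.* gaussNum q n m
  gaussNum-suc q n zero    = trans (ℕ.*-identityˡ _) (sym (ℕ.*-identityʳ _))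
  gaussNum-suc q n (suc m) = trans (cong (ℕ._* (q ℕ.^ (n ℕ.∸ m) ℕ.∸ 1)) (gaussNum-suc q n m))
    (ℕ.*-assoc (q ℕ.^ suc n ℕ.∸ 1) (gaussNum q n m) _)

  gaussNum-diagonal : ∀ q k → gaussNum q k k ≡ gaussDen q k
  gaussNum-diagonal q zero    = refl
  gaussNum-diagonal q (suc k) = trans (gaussNum-suc q k k) (trans (cong ((q ℕ.^ suc k ℕ.∸ 1) ℕ.*_) (gaussNum-diagonal q k))
    (ℕ.*-comm (q ℕ.^ suc k ℕ.∸ 1) _))

  gaussNum-vanishes : ∀ q n m → n ℕ.< m → gaussNum q n m ≡ 0
  gaussNum-vanishes q n (suc m) (ℕ.s≤s n≤m) = trans (cong (λ z → gaussNum q n m ℕ.* (q ℕ.^ z ℕ.∸ 1)) (ℕ.m≤n⇒m∸n≡0 n≤m))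
    (ℕ.*-zeroʳ (gaussNum q n m))

  module _ (q : ℕ) (q≥2 : 2 ℕ.≤ q) where

    1≤q^ : ∀ n → 1 ℕ.≤ q ℕ.^ n
    1≤q^ n = ℕ.m^n>0 q {{ℕ.>-nonZero (ℕ.≤-trans (ℕ.s≤s ℕ.z≤n) q≥2)}} n

    -- Shows that the denominator divides the numerator, so that the truncating division in `gauss`
    -- is exact.
    gaussNum≡ : ∀ n m → gaussNum q n m ≡ gaussDen q m ℕ.* qbinom q n m
    gaussNum≡ n       zero    = refl
    gaussNum≡ zero    (suc m) = trans (gaussNum-vanishes q 0 (suc m) (ℕ.s≤s ℕ.z≤n)) (sym (ℕ.*-zeroʳ (gaussDen q (suc m))))
    gaussNum≡ (suc n) (suc m) = begin
      gaussNum q (suc n) (suc m)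
        ≡⟨ gaussNum-suc q n m ⟩
      (q ℕ.^ suc n ℕ.∸ 1) ℕ.* gaussNum q n m
        ≡⟨ split (m ℕ.≤? n) ⟩
      (a ℕ.∸ 1) ℕ.* gaussNum q n m ℕ.+ a ℕ.* gaussNum q n (suc m)
        ≡⟨ cong₂ (λ x y → (a ℕ.∸ 1) ℕ.* x ℕ.+ a ℕ.* y) (gaussNum≡ n m) (gaussNum≡ n (suc m)) ⟩
      (a ℕ.∸ 1) ℕ.* (gaussDen q m ℕ.* qbinom q n m) ℕ.+ a ℕ.* (gaussDen q (suc m) ℕ.* qbinom q n (suc m))
        ≡⟨ collect (a ℕ.∸ 1) a (gaussDen q m) (qbinom q n m) (qbinom q n (suc m)) ⟩
      gaussDen q (suc m) ℕ.* qbinom q (suc n) (suc m) ∎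
      where
      open ≡-Reasoning
      a = q ℕ.^ suc m
      collect : ∀ p a d x y → p ℕ.* (d ℕ.* x) ℕ.+ a ℕ.* ((d ℕ.* p) ℕ.* y) ≡ (d ℕ.* p) ℕ.* (x ℕ.+ a ℕ.* y)
      collect = ℕ.solve-∀
      pred-* : ∀ a b → 1 ℕ.≤ a → 1 ℕ.≤ b → a ℕ.* b ℕ.∸ 1 ≡ (a ℕ.∸ 1) ℕ.+ a ℕ.* (b ℕ.∸ 1)
      pred-* (suc a) (suc b) _ _ = lemma a b
        where
        lemma : ∀ a b → b ℕ.+ a ℕ.* suc b ≡ a ℕ.+ suc a ℕ.* b
        lemma = ℕ.solve-∀
      -- With b = q^(n-m), q^(n+1) - 1 = ab - 1 splits as (a - 1) + a (b - 1), which is the q-Pascal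
      -- rule for numerators. For `m` above `n` the numerators vanish.
      split : Dec (m ℕ.≤ n) → (q ℕ.^ suc n ℕ.∸ 1) ℕ.* gaussNum q n m ≡ (a ℕ.∸ 1) ℕ.* gaussNum q n m ℕ.+ a ℕ.* gaussNum q n (suc m)
      split (no m≰n) = trans (cong ((q ℕ.^ suc n ℕ.∸ 1) ℕ.*_) z) (trans (ℕ.*-zeroʳ (q ℕ.^ suc n ℕ.∸ 1)) (sym (trans
          (cong (λ x → (a ℕ.∸ 1) ℕ.* x ℕ.+ a ℕ.* (x ℕ.* (q ℕ.^ (n ℕ.∸ m) ℕ.∸ 1))) z)
          (trans (cong₂ ℕ._+_ (ℕ.*-zeroʳ (a ℕ.∸ 1)) (ℕ.*-zeroʳ a)) refl))))
        where
        z : gaussNum q n m ≡ 0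
        z = gaussNum-vanishes q n m (ℕ.≰⇒> m≰n)
      split (yes m≤n) = trans (cong (ℕ._* gaussNum q n m) (trans (cong (ℕ._∸ 1) power)
          (pred-* a b (1≤q^ (suc m)) (1≤q^ (n ℕ.∸ m))))) (expand (a ℕ.∸ 1) a (b ℕ.∸ 1) (gaussNum q n m))
        where
        b = q ℕ.^ (n ℕ.∸ m)
        power : q ℕ.^ suc n ≡ a ℕ.* b
        power = trans (cong (λ z → q ℕ.^ suc z) (sym (ℕ.m+[n∸m]≡n m≤n))) (ℕ.^-distribˡ-+-* q (suc m) (n ℕ.∸ m))
        expand : ∀ x a y g → (x ℕ.+ a ℕ.* y) ℕ.* g ≡ x ℕ.* g ℕ.+ a ℕ.* (g ℕ.* y)
        expand = ℕ.solve-∀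

    gaussDen>0 : ∀ m → 0 ℕ.< gaussDen q m
    gaussDen>0 zero    = ℕ.s≤s ℕ.z≤n
    gaussDen>0 (suc m) = ℕ.*-mono-≤ (gaussDen>0 m) (ℕ.∸-monoˡ-≤ 1 (ℕ.≤-trans q≥2
      (ℕ.≤-trans (ℕ.≤-reflexive (sym (ℕ.*-identityʳ q))) (ℕ.*-monoʳ-≤ q (1≤q^ m)))))

    gauss-exact : ∀ n m → gaussDen q m ℕ.* gauss q n m ≡ gaussNum q n m
    gauss-exact n m = trans (cong (gaussDen q m ℕ.*_) (trans (cong (_div gaussDen q m) (gaussNum≡ n m)) (cancel (gaussDen q m) (gaussDen>0 m))))
        (sym (gaussNum≡ n m))
      where
      cancel : ∀ d → 0 ℕ.< d → (d ℕ.* qbinom q n m) div d ≡ qbinom q n m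
      cancel (suc d) _ = trans (cong (ℕ._/ suc d) (ℕ.*-comm (suc d) (qbinom q n m))) (ℕ.m*n/n≡m (qbinom q n m) (suc d))

    private
      qz : ℤ
      qz = + q

    +-pow : ∀ n → + (q ℕ.^ n) ≡ qz ^ n
    +-pow zero    = refl
    +-pow (suc n) = trans (pos-* q (q ℕ.^ n)) (cong (qz *_) (+-pow n))

    +-pow-1 : ∀ n → + (q ℕ.^ n ℕ.∸ 1) ≡ qz ^ n - 1ℤ
    +-pow-1 n = trans (sym (trans (m-n≡m⊖n (q ℕ.^ n) 1) (⊖-≥ (1≤q^ n)))) (cong (_- 1ℤ) (+-pow n))

    -- The power of `q` with exponent m (m - 1) / 2, the ratio between the number of independent
    -- `m`-tuples and the Gaussian numerator.
    triangle : ℕ → ℤ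
    triangle zero    = 1ℤ
    triangle (suc m) = qz ^ m * triangle m

    triangle>0 : ∀ m → 0ℤ < triangle m
    triangle>0 zero    = +<+ (ℕ.s≤s ℕ.z≤n)
    triangle>0 (suc m) = *-pos (^-pos m (+<+ (ℕ.≤-trans (ℕ.s≤s ℕ.z≤n) q≥2))) (triangle>0 m)

    falling-gaussNum : ∀ n m → m ℕ.≤ n → falling qz (qz ^ n) m ≡ triangle m * + gaussNum q n m
    falling-gaussNum n zero    _   = refl
    falling-gaussNum n (suc m) m<n = begin
      (qz ^ n - qz ^ m) * falling qz (qz ^ n) m
        ≡⟨ cong₂ (λ x y → (x - qz ^ m) * y) (trans (cong (qz ^_) (sym (ℕ.m+[n∸m]≡n (ℕ.<⇒≤ m<n)))) (^-distribˡ-+-* qz m (n ℕ.∸ m)))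
             (falling-gaussNum n m (ℕ.<⇒≤ m<n)) ⟩
      (qz ^ m * qz ^ (n ℕ.∸ m) - qz ^ m) * (triangle m * + gaussNum q n m)
        ≡⟨ lemma (qz ^ m) (qz ^ (n ℕ.∸ m)) (triangle m) (+ gaussNum q n m) ⟩
      qz ^ m * triangle m * (+ gaussNum q n m * (qz ^ (n ℕ.∸ m) - 1ℤ))
        ≡⟨ cong (qz ^ m * triangle m *_) (trans (cong (+ gaussNum q n m *_) (sym (+-pow-1 (n ℕ.∸ m)))) (sym (pos-* (gaussNum q n m) _))) ⟩
      triangle (suc m) * + gaussNum q n (suc m) ∎
      where
      open ≡-Reasoning
      lemma : ∀ a b t g → (a * b - a) * (t * g) ≡ a * t * (g * (b - 1ℤ))
      lemma = solve-∀

    falling>0 : ∀ k → 0ℤ < falling qz (qz ^ k) k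
    falling>0 k = subst (0ℤ <_) (sym (trans (falling-gaussNum k k ℕ.≤-refl) (cong (λ z → triangle k * + z) (gaussNum-diagonal q k))))
      (*-pos (triangle>0 k) (+<+ (gaussDen>0 k)))

    -- The coefficient [2k-2, k-2] equals [2k-2, k]: on passing from k - 2 to k factors, numerator
    -- and denominator both gain (q^k - 1)(q^(k-1) - 1). The ratio of the two falling products is
    -- therefore the second factor of the target, and (Q - 1) / (q - 1) is the first.
    gauss-product : ∀ k → 2 ℕ.≤ k →
      (qz - 1ℤ) * falling qz (qz ^ k) k * + (gauss q k 1 ℕ.* gauss q (2 ℕ.* k ℕ.∸ 2) (k ℕ.∸ 2)) ≡
      (qz ^ k - 1ℤ) * falling qz (qz ^ (2 ℕ.* k ℕ.∸ 2)) k
    gauss-product (suc zero) (ℕ.s≤s ())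
    gauss-product k@(suc (suc k′)) _ = begin
      (qz - 1ℤ) * falling qz (qz ^ k) k * + (g₁ ℕ.* g₂)
        ≡⟨ cong₂ (λ x y → (qz - 1ℤ) * x * y) (trans (falling-gaussNum k k ℕ.≤-refl) (cong (triangle k *_)
             (trans (cong +_ (gaussNum-diagonal q k)) den≡))) (pos-* g₁ g₂) ⟩
      (qz - 1ℤ) * (triangle k * (+ gaussDen q k′ * (qz ^ suc k′ - 1ℤ) * (qz ^ k - 1ℤ))) * (+ g₁ * + g₂)
        ≡⟨ l₁ (qz - 1ℤ) (triangle k) (+ gaussDen q k′) (qz ^ suc k′ - 1ℤ) (qz ^ k - 1ℤ) (+ g₁) (+ g₂) ⟩
      ((qz - 1ℤ) * + g₁) * (triangle k * ((+ gaussDen q k′ * + g₂) * (qz ^ k - 1ℤ) * (qz ^ suc k′ - 1ℤ)))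
        ≡⟨ cong₂ (λ x y → x * (triangle k * (y * (qz ^ k - 1ℤ) * (qz ^ suc k′ - 1ℤ)))) first second ⟩
      (qz ^ k - 1ℤ) * (triangle k * (+ gaussNum q n k′ * (qz ^ k - 1ℤ) * (qz ^ suc k′ - 1ℤ)))
        ≡⟨ cong (λ z → (qz ^ k - 1ℤ) * (triangle k * z)) (sym num≡) ⟩
      (qz ^ k - 1ℤ) * (triangle k * + gaussNum q n k)
        ≡⟨ cong ((qz ^ k - 1ℤ) *_) (sym (falling-gaussNum n k k≤n)) ⟩
      (qz ^ k - 1ℤ) * falling qz (qz ^ n) k ∎
      where
      open ≡-Reasoning
      n g₁ g₂ : ℕ
      n  = 2 ℕ.* k ℕ.∸ 2
      g₁ = gauss q k 1
      g₂ = gauss q n k′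
      n≡ : n ≡ k′ ℕ.+ k
      n≡ = cong (k′ ℕ.+_) (ℕ.+-identityʳ k)
      k≤n : k ℕ.≤ n
      k≤n = subst (k ℕ.≤_) (sym n≡) (ℕ.m≤n+m k k′)
      l₁ : ∀ a t d x y g h → a * (t * (d * x * y)) * (g * h) ≡ (a * g) * (t * ((d * h) * y * x))
      l₁ = solve-∀
      den≡ : + gaussDen q k ≡ + gaussDen q k′ * (qz ^ suc k′ - 1ℤ) * (qz ^ k - 1ℤ)
      den≡ = trans (pos-* (gaussDen q (suc k′)) _) (cong₂ _*_ (trans (pos-* (gaussDen q k′) _)
        (cong (+ gaussDen q k′ *_) (+-pow-1 (suc k′)))) (+-pow-1 k))
      num≡ : + gaussNum q n k ≡ + gaussNum q n k′ * (qz ^ k - 1ℤ) * (qz ^ suc k′ - 1ℤ)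
      num≡ = trans (pos-* (gaussNum q n (suc k′)) _) (cong₂ _*_ (trans (pos-* (gaussNum q n k′) _)
        (cong (+ gaussNum q n k′ *_) (trans (+-pow-1 (n ℕ.∸ k′)) (cong (λ z → qz ^ z - 1ℤ) (trans (cong (ℕ._∸ k′) n≡) (ℕ.m+n∸m≡n k′ k))))))
        (trans (+-pow-1 (n ℕ.∸ suc k′)) (cong (λ z → qz ^ z - 1ℤ)
          (trans (cong (ℕ._∸ suc k′) (trans n≡ (ℕ.+-suc k′ (suc k′)))) (ℕ.m+n∸m≡n (suc k′) (suc k′))))))
      first : (qz - 1ℤ) * + g₁ ≡ qz ^ k - 1ℤ
      first = trans (cong (_* + g₁) (trans (cong (_- 1ℤ) (sym (*-identityʳ qz))) (trans (sym (+-pow-1 1)) (cong +_ (sym (ℕ.*-identityˡ _))))))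
        (trans (sym (pos-* (gaussDen q 1) g₁)) (trans (cong +_ (trans (gauss-exact k 1) (ℕ.*-identityˡ _))) (+-pow-1 k)))
      second : + gaussDen q k′ * + g₂ ≡ + gaussNum q n k′
      second = trans (sym (pos-* (gaussDen q k′) g₂)) (cong +_ (gauss-exact n k′))

  -- A lower bound for the number of independent tuples

  geometric : ℤ → ℕ → ℤ
  geometric q zero    = 0ℤ
  geometric q (suc j) = q ^ j + geometric q j

  geometric-sum : ∀ q j → (q - 1ℤ) * geometric q j ≡ q ^ j - 1ℤ
  geometric-sum q zero    = *-zeroʳ (q - 1ℤ)
  geometric-sum q (suc j) = trans (*-distribˡ-+ (q - 1ℤ) (q ^ j) _) (trans (cong (_+_ ((q - 1ℤ) * q ^ j)) (geometric-sum q j))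
    (lemma q (q ^ j)))
    where
    lemma : ∀ q x → (q - 1ℤ) * x + (x - 1ℤ) ≡ q * x - 1ℤ
    lemma = solve-∀

  module _ {q : ℤ} (q>0 : 0ℤ < q) where

    geometric≥0 : ∀ j → 0ℤ ≤ geometric q j
    geometric≥0 zero    = ≤-refl
    geometric≥0 (suc j) = +-nonneg (<⇒≤ (^-pos j q>0)) (geometric≥0 j)

    ^-mono : ∀ {i j} → i ℕ.≤ j → q ^ i ≤ q ^ j
    ^-mono {i} {j} i≤j = subst₂ _≤_ (*-identityʳ (q ^ i))
      (trans (sym (^-distribˡ-+-* q i (j ℕ.∸ i))) (cong (q ^_) (ℕ.m+[n∸m]≡n i≤j)))
      (*-monoˡ (<⇒≤ (^-pos i q>0)) (i<j⇒suc[i]≤j (^-pos (j ℕ.∸ i) q>0)))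

    -- The product of the 1 - q^i / s is at least 1 minus the sum of the q^i / s, with denominators
    -- cleared.
    falling-lower : ∀ s j → 0ℤ ≤ s → (∀ i → i ℕ.< j → q ^ i ≤ s) → s ^ j * (s - geometric q j) ≤ falling q s j * s
    falling-lower s zero    s≥0 h = ≤-reflexive (cong (1ℤ *_) (+-identityʳ s))
    falling-lower s (suc j) s≥0 h = begin
      s * s ^ j * (s - (q ^ j + geometric q j))
        ≤⟨ ≤-witness (s ^ j * (q ^ j * geometric q j)) (*-nonneg (^-nonneg j) (*-nonneg (<⇒≤ (^-pos j q>0)) (geometric≥0 j)))
             (l₁ s (s ^ j) (q ^ j) (geometric q j)) ⟩
      (s - q ^ j) * (s ^ j * (s - geometric q j))
        ≤⟨ *-monoˡ (diff-≥0 (h j ℕ.≤-refl)) (falling-lower s j s≥0 (λ i i<j → h i (ℕ.m≤n⇒m≤1+n i<j))) ⟩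
      (s - q ^ j) * (falling q s j * s)
        ≡⟨ sym (*-assoc (s - q ^ j) (falling q s j) s) ⟩
      (s - q ^ j) * falling q s j * s ∎
      where
      open ≤-Reasoning
      ^-nonneg : ∀ j → 0ℤ ≤ s ^ j
      ^-nonneg zero    = 0≤1
      ^-nonneg (suc j) = *-nonneg s≥0 (^-nonneg j)
      l₁ : ∀ s S x g → (s - x) * (S * (s - g)) ≡ s * S * (s - (x + g)) + S * (x * g)
      l₁ = solve-∀

  -- Contradictions between the moment bounds and a large family

  module Endgame (q Q U γ I m D : ℤ) (q≥3 : + 3 ≤ q) (Q≥q⁵ : q * q * q * q * q ≤ Q) (U>0 : 0ℤ < U) (γ>0 : 0ℤ < γ)
    (product : (q - 1ℤ) * γ * D ≡ (Q - 1ℤ) * I) (I-lower : U * (Q * (Q - + 2 * q)) ≤ I) (large : (q + + 3) * D ≤ q * m) where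

    private
      b ρ : ℤ
      b = + 2 * q + + 2
      ρ = b * (q - + 2) - (q - 1ℤ)

      q>0 : 0ℤ < q
      q>0 = <-≤-trans {0ℤ} {+ 3} (+<+ (ℕ.s≤s ℕ.z≤n)) q≥3
      q-1>0 : 0ℤ < q - 1ℤ
      q-1>0 = +-monoˡ-< (- 1ℤ) {1ℤ} (<-≤-trans {1ℤ} {+ 3} (+<+ (ℕ.s≤s (ℕ.s≤s ℕ.z≤n))) q≥3)
      q-1≥0 : 0ℤ ≤ q - 1ℤ
      q-1≥0 = <⇒≤ q-1>0
      q-2≥0 : 0ℤ ≤ q - + 2
      q-2≥0 = diff-≥0 (≤-trans {+ 2} {+ 3} (+≤+ (ℕ.s≤s (ℕ.s≤s ℕ.z≤n))) q≥3)
      q+3>0 : 0ℤ < q + + 3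
      q+3>0 = +-mono-<-≤ {0ℤ} {q} {0ℤ} {+ 3} q>0 (+≤+ ℕ.z≤n)

      Q-4q>0 : 0ℤ < Q - + 4 * q
      Q-4q>0 = <-≤-trans (*-pos q>0 q-4>0) (≤-trans (≤-reflexive (l q)) (+-monoˡ-≤ (- (+ 4 * q)) Q≥q⁵))
        where
        q²≥9 : + 3 * + 3 ≤ q * q
        q²≥9 = *-mono {+ 3} {q} {+ 3} {q} (+≤+ ℕ.z≤n) (<⇒≤ q>0) q≥3 q≥3
        q-4>0 : 0ℤ < q * q * (q * q) - + 4
        q-4>0 = +-monoˡ-< (- + 4) {+ 4} (<-≤-trans {+ 4} {+ 81} (+<+ (ℕ.s≤s (ℕ.s≤s (ℕ.s≤s (ℕ.s≤s (ℕ.s≤s ℕ.z≤n))))))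
          (*-mono {+ 9} {q * q} {+ 9} {q * q} (+≤+ ℕ.z≤n) (square-nonneg q) q²≥9 q²≥9))
        l : ∀ q → q * (q * q * (q * q) - + 4) ≡ q * q * q * q * q - + 4 * q
        l = solve-∀
      Q-2q>0 : 0ℤ < Q - + 2 * q
      Q-2q>0 = subst (0ℤ <_) (l q Q) (+-mono-<-≤ Q-4q>0 (*-nonneg {+ 2} (+≤+ ℕ.z≤n) (<⇒≤ q>0)))
        where
        l : ∀ q Q → Q - + 4 * q + + 2 * q ≡ Q - + 2 * q
        l = solve-∀
      Q>q : q < Q
      Q>q = subst₂ _<_ (+-identityˡ q) (l q Q) (+-mono-<-≤ {0ℤ} {Q - + 4 * q} {q} {+ 4 * q} Q-4q>0 (≤-witness (+ 3 * q) (*-nonneg {+ 3} (+≤+ ℕ.z≤n) (<⇒≤ q>0)) (l′ q)))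
        where
        l : ∀ q Q → Q - + 4 * q + + 4 * q ≡ Q
        l = solve-∀
        l′ : ∀ q → + 4 * q ≡ q + + 3 * q
        l′ = solve-∀
      Q>0 : 0ℤ < Q
      Q>0 = <-trans q>0 Q>q
      Q-1>0 : 0ℤ < Q - 1ℤ
      Q-1>0 = <-trans q-1>0 (+-monoˡ-< (- 1ℤ) Q>q)

      UQ[Q-1]>0 : 0ℤ < U * Q * (Q - 1ℤ)
      UQ[Q-1]>0 = *-pos (*-pos U>0 Q>0) Q-1>0

      -- `product` expresses `D` through `I`, and `I-lower` estimates `I`. This turns `large` into a
      -- lower bound for `m * γ` in the quantities that occur in the moment bounds.
      base : (q + + 3) * (Q - + 2 * q) * (U * Q * (Q - 1ℤ)) ≤ q * (q - 1ℤ) * (m * γ)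
      base = begin
        (q + + 3) * (Q - + 2 * q) * (U * Q * (Q - 1ℤ))
          ≡⟨ l₁ q Q U ⟩
        (q + + 3) * ((Q - 1ℤ) * (U * (Q * (Q - + 2 * q))))
          ≤⟨ *-monoˡ (<⇒≤ q+3>0) (*-monoˡ (<⇒≤ Q-1>0) I-lower) ⟩
        (q + + 3) * ((Q - 1ℤ) * I)
          ≡⟨ cong ((q + + 3) *_) (sym product) ⟩
        (q + + 3) * ((q - 1ℤ) * γ * D)
          ≡⟨ l₂ q γ D ⟩
        (q - 1ℤ) * γ * ((q + + 3) * D)
          ≤⟨ *-monoˡ (*-nonneg q-1≥0 (<⇒≤ γ>0)) large ⟩
        (q - 1ℤ) * γ * (q * m)
          ≡⟨ l₃ q γ m ⟩
        q * (q - 1ℤ) * (m * γ) ∎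
        where
        open ≤-Reasoning
        l₁ : ∀ q Q U → (q + + 3) * (Q - + 2 * q) * (U * Q * (Q - 1ℤ)) ≡ (q + + 3) * ((Q - 1ℤ) * (U * (Q * (Q - + 2 * q))))
        l₁ = solve-∀
        l₂ : ∀ q γ D → (q + + 3) * ((q - 1ℤ) * γ * D) ≡ (q - 1ℤ) * γ * ((q + + 3) * D)
        l₂ = solve-∀
        l₃ : ∀ q γ m → (q - 1ℤ) * γ * (q * m) ≡ q * (q - 1ℤ) * (m * γ)
        l₃ = solve-∀

      base>0 : 0ℤ < (q + + 3) * (Q - + 2 * q) * (U * Q * (Q - 1ℤ))
      base>0 = *-pos (*-pos q+3>0 Q-2q>0) UQ[Q-1]>0

    m≢0 : m ≢ 0ℤ
    m≢0 e = <⇒≱ base>0 (≤-trans base (≤-reflexive (trans (cong (λ z → q * (q - 1ℤ) * (z * γ)) e) (*-zeroʳ (q * (q - 1ℤ))))))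

    no-star : ¬ (m * γ * ((q - + 2) * (ρ * ρ)) ≤ U * Q * (Q - 1ℤ) * ((q - 1ℤ) * (q - 1ℤ) * (q - 1ℤ) * Q + (q - + 2) * (b * b * (q * q * (q * q)))))
    no-star h = numeric₁ q Q q≥3 Q≥q⁵ (*-cancelˡ-≤ UQ[Q-1]>0 (begin
      U * Q * (Q - 1ℤ) * ((q + + 3) * (Q - + 2 * q) * ((q - + 2) * (ρ * ρ)))
        ≡⟨ l₁ (U * Q * (Q - 1ℤ)) ((q + + 3) * (Q - + 2 * q)) ((q - + 2) * (ρ * ρ)) ⟩
      (q - + 2) * (ρ * ρ) * ((q + + 3) * (Q - + 2 * q) * (U * Q * (Q - 1ℤ)))
        ≤⟨ *-monoˡ (*-nonneg q-2≥0 (square-nonneg ρ)) base ⟩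
      (q - + 2) * (ρ * ρ) * (q * (q - 1ℤ) * (m * γ))
        ≡⟨ l₂ ((q - + 2) * (ρ * ρ)) (q * (q - 1ℤ)) (m * γ) ⟩
      q * (q - 1ℤ) * (m * γ * ((q - + 2) * (ρ * ρ)))
        ≤⟨ *-monoˡ (*-nonneg (<⇒≤ q>0) q-1≥0) h ⟩
      q * (q - 1ℤ) * (U * Q * (Q - 1ℤ) * r)
        ≡⟨ l₃ (q * (q - 1ℤ)) (U * Q * (Q - 1ℤ)) r ⟩
      U * Q * (Q - 1ℤ) * (q * (q - 1ℤ) * r) ∎))
      where
      open ≤-Reasoning
      r : ℤ
      r = (q - 1ℤ) * (q - 1ℤ) * (q - 1ℤ) * Q + (q - + 2) * (b * b * (q * q * (q * q)))
      l₁ : ∀ a b c → a * (b * c) ≡ c * (b * a)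
      l₁ = solve-∀
      l₂ : ∀ a b c → a * (b * c) ≡ b * (c * a)
      l₂ = solve-∀
      l₃ : ∀ a b c → a * (b * c) ≡ b * (a * c)
      l₃ = solve-∀

    no-big-star : ∀ d → 0ℤ ≤ m → (q - 1ℤ) * d * γ ≤ (Q - 1ℤ) * I → m ≤ b * d →
      ¬ (γ * γ * ((m - d) * ((q - + 2) * (q - + 2) * d)) ≤ U * U * (Q * Q * Q) * ((Q - 1ℤ) * (Q - 1ℤ)) * (q * ((q - 1ℤ) * (q - 1ℤ))))
    no-big-star d m≥0 deg m≤bd h = numeric₂ q Q q≥3 Q≥q⁵ (*-cancelˡ-≤ (*-pos (*-pos UQ[Q-1]>0 UQ[Q-1]>0) (*-pos q+3>0 Q>0)) (begin
      K * K * ((q + + 3) * Q) * (+ 3 * ((q - + 2) * (q - + 2)) * (q + + 3) * (Q - + 4 * q))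
        -- (Q - 2q)² = Q (Q - 4q) + 4q². Dropping the last square exposes the factor `Q` to be
        -- cancelled.
        ≤⟨ ≤-witness (K * K * (q + + 3) * (q + + 3) * (+ 3 * ((q - + 2) * (q - + 2))) * (+ 4 * (q * q)))
             (*-nonneg (*-nonneg (*-nonneg (*-nonneg (square-nonneg K) (<⇒≤ q+3>0)) (<⇒≤ q+3>0)) 3e²≥0) (*-nonneg {+ 4} (+≤+ ℕ.z≤n) (square-nonneg q)))
             (l₁ K q Q) ⟩
      + 3 * ((q - + 2) * (q - + 2)) * ((q + + 3) * (Q - + 2 * q) * K * ((q + + 3) * (Q - + 2 * q) * K))
        ≤⟨ *-monoˡ 3e²≥0 (*-mono (<⇒≤ base>0) (≤-trans (<⇒≤ base>0) base) base base) ⟩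
      + 3 * ((q - + 2) * (q - + 2)) * (q * (q - 1ℤ) * (m * γ) * (q * (q - 1ℤ) * (m * γ)))
        ≡⟨ l₂ q m γ ⟩
      s * (γ * γ) * ((q - + 2) * (q - + 2)) * (+ 3 * m * m)
        ≤⟨ *-monoˡ (*-nonneg (*-nonneg (square-nonneg (q * (q - 1ℤ))) (square-nonneg γ)) (square-nonneg (q - + 2)))
             (*-mono (*-nonneg {+ 3} (+≤+ ℕ.z≤n) m≥0) (≤-trans m≥0 m≤bd) 3m≤ m≤bd) ⟩
      s * (γ * γ) * ((q - + 2) * (q - + 2)) * ((q + + 3) * (m - d) * (b * d))
        ≡⟨ l₃ s γ (q - + 2) (q + + 3) m d b ⟩
      s * ((q + + 3) * b) * (γ * γ * ((m - d) * ((q - + 2) * (q - + 2) * d)))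
        ≤⟨ *-monoˡ (*-nonneg (square-nonneg (q * (q - 1ℤ))) (*-nonneg (<⇒≤ q+3>0) b≥0)) h ⟩
      s * ((q + + 3) * b) * (U * U * (Q * Q * Q) * ((Q - 1ℤ) * (Q - 1ℤ)) * (q * ((q - 1ℤ) * (q - 1ℤ))))
        ≡⟨ l₄ q b U Q ⟩
      K * K * ((q + + 3) * Q) * (b * ((q - 1ℤ) * (q - 1ℤ) * ((q - 1ℤ) * (q - 1ℤ))) * (q * q * q)) ∎))
      where
      open ≤-Reasoning
      K s : ℤ
      K = U * Q * (Q - 1ℤ)
      s = q * (q - 1ℤ) * (q * (q - 1ℤ))
      3e²≥0 : 0ℤ ≤ + 3 * ((q - + 2) * (q - + 2))
      3e²≥0 = *-nonneg {+ 3} (+≤+ ℕ.z≤n) (square-nonneg (q - + 2))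
      b≥0 : 0ℤ ≤ b
      b≥0 = +-nonneg {y = + 2} (*-nonneg {+ 2} (+≤+ ℕ.z≤n) (<⇒≤ q>0)) (+≤+ ℕ.z≤n)
      d≤D : d ≤ D
      d≤D = *-cancelˡ-≤ (*-pos q-1>0 γ>0) (≤-trans (≤-reflexive (rearrange (q - 1ℤ) γ d)) (≤-trans deg (≤-reflexive (sym product))))
        where
        rearrange : ∀ a γ d → a * γ * d ≡ a * d * γ
        rearrange = solve-∀
      -- Since q m ≥ (q + 3) D ≥ (q + 3) d, at least a fraction 3 / (q + 3) of the members misses
      -- the point. This is the role of the constant 3 in the theorem.
      3m≤ : + 3 * m ≤ (q + + 3) * (m - d)
      3m≤ = ≤-witness ((q * m - (q + + 3) * D) + (q + + 3) * (D - d))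
        (+-nonneg (diff-≥0 large) (*-nonneg (<⇒≤ q+3>0) (diff-≥0 d≤D))) (l q m d D)
        where
        l : ∀ q m d D → (q + + 3) * (m - d) ≡ + 3 * m + ((q * m - (q + + 3) * D) + (q + + 3) * (D - d))
        l = solve-∀
      l₁ : ∀ K q Q → + 3 * ((q - + 2) * (q - + 2)) * ((q + + 3) * (Q - + 2 * q) * K * ((q + + 3) * (Q - + 2 * q) * K)) ≡
        K * K * ((q + + 3) * Q) * (+ 3 * ((q - + 2) * (q - + 2)) * (q + + 3) * (Q - + 4 * q))
        + K * K * (q + + 3) * (q + + 3) * (+ 3 * ((q - + 2) * (q - + 2))) * (+ 4 * (q * q))
      l₁ = solve-∀
      l₂ : ∀ q m γ → + 3 * ((q - + 2) * (q - + 2)) * (q * (q - 1ℤ) * (m * γ) * (q * (q - 1ℤ) * (m * γ))) ≡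
        q * (q - 1ℤ) * (q * (q - 1ℤ)) * (γ * γ) * ((q - + 2) * (q - + 2)) * (+ 3 * m * m)
      l₂ = solve-∀
      l₃ : ∀ s γ e c m d b → s * (γ * γ) * (e * e) * (c * (m - d) * (b * d)) ≡ s * (c * b) * (γ * γ * ((m - d) * (e * e * d)))
      l₃ = solve-∀
      l₄ : ∀ q b U Q → q * (q - 1ℤ) * (q * (q - 1ℤ)) * ((q + + 3) * b) * (U * U * (Q * Q * Q) * ((Q - 1ℤ) * (Q - 1ℤ)) * (q * ((q - 1ℤ) * (q - 1ℤ)))) ≡
        U * Q * (Q - 1ℤ) * (U * Q * (Q - 1ℤ)) * ((q + + 3) * Q) * (b * ((q - 1ℤ) * (q - 1ℤ) * ((q - 1ℤ) * (q - 1ℤ))) * (q * q * q))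
      l₄ = solve-∀

  -- Translation between spans and linear combinations

  module Bases {q : ℕ} (F : FiniteField q) (q>1 : 1ℤ < + q) (n : ℕ) where
    open Spans F q>1 n public
    open Linear F n using (lincomb; LinIndep; IsSubspaceOfDim; Sub)

    cons : ∀ {d} → Carrier → (Fin d → Carrier) → Fin (suc d) → Carrier
    cons a c Fin.zero    = a
    cons a c (Fin.suc i) = c i

    lincomb⇒span : ∀ {d} (b : Fin d → V) c → span (Vec.tabulate b) ∋ lincomb c b
    lincomb⇒span {zero}  b c = refl
    lincomb⇒span {suc d} b c = ∋⊕ (span (Vec.tabulate b)) (∋⊙ (span (Vec.tabulate b)) (c Fin.zero) (ext-∋ rest (b Fin.zero)))
      (ext-⊇ rest (b Fin.zero) _ (lincomb⇒span (b ∘ Fin.suc) (c ∘ Fin.suc)))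
      where rest = span (Vec.tabulate (b ∘ Fin.suc))

    span⇒lincomb : ∀ {d} (b : Fin d → V) v → span (Vec.tabulate b) ∋ v → ∃ λ c → v ≡ lincomb c b
    span⇒lincomb {zero}  b v e       = (λ ()) , e
    span⇒lincomb {suc d} b v (a , p) with span⇒lincomb (b ∘ Fin.suc) _ p
    ... | c , e = cons a c , trans (sym (⊕-cancel′ v (a ⊙ b Fin.zero)))
      (trans (⊕-comm _ (a ⊙ b Fin.zero)) (cong (a ⊙ b Fin.zero ⊕_) (trans (cong (v ⊕_) (sym (⊙-neg a (b Fin.zero)))) e)))

    LinIndep⇒IndepIn : ∀ {d} (b : Fin d → V) → LinIndep b → IndepIn fullS (Vec.tabulate b)
    LinIndep⇒IndepIn {zero}  b li = tt
    LinIndep⇒IndepIn {suc d} b li = (tt , not-in-rest) , LinIndep⇒IndepIn (b ∘ Fin.suc) (λ c e i → li (cons 0# c)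
        (trans (cong (_⊕ lincomb c (b ∘ Fin.suc)) (⊙-zeroˡ (b Fin.zero))) (trans (⊕-comm 𝟘 _) (trans (⊕-identityʳ _) e))) (Fin.suc i))
      where
      not-in-rest : ¬ (span (Vec.tabulate (b ∘ Fin.suc)) ∋ b Fin.zero)
      not-in-rest h with span⇒lincomb (b ∘ Fin.suc) (b Fin.zero) h
      ... | c , e = 0≢1 (sym (RP.-‿injective (trans (li (cons (-F 1#) c)
        (trans (cong (neg (b Fin.zero) ⊕_) (sym e)) (trans (⊕-comm _ _) (⊕-inverseʳ (b Fin.zero)))) Fin.zero) (sym RP.-0#≈0#))))

    IndepIn⇒LinIndep : ∀ {d} S (b : Fin d → V) → IndepIn S (Vec.tabulate b) → LinIndep b
    IndepIn⇒LinIndep {suc d} S b ((_ , h) , i) c e = λ { Fin.zero → c0≡0 ; (Fin.suc j) → IndepIn⇒LinIndep S (b ∘ Fin.suc) i (c ∘ Fin.suc) e′ j }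
      where
      rest = span (Vec.tabulate (b ∘ Fin.suc))
      c0≡0 : c Fin.zero ≡ 0#
      c0≡0 with c Fin.zero ≟F 0#
      ... | yes z = z
      ... | no nz = ⊥-elim (h (∋-unscale rest nz (∋-shift rest (lincomb⇒span (b ∘ Fin.suc) (c ∘ Fin.suc))
                      (subst (rest ∋_) (sym e) (∋0 rest)))))
      e′ : lincomb (c ∘ Fin.suc) (b ∘ Fin.suc) ≡ 𝟘
      e′ = trans (sym (⊕-identityʳ _)) (trans (⊕-comm _ 𝟘) (trans (cong (_⊕ lincomb (c ∘ Fin.suc) (b ∘ Fin.suc))
        (sym (trans (cong (_⊙ b Fin.zero) c0≡0) (⊙-zeroˡ (b Fin.zero))))) e))

    module _ {d} (P : Sub) (isSub : IsSubspaceOfDim d P) where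

      toSubspace : Subspace
      toSubspace = span (Vec.tabulate (proj₁ isSub))

      size-toSubspace : size toSubspace ≡ qz ^ d
      size-toSubspace = size-span fullS _ (LinIndep⇒IndepIn (proj₁ isSub) (proj₁ (proj₂ isSub)))

      toSubspace⇒ : ∀ v → toSubspace ∋ v → P v
      toSubspace⇒ v h = proj₂ (proj₂ (proj₂ isSub) v) (span⇒lincomb (proj₁ isSub) v h)

      ⇒toSubspace : ∀ v → P v → toSubspace ∋ v
      ⇒toSubspace v h with proj₁ (proj₂ (proj₂ isSub) v) h
      ... | c , refl = lincomb⇒span (proj₁ isSub) c

    ^-<-suc : ∀ j → qz ^ j < qz ^ suc j
    ^-<-suc j = subst (_< qz ^ suc j) (*-identityˡ (qz ^ j)) (*-monoʳ-<-pos (qz ^ j) {{positive (^-pos j q>0)}} q>1)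

    -- Greedy choice: as long as `j` is below `d`, a span of `j` vectors has fewer elements than
    -- `S`, so a new vector can be found outside it.
    independent-vectors : ∀ S d → size S ≡ qz ^ d → ∀ j → j ℕ.≤ d → ∃ λ (W : Vec V j) → IndepIn S W
    independent-vectors S d e zero    _   = [] , tt
    independent-vectors S d e (suc j) j<d with independent-vectors S d e j (ℕ.<⇒≤ j<d)
    ... | W , i with dec-∃ 𝕍 (λ w → (S ∋? w) ×-dec ¬? (span W ∋? w))
    ...   | yes (w , p) = w ∷ W , p , i
    ...   | no h = ⊥-elim (<⇒≱ (<-≤-trans (^-<-suc j) (^-mono q>0 j<d)) (subst₂ _≤_ e (size-span S W i)
              (∑-mono 𝕍 (λ v → 𝟙-mono (S ∋? v) (span W ∋? v) (λ Sv → in-span v Sv (span W ∋? v))))))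
      where
      in-span : ∀ v → S ∋ v → Dec (span W ∋ v) → span W ∋ v
      in-span v Sv (yes p) = p
      in-span v Sv (no ¬p) = ⊥-elim (h (v , Sv , ¬p))

    isSubspaceOfDim : ∀ S d → size S ≡ qz ^ d → IsSubspaceOfDim d (S ∋_)
    isSubspaceOfDim S d e with independent-vectors S d e d ℕ.≤-refl
    ... | W , i = b , IndepIn⇒LinIndep S b (subst (IndepIn S) (sym tab) i) , λ v →
        (λ Sv → span⇒lincomb b v (subst (λ z → span z ∋ v) (sym tab) (S⊆ v Sv))) ,
        (λ { (c , refl) → span-⊆ S W i _ (subst (λ z → span z ∋ lincomb c b) tab (lincomb⇒span b c)) })
      where
      b : Fin d → V
      b = Vec.lookup W
      tab : Vec.tabulate b ≡ W
      tab = Vec.tabulate∘lookup W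
      S⊆ : ∀ v → S ∋ v → span W ∋ v
      S⊆ = χ≡⇒⊇ (span W) S (⊆-size-≡ (span W) S (span-⊆ S W i) (trans (size-span S W i) (sym e)))

  -- Application to the given family

  module Main (q : ℕ) (q≥3 : 3 ℕ.≤ q) (F : FiniteField q) (k : ℕ) (k≥5 : 5 ℕ.≤ k) where

    q>1 : 1ℤ < + q
    q>1 = +<+ (ℕ.≤-trans (ℕ.s≤s (ℕ.s≤s ℕ.z≤n)) q≥3)

    q≥2 : 2 ℕ.≤ q
    q≥2 = ℕ.≤-trans (ℕ.s≤s (ℕ.s≤s ℕ.z≤n)) q≥3

    k≥2 : 2 ℕ.≤ k
    k≥2 = ℕ.≤-trans (ℕ.s≤s (ℕ.s≤s ℕ.z≤n)) k≥5

    open Moments F q>1 k k≥2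
    open Bases F q>1 (2 ℕ.* k) using (toSubspace; size-toSubspace; toSubspace⇒; ⇒toSubspace; isSubspaceOfDim)
    open Linear F (2 ℕ.* k) using (Sub; lincomb; IsSubspaceOfDim; SameSub; IntersectNontrivially; InDictator; InDualDictator)

    D : ℕ
    D = gauss q k 1 ℕ.* gauss q (2 ℕ.* k ℕ.∸ 2) (k ℕ.∸ 2)

    κ₂≡ : κ₂ ≡ qz ^ (2 ℕ.* k ℕ.∸ 2)
    κ₂≡ = cong (qz ^_) (exponent (2 ℕ.* k) (ℕ.*-monoʳ-≤ 2 k≥2))
      where
      exponent : ∀ a → 4 ℕ.≤ a → 2 ℕ.+ (a ℕ.∸ 4) ≡ a ℕ.∸ 2
      exponent (suc (suc (suc (suc a)))) _ = refl
      exponent (suc (suc (suc zero))) (ℕ.s≤s (ℕ.s≤s (ℕ.s≤s ())))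
      exponent (suc (suc zero)) (ℕ.s≤s (ℕ.s≤s ()))
      exponent (suc zero) (ℕ.s≤s ())

    product : (qz - 1ℤ) * γ * + D ≡ (Q - 1ℤ) * falling qz κ₂ k
    product = trans (gauss-product q q≥2 k k≥2) (cong (λ z → (Q - 1ℤ) * falling qz z k) (sym κ₂≡))

    I-lower : u ^ k * (Q * (Q - + 2 * qz)) ≤ falling qz κ₂ k
    I-lower = *-cancelˡ-≤ κ₂>0 (begin
      κ₂ * (u ^ k * (Q * (Q - + 2 * qz)))
        -- The k-th power of `κ₂` is `u ^ k * (Q * Q)`, and `Q * Q` is `qz * qz * κ₂`, so a factor
        -- `κ₂` splits off and Q² - q² g remains. As (q - 1) g = Q - 1, q g = 2 Q - (2 + (q - 2) g),
        -- which leaves Q (Q - 2q) plus the slack.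
        ≤⟨ ≤-witness (κ₂ * (u ^ k * (qz * (+ 2 + (qz - + 2) * g))))
             (*-nonneg κ₂≥0 (*-nonneg (<⇒≤ uᵏ>0) (*-nonneg (<⇒≤ q>0) (+-nonneg {+ 2} (+≤+ ℕ.z≤n)
               (*-nonneg (diff-≥0 {+ 2} (+≤+ q≥2)) (geometric≥0 q>0 k)))))) slack ⟩
      κ₂ ^ k * (κ₂ - g)
        ≤⟨ falling-lower q>0 κ₂ k κ₂≥0 (λ i i<k → ≤-trans (^-mono q>0 (ℕ.≤-trans (ℕ.<⇒≤ i<k) k≤)) (≤-reflexive (sym κ₂≡))) ⟩
      falling qz κ₂ k * κ₂
        ≡⟨ *-comm (falling qz κ₂ k) κ₂ ⟩
      κ₂ * falling qz κ₂ k ∎)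
      where
      open ≤-Reasoning
      g : ℤ
      g = geometric qz k
      κ₂>0 : 0ℤ < κ₂
      κ₂>0 = *-pos q>0 (*-pos q>0 u>0)
      k≤ : k ℕ.≤ 2 ℕ.* k ℕ.∸ 2
      k≤ = go k k≥2
        where
        go : ∀ k → 2 ℕ.≤ k → k ℕ.≤ 2 ℕ.* k ℕ.∸ 2
        go (suc zero) (ℕ.s≤s ())
        go (suc (suc k)) _ = subst (suc (suc k) ℕ.≤_) (cong (k ℕ.+_) (sym (ℕ.+-identityʳ (suc (suc k))))) (ℕ.m≤n+m (suc (suc k)) k)
      Q≡ : Q ≡ (qz - 1ℤ) * g + 1ℤ
      Q≡ = sym (trans (cong (_+ 1ℤ) (geometric-sum qz k)) (undo Q))
        where
        undo : ∀ x → x - 1ℤ + 1ℤ ≡ x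
        undo = solve-∀
      slack : κ₂ ^ k * (κ₂ - g) ≡ κ₂ * (u ^ k * (Q * (Q - + 2 * qz))) + κ₂ * (u ^ k * (qz * (+ 2 + (qz - + 2) * g)))
      slack = trans (cong (_* (κ₂ - g)) (trans (*-^ qz κ₃ k) (cong (Q *_) (*-^ qz u k))))
        (trans (l₁ Q (u ^ k) κ₂ g) (trans (cong (λ z → u ^ k * (z * (κ₂ - g))) QQ≡)
        (trans (l₂ (u ^ k) qz κ₂ g) (trans (cong (λ z → κ₂ * (u ^ k * (z - qz * (qz * g)))) (sym QQ≡))
        (trans (cong (λ z → κ₂ * (u ^ k * (Q * Q - qz * z))) qg≡) (l₃ κ₂ (u ^ k) Q qz g))))))
        where
        QQ≡ : Q * Q ≡ qz * qz * κ₂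
        QQ≡ = trans QQ≡uq⁴ (cong (qz * qz *_) (*-assoc qz qz u))
        l₁ : ∀ Q U x g → Q * (Q * U) * (x - g) ≡ U * ((Q * Q) * (x - g))
        l₁ = solve-∀
        l₂ : ∀ U q x g → U * (q * q * x * (x - g)) ≡ x * (U * (q * q * x - q * (q * g)))
        l₂ = solve-∀
        qg≡ : qz * g ≡ + 2 * Q - (+ 2 + (qz - + 2) * g)
        qg≡ = trans (l qz g) (cong (λ z → + 2 * z - (+ 2 + (qz - + 2) * g)) (sym Q≡))
          where
          l : ∀ q g → q * g ≡ + 2 * ((q - 1ℤ) * g + 1ℤ) - (+ 2 + (q - + 2) * g)
          l = solve-∀
        l₃ : ∀ x U Q q g → x * (U * (Q * Q - q * (+ 2 * Q - (+ 2 + (q - + 2) * g)))) ≡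
          x * (U * (Q * (Q - + 2 * q))) + x * (U * (q * (+ 2 + (q - + 2) * g)))
        l₃ = solve-∀

    Q≥q⁵ : qz * qz * qz * qz * qz ≤ Q
    Q≥q⁵ = ≤-trans (≤-reflexive (lemma qz)) (^-mono q>0 k≥5)
      where
      lemma : ∀ q → q * q * q * q * q ≡ q * (q * (q * (q * (q * 1ℤ))))
      lemma = solve-∀

    module _ (m : ℕ) (Y : Fin m → Sub) (dim : ∀ i → IsSubspaceOfDim k (Y i))
      (differ : ∀ i j → i ≢ j → ¬ SameSub (Y i) (Y j))
      (meet : ∀ i j → i ≢ j → IntersectNontrivially (Y i) (Y j)) where

      S : Fin m → Subspace
      S i = toSubspace (Y i) (dim i)

      family : Family m
      family = record
        { Y        = S
        ; size-Y   = λ i → size-toSubspace (Y i) (dim i)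
        ; distinct = λ i j e → distinct i j e (i Fin.≟ j)
        ; meets    = λ i j → meets i j (i Fin.≟ j)
        }
        where
        distinct : ∀ i j → (∀ v → χ (S i) v ≡ χ (S j) v) → Dec (i ≡ j) → i ≡ j
        distinct i j e (yes p) = p
        distinct i j e (no ¬p) = ⊥-elim (differ i j ¬p (λ v →
          (λ y → toSubspace⇒ (Y j) (dim j) v (χ≡⇒⊇ (S j) (S i) (λ x → sym (e x)) v (⇒toSubspace (Y i) (dim i) v y))) ,
          (λ y → toSubspace⇒ (Y i) (dim i) v (χ≡⇒⊇ (S i) (S j) e v (⇒toSubspace (Y j) (dim j) v y)))))
        meets : ∀ i j → Dec (i ≡ j) → ∃ λ v → v ≢ 𝟘 × S i ∋ v × S j ∋ v
        meets i j (no ¬p) with meet i j ¬p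
        ... | v , v≢0 , a , b = v , v≢0 , ⇒toSubspace (Y i) (dim i) v a , ⇒toSubspace (Y j) (dim j) v b
        -- The hypothesis speaks of different members only. On the diagonal a nonzero vector exists
        -- because a member has `Q` elements, more than one.
        meets i .i (yes refl) with dec-∃ 𝕍 (λ v → ¬? (v ≟V 𝟘) ×-dec (S i ∋? v))
        ... | yes (v , v≢0 , a) = v , v≢0 , a , a
        ... | no h = ⊥-elim (<⇒≱ q>1 (≤-trans qz<Q (≤-trans (≤-reflexive (sym (size-toSubspace (Y i) (dim i))))
                (≤-trans (∑-mono 𝕍 (λ v → 𝟙-mono (S i ∋? v) (v ≟V 𝟘) (only-zero v))) (≤-reflexive size-zeroS)))))
          where
          only-zero : ∀ v → S i ∋ v → v ≡ 𝟘
          only-zero v a with v ≟V 𝟘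
          ... | yes e = e
          ... | no  e = ⊥-elim (h (v , e , a))

      module _ (¬dictator : ¬ InDictator Y) (¬dual : ¬ InDualDictator Y) (large : (qz + + 3) * + D ≤ qz * + m) where

        open Endgame qz Q (u ^ k) γ (falling qz κ₂ k) (+ m) (+ D) (+≤+ q≥3) Q≥q⁵ uᵏ>0 (falling>0 q q≥2 k) product I-lower large

        b : ℤ
        b = + 2 * qz + + 2

        q>2 : + 2 < qz
        q>2 = +<+ q≥3

        γ≥0 : 0ℤ ≤ γ
        γ≥0 = <⇒≤ (falling>0 q q≥2 k)

        m>0 : 0ℤ < + m
        m>0 = ≤∧≢⇒< (+≤+ ℕ.z≤n) (λ e → m≢0 (sym e))

        degree : (Fin m → Subspace) → V → ℤ
        degree T v = ∑I (λ i → χ (T i) v)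

        -- A member missing `p` makes `degree-bound` available, and together with `dense-star` it
        -- contradicts `large`. The family is a parameter because the statement is applied to the
        -- complements as well.
        dense⇒common : (𝓕 : Family m) → ∀ p → p ≢ 𝟘 → ¬ (b * degree (Family.Y 𝓕) p ≤ + m) → ∀ i → Family.Y 𝓕 i ∋ p
        dense⇒common 𝓕 p p≢0 dense i = contains (Family.Y 𝓕 i ∋? p)
          where
          open Phase₂ F q>1 k k≥2 𝓕 p p≢0
          m≤bd : + m ≤ b * d₀
          m≤bd = <⇒≤ (≰⇒> dense)
          d₀>0 : 0ℤ < d₀
          d₀>0 = ≤∧≢⇒< d₀≥0 (λ e → <⇒≱ m>0 (≤-trans m≤bd (≤-reflexive (trans (cong (b *_) (sym e)) (*-zeroʳ b)))))
          contains : Dec (Family.Y 𝓕 i ∋ p) → Family.Y 𝓕 i ∋ p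
          contains (yes p∈) = p∈
          contains (no p∉)  = ⊥-elim (no-big-star d₀ (<⇒≤ m>0) (degree-bound γ≥0 i p∉) m≤bd (dense-star q>2 γ≥0 d₀>0))

        dictator : ∀ p → p ≢ 𝟘 → (∀ i → S i ∋ p) → InDictator Y
        dictator p p≢0 common = (span (p ∷ []) ∋_) , isSubspaceOfDim (span (p ∷ [])) 1
            (trans (size-line p p≢0) (sym (*-identityʳ qz))) ,
          λ i v h → toSubspace⇒ (Y i) (dim i) v (ext-least zeroS p (S i) (λ { _ refl → ∋0 (S i) }) (common i) v h)

        dual : ∀ w → w ≢ 𝟘 → (∀ i → perp (S i) ∋ w) → InDualDictator Y
        dual w w≢0 common = (perp (span (w ∷ [])) ∋_) , isSubspaceOfDim (perp (span (w ∷ []))) (2 ℕ.* k ℕ.∸ 1) size-H ,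
          λ i v h s s∈ → trans (dot-comm v s) (ext-least zeroS w (perp (S i)) (λ { _ refl → ∋0 (perp (S i)) }) (common i) s s∈ v
            (⇒toSubspace (Y i) (dim i) v h))
          where
          size-H : size (perp (span (w ∷ []))) ≡ qz ^ (2 ℕ.* k ℕ.∸ 1)
          size-H = *-cancelˡ q>0 (trans (cong (_* size (perp (span (w ∷ [])))) (sym (size-line w w≢0)))
            (trans (size-perp (span (w ∷ []))) (cong (qz ^_) (sym (ℕ.m+[n∸m]≡n {1} (ℕ.≤-trans (ℕ.s≤s ℕ.z≤n) (ℕ.*-monoʳ-≤ 2 k≥2)))))))

        b≤N : b ≤ Q + 1ℤ
        b≤N = ≤-witness ((Q - qz * qz) + ((qz - + 3) * qz + (qz - 1ℤ)))
          (+-nonneg (diff-≥0 (≤-trans (≤-reflexive (cong (qz *_) (sym (*-identityʳ qz)))) (^-mono q>0 k≥2)))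
            (+-nonneg (*-nonneg (diff-≥0 {+ 3} (+≤+ q≥3)) (<⇒≤ q>0)) q-1≥0)) (lemma qz Q)
          where
          lemma : ∀ q Q → Q + 1ℤ ≡ + 2 * q + + 2 + ((Q - q * q) + ((q - + 3) * q + (q - 1ℤ)))
          lemma = solve-∀

        sparse-or-dense : (𝓕 : Family m) → Dec (∃ λ v → v ≢ 𝟘 × ¬ (b * degree (Family.Y 𝓕) v ≤ + m))
        sparse-or-dense 𝓕 = dec-∃ 𝕍 (λ v → ¬? (v ≟V 𝟘) ×-dec ¬? ((b * degree (Family.Y 𝓕) v) ≤? + m))

        sparse : (𝓕 : Family m) → ¬ (∃ λ v → v ≢ 𝟘 × ¬ (b * degree (Family.Y 𝓕) v ≤ + m)) →
          ∀ v → v ≢ 𝟘 → b * degree (Family.Y 𝓕) v ≤ + m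
        sparse 𝓕 h v v≢0 = decidable-stable ((b * degree (Family.Y 𝓕) v) ≤? + m) (λ x → h (v , v≢0 , x))

        absurd : ⊥
        absurd with sparse-or-dense family | sparse-or-dense (perpFamily family)
        ... | yes (p , p≢0 , dense) | _ = ¬dictator (dictator p p≢0 (dense⇒common family p p≢0 dense))
        ... | no _  | yes (w , w≢0 , dense) = ¬dual (dual w w≢0 (dense⇒common (perpFamily family) w w≢0 dense))
        -- The degrees of `perpFamily` are by definition the `D⊥` of the original family, so their
        -- sparsity is exactly the hypothesis on hyperplanes.
        ... | no h | no h⊥ = no-star (Phase₁.no-dense-star F q>1 k k≥2 family b
                (+-nonneg {y = + 2} (*-nonneg {+ 2} (+≤+ ℕ.z≤n) (<⇒≤ q>0)) (+≤+ ℕ.z≤n)) b≤N m>0 q>2 γ≥0 (ρ≥0 qz Q (+≤+ q≥3) Q≥q⁵)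
                (sparse family h) (sparse (perpFamily family) h⊥))

      bound : ¬ InDictator Y → ¬ InDualDictator Y → q ℕ.* m ℕ.< (q ℕ.+ 3) ℕ.* D
      bound ¬dictator ¬dual = ℕ.≰⇒> (λ large → absurd ¬dictator ¬dual
        (subst₂ _≤_ (pos-* (q ℕ.+ 3) D) (pos-* q m) (+≤+ large)))

open import Data.Nat using (ℕ; _≤_; _<_; _+_; _*_; _∸_)
open import Data.Fin using (Fin)
open import Relation.Binary.PropositionalEquality using (_≢_)
open import Relation.Nullary using (¬_)

theorem5 : (q : ℕ) → 3 ≤ q → IsPrimePower q → (F : FiniteField q) →
    (k : ℕ) → 5 ≤ k →
    let open Linear F (2 * k) in
    (m : ℕ) → (Y : Fin m → Sub) →
    (∀ i → IsSubspaceOfDim k (Y i)) →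
    (∀ i j → i ≢ j → ¬ SameSub (Y i) (Y j)) →
    (∀ i j → i ≢ j → IntersectNontrivially (Y i) (Y j)) →
    ¬ InDictator Y → ¬ InDualDictator Y →
    q * m < (q + 3) * (gauss q k 1 * gauss q (2 * k ∸ 2) (k ∸ 2))
theorem5 q q≥3 _ F k k≥5 m Y dim differ meet ¬dictator ¬dual =
  Development.Main.bound q q≥3 F k k≥5 m Y dim differ meet ¬dictator ¬dual
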